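{- Let $m=m_n\ge 1$ and $F=F_n=f^{(1)}\times\cdots\times f^{(m)}$ be such that $(F)_2\lesssim(F)_0$. Then, as $n\to\infty$, \[ \mathbb{P}(H^*_{nmF} \text{ is connected}) \to \begin{cases} 0 & \text{if } \log n - \frac{m}{n}(F)_1 \to +\infty,\\ 1 & \text{if } \log n - \frac{m}{n}(F)_1 \to -\infty.\end{cases} \]
   Context: Shotgun random hypergraph: given integers $n,m\ge1$ and probability distributions $f^{(1)},\dots,f^{(m)}$ on $\{0,\dots,n\}$, write $F=f^{(1)}\times\cdots\times f^{(m)}$. $H^*_{nmF}$ is the random hypergraph with node set $\{1,\dots,n\}$ and hyperedge set $\{V_1,\dots,V_m\}$ (duplicates merged), where $V_1,\dots,V_m\subset\{1,\dots,n\}$ are mutually independent and $\mathbb{P}(V_k=A)=f^{(k)}(|A|)\binom{n}{|A|}^{ -1}$. A hypergraph on node set $V$ is connected if for every partition of $V$ into nonempty sets $V_1',V_2'$ some hyperedge meets both. Moments: $(F)_r=\frac1m\sum_{k=1}^m\sum_{x=2}^n x^r f^{(k)}(x)$. $a_n\lesssim b_n$ means $\limsup a_n/|b_n|<\infty$. -}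

module Defs where

open import Level using (0ℓ)
open import Data.Nat as ℕ using (ℕ; zero; suc; NonZero)
import Data.Nat.Properties as ℕ
open import Data.Nat.Combinatorics using (_C_; nCk+nC[k+1]≡[n+1]C[k+1])
import Data.Nat.Coprimality as Coprimality
import Data.Nat.Solver as ℕ-Solver
open import Data.Integer as ℤ using (ℤ; +_)
import Data.Integer.Properties as ℤ
import Data.Integer.Solver as ℤ-Solver
open import Data.Rational as ℚ using (ℚ; 0ℚ; 1ℚ; mkℚ)
import Data.Rational.Properties as ℚ
open import Data.Rational.Unnormalised.Base as ℚᵘ using (mkℚᵘ; *≡*)
import Data.Rational.Unnormalised.Properties as ℚᵘ
import Data.Rational.Solver as ℚ-Solver
open import Data.Bool.Properties using () renaming (_≟_ to _≟ᵇ_)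
open import Data.Fin using (Fin; toℕ; fromℕ<)
open import Data.Fin.Subset as Subset
  using (Subset; inside; outside; Nonempty; _∪_; _∩_; ⊤; ⊥)
open import Data.Fin.Subset.Properties using (∣p∣≤n; nonempty?; anySubset?)
open import Data.List using (List; []; _∷_; [_]; _++_; map; foldr; filter; allFin; cartesianProductWith)
open import Data.Vec as Vec using (Vec; []; _∷_)
open import Data.Vec.Properties using (≡-dec)
open import Data.Vec.Membership.Propositional using (_∈_; find; lose)
open import Data.Vec.Relation.Unary.Any using (Any; any?)
open import Data.Product using (Σ-syntax; ∃-syntax; _×_; _,_; proj₁)
open import Data.Sum using (inj₁; inj₂)
open import Function using (_∘_)
open import Relation.Nullary using (Dec; yes; no; ¬_; ¬?; _×-dec_)
open import Relation.Nullary.Decidable using (decidable-stable; map′)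
open import Relation.Unary using (Pred; Decidable)
open import Relation.Binary.PropositionalEquality
  using (_≡_; refl; sym; trans; cong; cong₂; subst; module ≡-Reasoning)

-- Real numbers are Cauchy sequences of rationals; their equality is _≃_.

IsCauchy : (ℕ → ℚ) → Set
IsCauchy x = ∀ ε → 0ℚ ℚ.< ε →
  ∃[ N ] (∀ i j → N ℕ.≤ i → N ℕ.≤ j → ℚ.∣ x i ℚ.- x j ∣ ℚ.≤ ε)

record ℝ : Set where
  constructor mkℝ
  field
    approx : ℕ → ℚ
    cauchy : IsCauchy approx

open ℝ public

infix 4 _≤_ _<_ _≃_

_≤_ : ℝ → ℝ → Set
x ≤ y = ∀ ε → 0ℚ ℚ.< ε → ∃[ N ] (∀ i → N ℕ.≤ i → approx x i ℚ.≤ approx y i ℚ.+ ε)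

_<_ : ℝ → ℝ → Set
x < y = ∃[ ε ] (0ℚ ℚ.< ε × ∃[ N ] (∀ i → N ℕ.≤ i → approx x i ℚ.+ ε ℚ.≤ approx y i))

_≃_ : ℝ → ℝ → Set
x ≃ y = x ≤ y × y ≤ x

module CauchyProperties where
  abstract

    halves : ∀ ε → ℚ.½ ℚ.* ε ℚ.+ ℚ.½ ℚ.* ε ≡ ε
    halves ε = trans (sym (ℚ.*-distribʳ-+ ε ℚ.½ ℚ.½)) (ℚ.*-identityˡ ε)

    half-pos : ∀ {ε} → 0ℚ ℚ.< ε → 0ℚ ℚ.< ℚ.½ ℚ.* ε
    half-pos {ε} 0<ε = subst (ℚ._< ℚ.½ ℚ.* ε) (ℚ.*-zeroʳ ℚ.½) (ℚ.*-monoʳ-<-pos ℚ.½ 0<ε)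

    const-cauchy : ∀ q → IsCauchy (λ _ → q)
    const-cauchy q ε 0<ε = 0 , λ _ _ _ _ →
      ℚ.≤-trans (ℚ.≤-reflexive (cong ℚ.∣_∣ (ℚ.+-inverseʳ q))) (ℚ.<⇒≤ 0<ε)

    +-cauchy : ∀ {x y} → IsCauchy x → IsCauchy y → IsCauchy (λ i → x i ℚ.+ y i)
    +-cauchy {x} {y} cx cy ε 0<ε =
      let M , hx = cx (ℚ.½ ℚ.* ε) (half-pos 0<ε)
          N , hy = cy (ℚ.½ ℚ.* ε) (half-pos 0<ε)
      in M ℕ.⊔ N , λ i j p q → begin
        ℚ.∣ (x i ℚ.+ y i) ℚ.- (x j ℚ.+ y j) ∣
          ≡⟨ cong ℚ.∣_∣ (solve 4 (λ a b c d → (a :+ b) :- (c :+ d) := (a :- c) :+ (b :- d))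
                          refl (x i) (y i) (x j) (y j)) ⟩
        ℚ.∣ (x i ℚ.- x j) ℚ.+ (y i ℚ.- y j) ∣
          ≤⟨ ℚ.∣p+q∣≤∣p∣+∣q∣ (x i ℚ.- x j) (y i ℚ.- y j) ⟩
        ℚ.∣ x i ℚ.- x j ∣ ℚ.+ ℚ.∣ y i ℚ.- y j ∣
          ≤⟨ ℚ.+-mono-≤ (hx i j (ℕ.m⊔n≤o⇒m≤o M N p) (ℕ.m⊔n≤o⇒m≤o M N q))
                        (hy i j (ℕ.m⊔n≤o⇒n≤o M N p) (ℕ.m⊔n≤o⇒n≤o M N q)) ⟩
        ℚ.½ ℚ.* ε ℚ.+ ℚ.½ ℚ.* ε ≡⟨ halves ε ⟩
        ε ∎
      where open ℚ.≤-Reasoning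
            open ℚ-Solver.+-*-Solver

    neg-cauchy : ∀ {x} → IsCauchy x → IsCauchy (λ i → ℚ.- x i)
    neg-cauchy {x} cx ε 0<ε =
      let N , h = cx ε 0<ε
      in N , λ i j p q → ℚ.≤-trans (ℚ.≤-reflexive (begin
        ℚ.∣ ℚ.- x i ℚ.- ℚ.- x j ∣ ≡⟨ cong ℚ.∣_∣ (solve 2 (λ a b → :- a :- :- b := :- (a :- b))
                                                  refl (x i) (x j)) ⟩
        ℚ.∣ ℚ.- (x i ℚ.- x j) ∣   ≡⟨ ℚ.∣-p∣≡∣p∣ (x i ℚ.- x j) ⟩
        ℚ.∣ x i ℚ.- x j ∣         ∎)) (h i j p q)
      where open ≡-Reasoning
            open ℚ-Solver.+-*-Solver

    ∣p∣≤∣p-q∣+∣q∣ : ∀ p q → ℚ.∣ p ∣ ℚ.≤ ℚ.∣ p ℚ.- q ∣ ℚ.+ ℚ.∣ q ∣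
    ∣p∣≤∣p-q∣+∣q∣ p q = subst (λ r → ℚ.∣ r ∣ ℚ.≤ ℚ.∣ p ℚ.- q ∣ ℚ.+ ℚ.∣ q ∣)
      (solve 2 (λ a b → (a :- b) :+ b := a) refl p q)
      (ℚ.∣p+q∣≤∣p∣+∣q∣ (p ℚ.- q) q)
      where open ℚ-Solver.+-*-Solver

    p-q≤r : ∀ {p q r} → p ℚ.≤ r ℚ.+ q → p ℚ.- q ℚ.≤ r
    p-q≤r {p} {q} {r} h = subst (p ℚ.- q ℚ.≤_)
      (solve 2 (λ a b → (a :+ b) :- b := a) refl r q)
      (ℚ.+-monoˡ-≤ (ℚ.- q) h)
      where open ℚ-Solver.+-*-Solver

    ∣p∣≤r : ∀ {p r} → p ℚ.≤ r → ℚ.- p ℚ.≤ r → ℚ.∣ p ∣ ℚ.≤ r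
    ∣p∣≤r {p} h₁ h₂ with ℚ.∣p∣≡p∨∣p∣≡-p p
    ... | inj₁ e = subst (ℚ._≤ _) (sym e) h₁
    ... | inj₂ e = subst (ℚ._≤ _) (sym e) h₂

    ∣p-q∣≤r : ∀ {p q r} → p ℚ.≤ r ℚ.+ q → q ℚ.≤ r ℚ.+ p → ℚ.∣ p ℚ.- q ∣ ℚ.≤ r
    ∣p-q∣≤r {p} {q} h₁ h₂ = ∣p∣≤r (p-q≤r h₁)
      (subst (ℚ._≤ _) (solve 2 (λ a b → b :- a := :- (a :- b)) refl p q) (p-q≤r h₂))
      where open ℚ-Solver.+-*-Solver

    ∣-∣-cauchy : ∀ {x} → IsCauchy x → IsCauchy (λ i → ℚ.∣ x i ∣)
    ∣-∣-cauchy {x} cx ε 0<ε =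
      let N , h = cx ε 0<ε
      in N , λ i j p q → ∣p-q∣≤r
        (ℚ.≤-trans (∣p∣≤∣p-q∣+∣q∣ (x i) (x j)) (ℚ.+-monoˡ-≤ ℚ.∣ x j ∣ (h i j p q)))
        (ℚ.≤-trans (∣p∣≤∣p-q∣+∣q∣ (x j) (x i)) (ℚ.+-monoˡ-≤ ℚ.∣ x i ∣ (h j i q p)))

    0<1 : 0ℚ ℚ.< 1ℚ
    0<1 = ℚ.positive⁻¹ 1ℚ

    bounded : ∀ {x} → IsCauchy x →
      ∃[ B ] (0ℚ ℚ.< B × ∃[ N ] (∀ i → N ℕ.≤ i → ℚ.∣ x i ∣ ℚ.≤ B))
    bounded {x} cx =
      let N , h = cx 1ℚ 0<1
      in 1ℚ ℚ.+ ℚ.∣ x N ∣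
         , ℚ.+-mono-<-≤ 0<1 (ℚ.0≤∣p∣ (x N))
         , N , λ i p → ℚ.≤-trans (∣p∣≤∣p-q∣+∣q∣ (x i) (x N))
                         (ℚ.+-monoˡ-≤ ℚ.∣ x N ∣ (h i N p ℕ.≤-refl))

    ∣*∣-mono : ∀ {p q r s} → 0ℚ ℚ.< r → ℚ.∣ p ∣ ℚ.≤ r → ℚ.∣ q ∣ ℚ.≤ s → ℚ.∣ p ℚ.* q ∣ ℚ.≤ r ℚ.* s
    ∣*∣-mono {p} {q} {r} {s} 0<r h₁ h₂ = begin
      ℚ.∣ p ℚ.* q ∣       ≡⟨ ℚ.∣p*q∣≡∣p∣*∣q∣ p q ⟩
      ℚ.∣ p ∣ ℚ.* ℚ.∣ q ∣ ≤⟨ ℚ.*-monoʳ-≤-nonNeg ℚ.∣ q ∣ ⦃ ℚ.∣-∣-nonNeg q ⦄ h₁ ⟩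
      r ℚ.* ℚ.∣ q ∣       ≤⟨ ℚ.*-monoˡ-≤-nonNeg r ⦃ ℚ.nonNegative (ℚ.<⇒≤ 0<r) ⦄ h₂ ⟩
      r ℚ.* s             ∎
      where open ℚ.≤-Reasoning

    *-cauchy : ∀ {x y} → IsCauchy x → IsCauchy y → IsCauchy (λ i → x i ℚ.* y i)
    *-cauchy {x} {y} cx cy ε 0<ε =
      let A , 0<A , K , hA = bounded cx
          B , 0<B , L , hB = bounded cy
          0<A+B = ℚ.+-mono-< 0<A 0<B
          A+B≢0 = ℚ.>-nonZero 0<A+B
          1/[A+B] = (ℚ.1/ (A ℚ.+ B)) ⦃ A+B≢0 ⦄
          δ = 1/[A+B] ℚ.* ε
          0<1/ = ℚ.positive⁻¹ 1/[A+B] ⦃ ℚ.1/pos⇒pos (A ℚ.+ B) ⦃ ℚ.positive 0<A+B ⦄ ⦄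
          0<δ = subst (ℚ._< δ) (ℚ.*-zeroʳ 1/[A+B])
                  (ℚ.*-monoʳ-<-pos 1/[A+B] ⦃ ℚ.positive 0<1/ ⦄ 0<ε)
          M , hx = cx δ 0<δ
          N , hy = cy δ 0<δ
          R = (K ℕ.⊔ L) ℕ.⊔ (M ℕ.⊔ N)
          K≤ = λ {i} (p : R ℕ.≤ i) → ℕ.m⊔n≤o⇒m≤o K L (ℕ.m⊔n≤o⇒m≤o (K ℕ.⊔ L) (M ℕ.⊔ N) p)
          L≤ = λ {i} (p : R ℕ.≤ i) → ℕ.m⊔n≤o⇒n≤o K L (ℕ.m⊔n≤o⇒m≤o (K ℕ.⊔ L) (M ℕ.⊔ N) p)
          M≤ = λ {i} (p : R ℕ.≤ i) → ℕ.m⊔n≤o⇒m≤o M N (ℕ.m⊔n≤o⇒n≤o (K ℕ.⊔ L) (M ℕ.⊔ N) p)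
          N≤ = λ {i} (p : R ℕ.≤ i) → ℕ.m⊔n≤o⇒n≤o M N (ℕ.m⊔n≤o⇒n≤o (K ℕ.⊔ L) (M ℕ.⊔ N) p)
      in R , λ i j p q → begin
        ℚ.∣ x i ℚ.* y i ℚ.- x j ℚ.* y j ∣
          ≡⟨ cong ℚ.∣_∣ (solve 4 (λ a b c d → a :* b :- c :* d := a :* (b :- d) :+ d :* (a :- c))
                          refl (x i) (y i) (x j) (y j)) ⟩
        ℚ.∣ x i ℚ.* (y i ℚ.- y j) ℚ.+ y j ℚ.* (x i ℚ.- x j) ∣
          ≤⟨ ℚ.∣p+q∣≤∣p∣+∣q∣ (x i ℚ.* (y i ℚ.- y j)) (y j ℚ.* (x i ℚ.- x j)) ⟩
        ℚ.∣ x i ℚ.* (y i ℚ.- y j) ∣ ℚ.+ ℚ.∣ y j ℚ.* (x i ℚ.- x j) ∣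
          ≤⟨ ℚ.+-mono-≤ (∣*∣-mono {x i} 0<A (hA i (K≤ p)) (hy i j (N≤ p) (N≤ q)))
                        (∣*∣-mono {y j} 0<B (hB j (L≤ q)) (hx i j (M≤ p) (M≤ q))) ⟩
        A ℚ.* δ ℚ.+ B ℚ.* δ ≡⟨ sym (ℚ.*-distribʳ-+ δ A B) ⟩
        (A ℚ.+ B) ℚ.* δ ≡⟨ sym (ℚ.*-assoc (A ℚ.+ B) 1/[A+B] ε) ⟩
        ((A ℚ.+ B) ℚ.* 1/[A+B]) ℚ.* ε
          ≡⟨ cong (ℚ._* ε) (ℚ.*-inverseʳ (A ℚ.+ B) ⦃ A+B≢0 ⦄) ⟩
        1ℚ ℚ.* ε ≡⟨ ℚ.*-identityˡ ε ⟩
        ε ∎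
      where open ℚ.≤-Reasoning
            open ℚ-Solver.+-*-Solver

open CauchyProperties

infixl 6 _+_ _-_
infixl 7 _*_
infix  8 -_

fromℚ : ℚ → ℝ
fromℚ q = mkℝ (λ _ → q) (const-cauchy q)

0ℝ 1ℝ : ℝ
0ℝ = fromℚ 0ℚ
1ℝ = fromℚ 1ℚ

_+_ : ℝ → ℝ → ℝ
x + y = mkℝ (λ i → approx x i ℚ.+ approx y i) (+-cauchy {approx x} {approx y} (cauchy x) (cauchy y))

_*_ : ℝ → ℝ → ℝ
x * y = mkℝ (λ i → approx x i ℚ.* approx y i) (*-cauchy {approx x} {approx y} (cauchy x) (cauchy y))

-_ : ℝ → ℝ
- x = mkℝ (λ i → ℚ.- approx x i) (neg-cauchy {approx x} (cauchy x))

_-_ : ℝ → ℝ → ℝ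
x - y = x + (- y)

∣_∣ : ℝ → ℝ
∣ x ∣ = mkℝ (λ i → ℚ.∣ approx x i ∣) (∣-∣-cauchy {approx x} (cauchy x))

∑ : ∀ {A : Set} → List A → (A → ℝ) → ℝ
∑ xs f = foldr _+_ 0ℝ (map f xs)

∏ : ∀ {A : Set} → List A → (A → ℝ) → ℝ
∏ xs f = foldr _*_ 1ℝ (map f xs)

-- harmonicBlock a N = 1/(a+1) + 1/(a+2) + ⋯ + 1/(a+N)
harmonicBlock : ℕ → ℕ → ℚ
harmonicBlock a zero    = 0ℚ
harmonicBlock a (suc N) = harmonicBlock a N ℚ.+ + 1 ℚ./ suc (a ℕ.+ N)

module HarmonicProperties where

  H = harmonicBlock

  recip-mkℚ : ∀ n → + 1 ℚ./ suc n ≡ mkℚ (+ 1) n (Coprimality.1-coprimeTo (suc n))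
  recip-mkℚ n = ℚ.normalize-coprime (Coprimality.1-coprimeTo (suc n))

  recip-anti : ∀ {m n} → m ℕ.≤ n → + 1 ℚ./ suc n ℚ.≤ + 1 ℚ./ suc m
  recip-anti {m} {n} m≤n rewrite recip-mkℚ m | recip-mkℚ n =
    ℚ.*≤* (ℤ.*-monoˡ-≤-nonNeg (+ 1) (ℤ.+≤+ (ℕ.s≤s m≤n)))

  recip-nonneg : ∀ n → 0ℚ ℚ.≤ + 1 ℚ./ suc n
  recip-nonneg n = ℚ.nonNegative⁻¹ _ ⦃ ℚ.normalize-nonNeg 1 (suc n) ⦄

  /-suc : ∀ l d → + suc l ℚ./ suc d ≡ + l ℚ./ suc d ℚ.+ + 1 ℚ./ suc d
  /-suc l d = ℚ.toℚᵘ-injective (begin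
    ℚ.toℚᵘ (+ suc l ℚ./ suc d) ≈⟨ ℚ.toℚᵘ-fromℚᵘ (mkℚᵘ (+ suc l) d) ⟩
    mkℚᵘ (+ suc l) d           ≈⟨ *≡* numerators ⟩
    mkℚᵘ (+ l) d ℚᵘ.+ mkℚᵘ (+ 1) d
      ≈⟨ ℚᵘ.+-cong (ℚᵘ.≃-sym (ℚ.toℚᵘ-fromℚᵘ (mkℚᵘ (+ l) d)))
                   (ℚᵘ.≃-sym (ℚ.toℚᵘ-fromℚᵘ (mkℚᵘ (+ 1) d))) ⟩
    ℚ.toℚᵘ (+ l ℚ./ suc d) ℚᵘ.+ ℚ.toℚᵘ (+ 1 ℚ./ suc d)
      ≈⟨ ℚᵘ.≃-sym (ℚ.toℚᵘ-homo-+ (+ l ℚ./ suc d) (+ 1 ℚ./ suc d)) ⟩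
    ℚ.toℚᵘ (+ l ℚ./ suc d ℚ.+ + 1 ℚ./ suc d) ∎)
    where
    open import Relation.Binary.Reasoning.Setoid ℚᵘ.≃-setoid
    open ℤ-Solver.+-*-Solver
    numerators : + suc l ℤ.* (+ suc d ℤ.* + suc d) ≡
                 (+ l ℤ.* + suc d ℤ.+ + 1 ℤ.* + suc d) ℤ.* + suc d
    numerators = solve 2 (λ x y → (con (+ 1) :+ x) :* (y :* y) :=
                                  (x :* y :+ con (+ 1) :* y) :* y) refl (+ l) (+ suc d)

  l/lb : ∀ l b → + suc l ℚ./ (suc l ℕ.* suc b) ≡ + 1 ℚ./ suc b
  l/lb l b = ℚ.fromℚᵘ-cong {mkℚᵘ (+ suc l) (b ℕ.+ l ℕ.* suc b)} {mkℚᵘ (+ 1) b}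
    (*≡* (sym (ℤ.*-identityˡ _)))

  H-lower : ∀ a i d → a ℕ.+ i ℕ.≤ suc d → + i ℚ./ suc d ℚ.≤ H a i
  H-lower a zero    d _ = ℚ.≤-reflexive (ℚ.0/n≡0 (suc d))
  H-lower a (suc i) d h = subst (ℚ._≤ H a (suc i)) (sym (/-suc i d))
    (ℚ.+-mono-≤ (H-lower a i d (ℕ.≤-trans (ℕ.+-monoʳ-≤ a (ℕ.n≤1+n i)) h))
                (recip-anti {a ℕ.+ i} {d} (ℕ.s≤s⁻¹ (subst (ℕ._≤ suc d) (ℕ.+-suc a i) h))))

  H-upper : ∀ a i d → d ℕ.≤ a → H a i ℚ.≤ + i ℚ./ suc d
  H-upper a zero    d _ = ℚ.≤-reflexive (sym (ℚ.0/n≡0 (suc d)))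
  H-upper a (suc i) d h = subst (H a (suc i) ℚ.≤_) (sym (/-suc i d))
    (ℚ.+-mono-≤ (H-upper a i d h) (recip-anti {d} {a ℕ.+ i} (ℕ.≤-trans h (ℕ.m≤m+n a i))))

  H-++ : ∀ a M N → H a (M ℕ.+ N) ≡ H a M ℚ.+ H (a ℕ.+ M) N
  H-++ a M zero = trans (cong (H a) (ℕ.+-identityʳ M)) (sym (ℚ.+-identityʳ (H a M)))
  H-++ a M (suc N) rewrite ℕ.+-suc M N | H-++ a M N | ℕ.+-assoc a M N =
    ℚ.+-assoc (H a M) (H (a ℕ.+ M) N) _

  H-split : ∀ l a N → H (l ℕ.* a) (l ℕ.* suc N) ≡
                      H (l ℕ.* a) (l ℕ.* N) ℚ.+ H (l ℕ.* (a ℕ.+ N)) l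
  H-split l a N rewrite ℕ.*-suc l N | ℕ.+-comm l (l ℕ.* N) | ℕ.*-distribˡ-+ l a N =
    H-++ (l ℕ.* a) (l ℕ.* N) l

  refine-≥ : ∀ l a N → H a N ℚ.≤ H (suc l ℕ.* a) (suc l ℕ.* N)
  refine-≥ l a zero rewrite ℕ.*-zeroʳ l = ℚ.≤-refl
  refine-≥ l a (suc N) = subst (H a (suc N) ℚ.≤_) (sym (H-split (suc l) a N))
    (ℚ.+-mono-≤ (refine-≥ l a N)
      (subst (λ q → q ℚ.≤ H (suc l ℕ.* b) (suc l)) (l/lb l b)
        (H-lower (suc l ℕ.* b) (suc l) (b ℕ.+ l ℕ.* suc b)
          (ℕ.≤-reflexive (trans (ℕ.+-comm (suc l ℕ.* b) (suc l)) (sym (ℕ.*-suc (suc l) b)))))))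
    where b = a ℕ.+ N

  refine-≤ : ∀ l a N → H (suc l ℕ.* suc a) (suc l ℕ.* N) ℚ.≤ H a N
  refine-≤ l a zero rewrite ℕ.*-zeroʳ l = ℚ.≤-refl
  refine-≤ l a (suc N) = subst (ℚ._≤ H a (suc N)) (sym (H-split (suc l) (suc a) N))
    (ℚ.+-mono-≤ (refine-≤ l a N)
      (subst (H (suc l ℕ.* suc b) (suc l) ℚ.≤_) (l/lb l b)
        (H-upper (suc l ℕ.* suc b) (suc l) (b ℕ.+ l ℕ.* suc b) (ℕ.n≤1+n _))))
    where b = a ℕ.+ N

  H-shift : ∀ a N → H a N ℚ.≤ + 1 ℚ./ suc a ℚ.+ H (suc a) N
  H-shift a N = begin
    H a N                            ≡⟨ sym (ℚ.+-identityʳ (H a N)) ⟩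
    H a N ℚ.+ 0ℚ                     ≤⟨ ℚ.+-monoʳ-≤ (H a N) (recip-nonneg (a ℕ.+ N)) ⟩
    H a (1 ℕ.+ N)                    ≡⟨ H-++ a 1 N ⟩
    H a 1 ℚ.+ H (a ℕ.+ 1) N          ≡⟨ cong₂ ℚ._+_ H1 (cong (λ k → H k N) (ℕ.+-comm a 1)) ⟩
    + 1 ℚ./ suc a ℚ.+ H (suc a) N    ∎
    where
    open ℚ.≤-Reasoning
    H1 : H a 1 ≡ + 1 ℚ./ suc a
    H1 = trans (ℚ.+-identityˡ _) (cong (λ k → + 1 ℚ./ suc k) (ℕ.+-identityʳ a))

  log-approx : ℕ → ℕ → ℚ
  log-approx p i = H (suc i) (p ℕ.* suc i)

  log-compare : ∀ p i j → log-approx p i ℚ.≤ + 1 ℚ./ suc j ℚ.+ log-approx p j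
  log-compare p i j = begin
    H (suc i) (p ℕ.* suc i)
      ≤⟨ refine-≥ j (suc i) (p ℕ.* suc i) ⟩
    H (suc j ℕ.* suc i) (suc j ℕ.* (p ℕ.* suc i))
      ≡⟨ cong₂ H (ℕ.*-comm (suc j) (suc i))
           (solve 3 (λ x y z → y :* (x :* z) := z :* (x :* y)) refl p (suc j) (suc i)) ⟩
    H (suc i ℕ.* suc j) (suc i ℕ.* (p ℕ.* suc j))
      ≤⟨ refine-≤ i j (p ℕ.* suc j) ⟩
    H j (p ℕ.* suc j)
      ≤⟨ H-shift j (p ℕ.* suc j) ⟩
    + 1 ℚ./ suc j ℚ.+ H (suc j) (p ℕ.* suc j) ∎
    where open ℚ.≤-Reasoning
          open ℕ-Solver.+-*-Solver

  archimedes : ∀ ε → 0ℚ ℚ.< ε → ∃[ N ] (+ 1 ℚ./ suc N ℚ.≤ ε)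
  archimedes (mkℚ (+ suc p) d c) _ = d , subst (ℚ._≤ mkℚ (+ suc p) d c) (sym (recip-mkℚ d))
    (ℚ.*≤* (ℤ.*-monoʳ-≤-nonNeg (+ suc d) (ℤ.+≤+ (ℕ.s≤s (ℕ.z≤n {p})))))
  archimedes (mkℚ (+ zero) d c)    (ℚ.*<* (ℤ.+<+ ()))
  archimedes (mkℚ ℤ.-[1+ _ ] d c) (ℚ.*<* ())

  abstract
    log-cauchy : ∀ p → IsCauchy (log-approx p)
    log-cauchy p ε 0<ε =
      let N , h = archimedes ε 0<ε
          bound = λ i j (q : N ℕ.≤ j) → ℚ.≤-trans (log-compare p i j)
                    (ℚ.+-monoˡ-≤ (log-approx p j) (ℚ.≤-trans (recip-anti {N} {j} q) h))
      in N , λ i j q r → ∣p-q∣≤r (bound i j r) (bound j i q)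

open HarmonicProperties

-- log n = ∫₁ⁿ dt/t.  The i-th approximation is the right-endpoint Riemann sum
-- of mesh 1/K, K = i + 1, which is
--   ∑_{j=1}^{(n-1)K} (1/K) · 1/(1 + j/K) = ∑_{j=1}^{(n-1)K} 1/(K + j).
log : (n : ℕ) → .⦃ NonZero n ⦄ → ℝ
log n = mkℝ (λ i → harmonicBlock (suc i) (ℕ.pred n ℕ.* suc i)) (log-cauchy (ℕ.pred n))

Sequence : Set
Sequence = (n : ℕ) → .⦃ NonZero n ⦄ → ℝ

Eventually : ((n : ℕ) → .⦃ NonZero n ⦄ → Set) → Set
Eventually P = ∃[ N ] (∀ n → .⦃ _ : NonZero n ⦄ → N ℕ.≤ n → P n)

infix 4 _⟶_ _⟶+∞ _⟶-∞ _≲_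

_⟶_ : Sequence → ℝ → Set
a ⟶ L = ∀ ε → 0ℝ < ε → Eventually λ n → ∣ a n - L ∣ < ε

_⟶+∞ : Sequence → Set
a ⟶+∞ = ∀ K → Eventually λ n → K < a n

_⟶-∞ : Sequence → Set
a ⟶-∞ = ∀ K → Eventually λ n → a n < K

-- lim sup aₙ/|bₙ| < ∞, cleared of denominators: where bₙ = 0 this asks for aₙ ≤ 0,
-- so the quotient 0/0 is read as 0 and a/0 as +∞ for a > 0.
_≲_ : Sequence → Sequence → Set
a ≲ b = ∃[ C ] Eventually λ n → a n ≤ C * ∣ b n ∣

-- The nodes are Fin n; a hypergraph is its set of hyperedges, so repeated hyperedges merge.
Hypergraph : ℕ → Set₁
Hypergraph n = Pred (Subset n) 0ℓ

Meets : ∀ {n} → Subset n → Subset n → Set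
Meets E A = Nonempty (E ∩ A)

IsPartition : ∀ {n} → Subset n → Subset n → Set
IsPartition A B = Nonempty A × Nonempty B × A ∪ B ≡ ⊤ × A ∩ B ≡ ⊥

Connected : ∀ {n} → Hypergraph n → Set
Connected H = ∀ A B → IsPartition A B → ∃[ E ] (H E × Meets E A × Meets E B)

hypergraph : ∀ {n m} → Vec (Subset n) m → Hypergraph n
hypergraph V E = E ∈ V

connected? : ∀ {n m} → Decidable (λ (V : Vec (Subset n) m) → Connected (hypergraph V))
connected? {n} V = map′ to from (¬? (anySubset? λ A → anySubset? λ B → violates? A B))
  where
  Joins : Subset n → Subset n → Subset n → Set
  Joins A B E = Meets E A × Meets E B

  joined? : ∀ A B → Dec (Any (Joins A B) V)
  joined? A B = any? (λ E → nonempty? (E ∩ A) ×-dec nonempty? (E ∩ B)) V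

  _≟_ : (A B : Subset n) → Dec (A ≡ B)
  _≟_ = ≡-dec _≟ᵇ_

  Violates : Subset n → Subset n → Set
  Violates A B = IsPartition A B × ¬ Any (Joins A B) V

  violates? : ∀ A B → Dec (Violates A B)
  violates? A B =
    (nonempty? A ×-dec nonempty? B ×-dec ((A ∪ B) ≟ ⊤) ×-dec ((A ∩ B) ≟ ⊥)) ×-dec ¬? (joined? A B)

  to : ¬ (∃[ A ] ∃[ B ] Violates A B) → Connected (hypergraph V)
  to h A B part = find (decidable-stable (joined? A B) λ ¬j → h (A , B , part , ¬j))

  from : Connected (hypergraph V) → ¬ (∃[ A ] ∃[ B ] Violates A B)
  from c (A , B , part , ¬j) = let E , E∈V , meets = c A B part in ¬j (lose E∈V meets)

IsDistribution : ∀ {n} → (Fin (suc n) → ℝ) → Set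
IsDistribution {n} f = (∀ x → 0ℝ ≤ f x) × ∑ (allFin (suc n)) f ≃ 1ℝ

Distribution : ℕ → Set
Distribution n = Σ[ f ∈ (Fin (suc n) → ℝ) ] IsDistribution f

pmf : ∀ {n} → Distribution n → Fin (suc n) → ℝ
pmf = proj₁

-- F = f⁽¹⁾ × ⋯ × f⁽ᵐ⁾ is represented by its factors.
ProductDistribution : ℕ → ℕ → Set
ProductDistribution n m = Fin m → Distribution n

-- (F)ᵣ = (1/m) ∑ₖ ∑_{x=2}^n xʳ f⁽ᵏ⁾(x)
moment : ∀ {n m} → .⦃ NonZero m ⦄ → ProductDistribution n m → ℕ → ℝ
moment {n} {m} F r =
  fromℚ (+ 1 ℚ./ m) *
  ∑ (allFin m) λ k →
  ∑ (filter (λ x → 2 ℕ.≤? toℕ x) (allFin (suc n))) λ x →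
    fromℚ (+ (toℕ x ℕ.^ r) ℚ./ 1) * pmf (F k) x

nCk-nonZero : ∀ {n k} → k ℕ.≤ n → NonZero (n C k)
nCk-nonZero {n}     {zero}  _           = ℕ.≢-nonZero λ ()
nCk-nonZero {suc n} {suc k} (ℕ.s≤s k≤n) =
  subst NonZero (nCk+nC[k+1]≡[n+1]C[k+1] n k)
    (ℕ.≢-nonZero λ e → ℕ.≢-nonZero⁻¹ (n C k) ⦃ nCk-nonZero k≤n ⦄ (ℕ.m+n≡0⇒m≡0 (n C k) e))

subsets : ∀ n → List (Subset n)
subsets zero    = [ [] ]
subsets (suc n) = map (outside ∷_) (subsets n) ++ map (inside ∷_) (subsets n)

tuples : ∀ {A : Set} → List A → (m : ℕ) → List (Vec A m)
tuples xs zero    = [ [] ]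
tuples xs (suc m) = cartesianProductWith _∷_ xs (tuples xs m)

-- f(|A|) / C(n, |A|)
subsetProbability : ∀ {n} → Distribution n → Subset n → ℝ
subsetProbability {n} f A =
  pmf f (fromℕ< (ℕ.s≤s (∣p∣≤n A))) *
  fromℚ ((+ 1 ℚ./ (n C Subset.∣ A ∣)) ⦃ nCk-nonZero (∣p∣≤n A) ⦄)

-- Independence of V₁, …, Vₘ: their joint law is the product of the marginal laws.
tupleProbability : ∀ {n m} → ProductDistribution n m → Vec (Subset n) m → ℝ
tupleProbability {n} {m} F V = ∏ (allFin m) λ k → subsetProbability (F k) (Vec.lookup V k)

ℙ : ∀ {n m} → ProductDistribution n m →
    {Event : Pred (Vec (Subset n) m) 0ℓ} → Decidable Event → ℝ
ℙ {n} {m} F event? = ∑ (filter event? (tuples (subsets n) m)) (tupleProbability F)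

ℙ-connected : ∀ {n m} → ProductDistribution n m → ℝ
ℙ-connected F = ℙ F connected?

{-# OPTIONS --safe #-}

-- Both limits are first reduced to rational inequalities: for every i the i-th approximations of the laws
-- are adjusted to exact rational distributions, to which finite counting applies.
--
-- Exponentials are replaced by AM-GM in the form "∑ u ≤ ∑ d implies ∏ (1 + u) ∏ (1 - d) ≤ 1", and the
-- Riemann sums of log n are related to n by the telescoping products ∏ (1 ± 1/j).
--
-- Sparse case: write pₖ = 𝔼 |Vₖ| 1(|Vₖ| ≥ 2) / n.  The number X of nodes in no edge with at least two elements
-- has mean n ∏ₖ (1 - pₖ), which is large, while (F)₂ ≲ (F)₀ makes ∑ₖ pₖ² and the correlations of
-- two such nodes negligible; X = 0 when the hypergraph is connected, so Chebyshev's inequality applies.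
--
-- Dense case: union bound over the sets A with 1 ≤ |A| ≤ n/2.  For edges V with at least two elements,
-- 1(V joins A to its complement) is at least 2Z - Z² and Z(|V| - Z)/(|V|(|V| - 1)), where Z = |A ∩ V|;
-- the first bound is used for |A| ≲ n / log n and the second one for larger A, and in both cases
-- the probabilities are compared with w^|A|/(1 + w)ⁿ, whose sum over all sets A is 1.

module Submission where

import Defs
open import Data.Fin.Base using (Fin; zero; suc; toℕ; fromℕ<)
import Data.Fin.Properties as Fin
open import Data.Fin.Subset as Subset
  using (Subset; inside; outside; _∩_; ∁; ⁅_⁆; _∈_; Nonempty)
open import Data.Fin.Subset.Properties
open import Data.Integer.Base as ℤ using ()
import Data.Integer.Properties as ℤ
import Data.Integer.Solver as ℤ-Solver
open import Data.List.Base using (List; []; _∷_; _++_; map; foldr; filter; allFin; cartesianProductWith)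
open import Data.List.Properties using (map-tabulate)
open import Data.List.Relation.Unary.All using (All; []; _∷_)
open import Data.List.Relation.Unary.All.Properties using (++⁺)
open import Data.Nat.Base as ℕ using (ℕ; zero; suc; z≤n; s≤s; NonZero)
import Data.Nat.Combinatorics as ℕ
import Data.Nat.Properties as ℕ
open import Data.Product.Base using (_,_; _×_; ∃-syntax; proj₁; proj₂)
open import Data.Rational.Base as ℚ using (ℚ; 0ℚ; 1ℚ; ½)
open import Data.Rational.Properties
open import Data.Rational.Solver using (module +-*-Solver)
import Data.Rational.Unnormalised.Base as ℚᵘ
import Data.Rational.Unnormalised.Properties as ℚᵘ
open import Data.Sum.Base using (_⊎_; inj₁; inj₂; [_,_]′; swap) renaming (map to map-⊎)
open import Data.Vec.Base using (Vec; []; _∷_; lookup; here; there)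
import Data.Vec.Membership.Propositional.Properties as Any
import Data.Vec.Relation.Unary.Any as Any
import Data.Vec.Relation.Unary.Any.Properties as Any
open import Function.Base using (_∘_; id)
open import Relation.Binary.PropositionalEquality
  using (_≡_; _≢_; refl; sym; trans; cong; cong₂; subst; subst₂; module ≡-Reasoning)
open import Relation.Nullary.Decidable using (Dec; yes; no; _×-dec_; _⊎-dec_; ¬?)
open import Relation.Nullary.Negation using (¬_; contradiction)
open import Relation.Unary using (Pred; Decidable)
open +-*-Solver using (solve; con; _:+_; _:*_; _:-_; :-_; _:=_)

-- The order of Cauchy reals is undecidable, while the estimates split cases with `≤-total` and
-- divide by positive quantities. They are therefore proved at a fixed index i, where everything is
-- rational, and the approximation errors are paid for by slack: the `1ℚ` in `T₂ ≤ b * T₀ + 1ℚ` and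
-- the margin contained in `_<_`. The dense case needs two bounds because neither is enough alone.
-- Above log n there is only an additive gap, so for single nodes the leading constant of the
-- exponent must be exact. The bound 2Z - Z² achieves this up to a relative error of order |A|/n,
-- which is affordable only while it is at most of order 1/log n. The pair bound remains linear in
-- |A| up to n/2 but loses a constant factor. For large A that loss is harmless: the weight w can be
-- of order 1/log n instead of 1/n, since n w is then still a small part of |A| log n, and a factor
-- 1/w costs only a small fraction of log n instead of all of it.

module Arithmetic where

  open Defs using (harmonicBlock; module HarmonicProperties)
  open import Data.Integer.Base using (+_)
  open import Data.Rational.Base using (_≤_; _<_; _+_; _*_; _-_; -_; _/_; 1/_; positive; nonNegative; >-nonZero; toℚᵘ)

  -- Rational arithmetic and the embedding of the natural numbers

  nat : ℕ → ℚ
  nat n = + n / 1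

  nat-+ : ∀ a b → nat (a ℕ.+ b) ≡ nat a + nat b
  nat-+ a b = toℚᵘ-injective (begin
    toℚᵘ (nat (a ℕ.+ b))             ≈⟨ toℚᵘ-fromℚᵘ (ℚᵘ.mkℚᵘ (+ (a ℕ.+ b)) 0) ⟩
    ℚᵘ.mkℚᵘ (+ (a ℕ.+ b)) 0
      ≈⟨ ℚᵘ.*≡* (cong (ℤ._* + 1) (sym (cong₂ ℤ._+_ (ℤ.*-identityʳ (+ a)) (ℤ.*-identityʳ (+ b))))) ⟩
    ℚᵘ.mkℚᵘ (+ a) 0 ℚᵘ.+ ℚᵘ.mkℚᵘ (+ b) 0
      ≈⟨ ℚᵘ.+-cong (ℚᵘ.≃-sym (toℚᵘ-fromℚᵘ (ℚᵘ.mkℚᵘ (+ a) 0))) (ℚᵘ.≃-sym (toℚᵘ-fromℚᵘ (ℚᵘ.mkℚᵘ (+ b) 0))) ⟩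
    toℚᵘ (nat a) ℚᵘ.+ toℚᵘ (nat b)   ≈⟨ ℚᵘ.≃-sym (toℚᵘ-homo-+ (nat a) (nat b)) ⟩
    toℚᵘ (nat a + nat b)             ∎)
    where open import Relation.Binary.Reasoning.Setoid ℚᵘ.≃-setoid

  nat-suc : ∀ n → nat (suc n) ≡ 1ℚ + nat n
  nat-suc = nat-+ 1

  nat-* : ∀ a b → nat (a ℕ.* b) ≡ nat a * nat b
  nat-* zero    b = sym (*-zeroˡ (nat b))
  nat-* (suc a) b = begin
    nat (b ℕ.+ a ℕ.* b)     ≡⟨ nat-+ b (a ℕ.* b) ⟩
    nat b + nat (a ℕ.* b)   ≡⟨ cong (_+_ (nat b)) (nat-* a b) ⟩
    nat b + nat a * nat b   ≡⟨ solve 2 (λ x y → y :+ x :* y := (con 1ℚ :+ x) :* y) refl (nat a) (nat b) ⟩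
    (1ℚ + nat a) * nat b    ≡⟨ cong (_* nat b) (sym (nat-suc a)) ⟩
    nat (suc a) * nat b     ∎
    where open ≡-Reasoning

  0≤1 : 0ℚ ≤ 1ℚ
  0≤1 = nonNegative⁻¹ 1ℚ

  0<1 : 0ℚ < 1ℚ
  0<1 = positive⁻¹ 1ℚ

  0≤-+ : ∀ {p q} → 0ℚ ≤ p → 0ℚ ≤ q → 0ℚ ≤ p + q
  0≤-+ = +-mono-≤

  *-monoˡ : ∀ {r p q} → 0ℚ ≤ r → p ≤ q → r * p ≤ r * q
  *-monoˡ {r} 0≤r = *-monoˡ-≤-nonNeg r ⦃ nonNegative 0≤r ⦄

  *-monoʳ : ∀ {r p q} → 0ℚ ≤ r → p ≤ q → p * r ≤ q * r
  *-monoʳ {r} 0≤r = *-monoʳ-≤-nonNeg r ⦃ nonNegative 0≤r ⦄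

  0≤-* : ∀ {p q} → 0ℚ ≤ p → 0ℚ ≤ q → 0ℚ ≤ p * q
  0≤-* {p} {q} 0≤p 0≤q = subst (_≤ p * q) (*-zeroʳ p) (*-monoˡ 0≤p 0≤q)

  *-mono : ∀ {p q r s} → 0ℚ ≤ p → 0ℚ ≤ s → p ≤ q → r ≤ s → p * r ≤ q * s
  *-mono 0≤p 0≤s p≤q r≤s = ≤-trans (*-monoˡ 0≤p r≤s) (*-monoʳ 0≤s p≤q)

  0<-* : ∀ {p q} → 0ℚ < p → 0ℚ < q → 0ℚ < p * q
  0<-* {p} {q} 0<p 0<q = subst (_< p * q) (*-zeroʳ p) (*-monoʳ-<-pos p ⦃ positive 0<p ⦄ 0<q)

  *-cancelˡ : ∀ {r p q} → 0ℚ < r → r * p ≤ r * q → p ≤ q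
  *-cancelˡ {r} 0<r = *-cancelˡ-≤-pos r ⦃ positive 0<r ⦄

  *-cancelˡ-≡ : ∀ {r p q} → 0ℚ < r → r * p ≡ r * q → p ≡ q
  *-cancelˡ-≡ 0<r e = ≤-antisym (*-cancelˡ 0<r (≤-reflexive e)) (*-cancelˡ 0<r (≤-reflexive (sym e)))

  ≤⇒0≤ : ∀ {p q} → p ≤ q → 0ℚ ≤ q - p
  ≤⇒0≤ {p} {q} p≤q = subst (_≤ q - p) (+-inverseʳ p) (+-monoˡ-≤ (- p) p≤q)

  ≤-by : ∀ {p q d} → 0ℚ ≤ d → p + d ≡ q → p ≤ q
  ≤-by {p} 0≤d e = subst₂ _≤_ (+-identityʳ p) e (+-monoʳ-≤ p 0≤d)

  0≤∣p∣² : ∀ p → 0ℚ ≤ p * p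
  0≤∣p∣² p with ≤-total 0ℚ p
  ... | inj₁ 0≤p = 0≤-* 0≤p 0≤p
  ... | inj₂ p≤0 = subst (0ℚ ≤_) (solve 1 (λ x → :- x :* :- x := x :* x) refl p)
                     (0≤-* (neg-antimono-≤ p≤0) (neg-antimono-≤ p≤0))

  0≤nat : ∀ n → 0ℚ ≤ nat n
  0≤nat n = nonNegative⁻¹ (nat n) ⦃ normalize-nonNeg n 1 ⦄

  nat-mono : ∀ {a b} → a ℕ.≤ b → nat a ≤ nat b
  nat-mono {a} a≤b with ℕ.m≤n⇒∃[o]m+o≡n a≤b
  ... | c , refl = ≤-by (0≤nat c) (sym (nat-+ a c))

  0<nat : ∀ n → 0ℚ < nat (suc n)
  0<nat n = positive⁻¹ (nat (suc n)) ⦃ normalize-pos (suc n) 1 ⦄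

  inverse : ∀ {p} → 0ℚ < p → ∃[ r ] (0ℚ < r × p * r ≡ 1ℚ)
  inverse {p} 0<p =
      (1/ p) ⦃ >-nonZero 0<p ⦄
    , positive⁻¹ _ ⦃ 1/pos⇒pos p ⦃ positive 0<p ⦄ ⦄
    , *-inverseʳ p ⦃ >-nonZero 0<p ⦄

  1/ℕ : ∀ n .⦃ _ : NonZero n ⦄ → ℚ
  1/ℕ n = + 1 / n

  nat*1/ : ∀ n .⦃ _ : NonZero n ⦄ → nat n * 1/ℕ n ≡ 1ℚ
  nat*1/ (suc n) = toℚᵘ-injective (begin
    toℚᵘ (nat (suc n) * 1/ℕ (suc n))               ≈⟨ toℚᵘ-homo-* (nat (suc n)) (1/ℕ (suc n)) ⟩
    toℚᵘ (nat (suc n)) ℚᵘ.* toℚᵘ (1/ℕ (suc n))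
      ≈⟨ ℚᵘ.*-cong (toℚᵘ-fromℚᵘ (ℚᵘ.mkℚᵘ (+ suc n) 0)) (toℚᵘ-fromℚᵘ (ℚᵘ.mkℚᵘ (+ 1) n)) ⟩
    ℚᵘ.mkℚᵘ (+ suc n) 0 ℚᵘ.* ℚᵘ.mkℚᵘ (+ 1) n       ≈⟨ ℚᵘ.*≡* numerators ⟩
    ℚᵘ.1ℚᵘ                                         ∎)
    where
    open import Relation.Binary.Reasoning.Setoid ℚᵘ.≃-setoid
    open ℤ-Solver.+-*-Solver using () renaming (solve to solveℤ; _:*_ to _⊗_; _:=_ to _⊜_; con to conℤ)
    numerators : (+ suc n ℤ.* + 1) ℤ.* + 1 ≡ + 1 ℤ.* (+ 1 ℤ.* + suc n)
    numerators = solveℤ 1 (λ x → (x ⊗ conℤ (+ 1)) ⊗ conℤ (+ 1) ⊜ conℤ (+ 1) ⊗ (conℤ (+ 1) ⊗ x)) refl (+ suc n)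

  0≤1/ : ∀ n .⦃ _ : NonZero n ⦄ → 0ℚ ≤ 1/ℕ n
  0≤1/ n = nonNegative⁻¹ (1/ℕ n) ⦃ normalize-nonNeg 1 n ⦄

  -- Finite sums and products of rationals

  Sum : ∀ {A : Set} → List A → (A → ℚ) → ℚ
  Sum xs f = foldr _+_ 0ℚ (map f xs)

  Prod : ∀ {A : Set} → List A → (A → ℚ) → ℚ
  Prod xs f = foldr _*_ 1ℚ (map f xs)

  ⟦_⟧ : ∀ {P : Set} → Dec P → ℚ
  ⟦ yes _ ⟧ = 1ℚ
  ⟦ no _ ⟧ = 0ℚ

  0≤⟦⟧ : ∀ {P : Set} (P? : Dec P) → 0ℚ ≤ ⟦ P? ⟧
  0≤⟦⟧ (yes _) = 0≤1
  0≤⟦⟧ (no _) = ≤-refl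

  Sum-0 : ∀ {A : Set} (xs : List A) → Sum xs (λ _ → 0ℚ) ≡ 0ℚ
  Sum-0 []       = refl
  Sum-0 (x ∷ xs) = trans (+-identityˡ _) (Sum-0 xs)

  Sum-+ : ∀ {A : Set} (xs : List A) (f g : A → ℚ) → Sum xs (λ x → f x + g x) ≡ Sum xs f + Sum xs g
  Sum-+ []       f g = refl
  Sum-+ (x ∷ xs) f g = trans (cong (_+_ (f x + g x)) (Sum-+ xs f g))
    (solve 4 (λ a b c d → (a :+ b) :+ (c :+ d) := (a :+ c) :+ (b :+ d)) refl
      (f x) (g x) (Sum xs f) (Sum xs g))

  module _ {A : Set} where

    Sum-cong : ∀ xs {f g : A → ℚ} → (∀ x → f x ≡ g x) → Sum xs f ≡ Sum xs g
    Sum-cong []       f≡g = refl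
    Sum-cong (x ∷ xs) f≡g = cong₂ _+_ (f≡g x) (Sum-cong xs f≡g)

    Sum-mono : ∀ xs {f g : A → ℚ} → (∀ x → f x ≤ g x) → Sum xs f ≤ Sum xs g
    Sum-mono []       f≤g = ≤-refl
    Sum-mono (x ∷ xs) f≤g = +-mono-≤ (f≤g x) (Sum-mono xs f≤g)

    Sum-nonneg : ∀ xs {f : A → ℚ} → (∀ x → 0ℚ ≤ f x) → 0ℚ ≤ Sum xs f
    Sum-nonneg []       0≤f = ≤-refl
    Sum-nonneg (x ∷ xs) 0≤f = 0≤-+ (0≤f x) (Sum-nonneg xs 0≤f)

    Sum-* : ∀ xs c (f : A → ℚ) → Sum xs (λ x → c * f x) ≡ c * Sum xs f
    Sum-* []       c f = sym (*-zeroʳ c)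
    Sum-* (x ∷ xs) c f = trans (cong (_+_ (c * f x)) (Sum-* xs c f))
      (sym (*-distribˡ-+ c (f x) (Sum xs f)))

    Sum-*ʳ : ∀ xs c (f : A → ℚ) → Sum xs (λ x → f x * c) ≡ Sum xs f * c
    Sum-*ʳ xs c f = trans (Sum-cong xs (λ x → *-comm (f x) c)) (trans (Sum-* xs c f) (*-comm c _))

    Sum-neg : ∀ xs (f : A → ℚ) → Sum xs (λ x → - f x) ≡ - Sum xs f
    Sum-neg []       f = refl
    Sum-neg (x ∷ xs) f = trans (cong (_+_ (- f x)) (Sum-neg xs f)) (sym (neg-distrib-+ (f x) (Sum xs f)))

    Sum-- : ∀ xs (f g : A → ℚ) → Sum xs (λ x → f x - g x) ≡ Sum xs f - Sum xs g
    Sum-- xs f g = trans (Sum-+ xs f (λ x → - g x)) (cong (_+_ (Sum xs f)) (Sum-neg xs g))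

    Sum-++ : ∀ xs ys (f : A → ℚ) → Sum (xs ++ ys) f ≡ Sum xs f + Sum ys f
    Sum-++ []       ys f = sym (+-identityˡ _)
    Sum-++ (x ∷ xs) ys f = trans (cong (_+_ (f x)) (Sum-++ xs ys f)) (sym (+-assoc (f x) _ _))

    Sum-map : ∀ {B : Set} (h : B → A) xs (f : A → ℚ) → Sum (map h xs) f ≡ Sum xs (f ∘ h)
    Sum-map h []       f = refl
    Sum-map h (x ∷ xs) f = cong (_+_ (f (h x))) (Sum-map h xs f)

    Sum-swap : ∀ {B : Set} xs (ys : List B) (f : A → B → ℚ) →
      Sum xs (λ x → Sum ys (f x)) ≡ Sum ys (λ y → Sum xs (λ x → f x y))
    Sum-swap []       ys f = sym (Sum-0 ys)
    Sum-swap (x ∷ xs) ys f = trans (cong (_+_ (Sum ys (f x))) (Sum-swap xs ys f))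
      (sym (Sum-+ ys (f x) (λ y → Sum xs (λ x → f x y))))

    Sum-filter : ∀ {P : Pred A _} (P? : Decidable P) xs (f : A → ℚ) →
      Sum (filter P? xs) f ≡ Sum xs (λ x → ⟦ P? x ⟧ * f x)
    Sum-filter P? []       f = refl
    Sum-filter P? (x ∷ xs) f with P? x
    ... | yes _ = cong₂ _+_ (sym (*-identityˡ (f x))) (Sum-filter P? xs f)
    ... | no  _ = trans (Sum-filter P? xs f)
                    (sym (trans (cong (_+ _) (*-zeroˡ (f x))) (+-identityˡ _)))

    Prod-cong : ∀ xs {f g : A → ℚ} → (∀ x → f x ≡ g x) → Prod xs f ≡ Prod xs g
    Prod-cong []       f≡g = refl
    Prod-cong (x ∷ xs) f≡g = cong₂ _*_ (f≡g x) (Prod-cong xs f≡g)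

    Prod-nonneg : ∀ xs {f : A → ℚ} → (∀ x → 0ℚ ≤ f x) → 0ℚ ≤ Prod xs f
    Prod-nonneg []       0≤f = 0≤1
    Prod-nonneg (x ∷ xs) 0≤f = 0≤-* (0≤f x) (Prod-nonneg xs 0≤f)

    Prod-mono : ∀ xs {f g : A → ℚ} → (∀ x → 0ℚ ≤ f x) → (∀ x → f x ≤ g x) → Prod xs f ≤ Prod xs g
    Prod-mono []       0≤f f≤g = ≤-refl
    Prod-mono (x ∷ xs) 0≤f f≤g =
      *-mono (0≤f x) (Prod-nonneg xs (λ y → ≤-trans (0≤f y) (f≤g y))) (f≤g x) (Prod-mono xs 0≤f f≤g)

    Prod-* : ∀ xs (f g : A → ℚ) → Prod xs (λ x → f x * g x) ≡ Prod xs f * Prod xs g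
    Prod-* []       f g = refl
    Prod-* (x ∷ xs) f g = trans (cong (_*_ (f x * g x)) (Prod-* xs f g))
      (solve 4 (λ a b c d → (a :* b) :* (c :* d) := (a :* c) :* (b :* d)) refl
        (f x) (g x) (Prod xs f) (Prod xs g))

    Prod-1 : ∀ xs {f : A → ℚ} → (∀ x → f x ≡ 1ℚ) → Prod xs f ≡ 1ℚ
    Prod-1 []       f≡1 = refl
    Prod-1 (x ∷ xs) f≡1 = trans (cong₂ _*_ (f≡1 x) (Prod-1 xs f≡1)) (*-identityˡ 1ℚ)

  allFin-suc : ∀ n → allFin (suc n) ≡ zero ∷ map suc (allFin n)
  allFin-suc n = cong (zero ∷_) (sym (map-tabulate id suc))

  Sum-suc : ∀ {n} (f : Fin (suc n) → ℚ) → Sum (allFin (suc n)) f ≡ f zero + Sum (allFin n) (f ∘ suc)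
  Sum-suc {n} f = trans (cong (λ xs → Sum xs f) (allFin-suc n)) (cong (_+_ (f zero)) (Sum-map suc (allFin n) f))

  Prod-map : ∀ {A B : Set} (h : B → A) xs (f : A → ℚ) → Prod (map h xs) f ≡ Prod xs (f ∘ h)
  Prod-map h []       f = refl
  Prod-map h (x ∷ xs) f = cong (_*_ (f (h x))) (Prod-map h xs f)

  Prod-suc : ∀ {n} (f : Fin (suc n) → ℚ) → Prod (allFin (suc n)) f ≡ f zero * Prod (allFin n) (f ∘ suc)
  Prod-suc {n} f = trans (cong (λ xs → Prod xs f) (allFin-suc n)) (cong (_*_ (f zero)) (Prod-map suc (allFin n) f))

  Sum-const : ∀ n c → Sum (allFin n) (λ _ → c) ≡ nat n * c
  Sum-const zero    c = sym (*-zeroˡ c)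
  Sum-const (suc n) c = begin
    Sum (allFin (suc n)) (λ _ → c)    ≡⟨ Sum-suc {n} (λ _ → c) ⟩
    c + Sum (allFin n) (λ _ → c)      ≡⟨ cong (_+_ c) (Sum-const n c) ⟩
    c + nat n * c                     ≡⟨ solve 2 (λ c x → c :+ x :* c := (con 1ℚ :+ x) :* c) refl c (nat n) ⟩
    (1ℚ + nat n) * c                  ≡⟨ cong (_* c) (sym (nat-suc n)) ⟩
    nat (suc n) * c                   ∎
    where open ≡-Reasoning

  ⟦suc≟suc⟧ : ∀ {n} (i j : Fin n) → ⟦ suc i Fin.≟ suc j ⟧ ≡ ⟦ i Fin.≟ j ⟧
  ⟦suc≟suc⟧ i j with i Fin.≟ j
  ... | yes refl = refl
  ... | no  _    = refl

  Sum-δ : ∀ {n} (i : Fin n) (f : Fin n → ℚ) → Sum (allFin n) (λ j → ⟦ i Fin.≟ j ⟧ * f j) ≡ f i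
  Sum-δ {suc n} zero    f = begin
    Sum (allFin (suc n)) (λ j → ⟦ zero Fin.≟ j ⟧ * f j)
      ≡⟨ Sum-suc (λ j → ⟦ zero Fin.≟ j ⟧ * f j) ⟩
    1ℚ * f zero + Sum (allFin n) (λ j → 0ℚ * f (suc j))
      ≡⟨ cong₂ _+_ (*-identityˡ (f zero))
          (trans (Sum-cong (allFin n) (λ j → *-zeroˡ (f (suc j)))) (Sum-0 (allFin n))) ⟩
    f zero + 0ℚ ≡⟨ +-identityʳ (f zero) ⟩
    f zero ∎
    where open ≡-Reasoning
  Sum-δ {suc n} (suc i) f = begin
    Sum (allFin (suc n)) (λ j → ⟦ suc i Fin.≟ j ⟧ * f j)
      ≡⟨ Sum-suc (λ j → ⟦ suc i Fin.≟ j ⟧ * f j) ⟩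
    0ℚ * f zero + Sum (allFin n) (λ j → ⟦ suc i Fin.≟ suc j ⟧ * f (suc j))
      ≡⟨ cong₂ _+_ (*-zeroˡ (f zero)) (Sum-cong (allFin n) (λ j → cong (_* f (suc j)) (⟦suc≟suc⟧ i j))) ⟩
    0ℚ + Sum (allFin n) (λ j → ⟦ i Fin.≟ j ⟧ * f (suc j))
      ≡⟨ trans (+-identityˡ _) (Sum-δ i (f ∘ suc)) ⟩
    f (suc i) ∎
    where open ≡-Reasoning

  Prod-++ : ∀ {A : Set} xs ys (f : A → ℚ) → Prod (xs ++ ys) f ≡ Prod xs f * Prod ys f
  Prod-++ []       ys f = sym (*-identityˡ _)
  Prod-++ (x ∷ xs) ys f = trans (cong (_*_ (f x)) (Prod-++ xs ys f)) (sym (*-assoc (f x) _ _))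

  -- Products of 1 + u and 1 - d in place of exponentials

  UnitInterval : ℚ → Set
  UnitInterval d = 0ℚ ≤ d × d ≤ 1ℚ

  0≤Sum-All : ∀ {xs} → All (0ℚ ≤_) xs → 0ℚ ≤ Sum xs id
  0≤Sum-All []       = ≤-refl
  0≤Sum-All (p ∷ ps) = 0≤-+ p (0≤Sum-All ps)

  1≤Prod-1+ : ∀ {us} → All (0ℚ ≤_) us → 1ℚ ≤ Prod us (_+_ 1ℚ)
  1≤Prod-1+ []       = ≤-refl
  1≤Prod-1+ {u ∷ us} (p ∷ ps) = *-mono {1ℚ} {1ℚ + u} 0≤1 (≤-trans 0≤1 (1≤Prod-1+ ps))
    (≤-by p refl) (1≤Prod-1+ ps)

  Prod-1+≤1 : ∀ {us} → All (0ℚ ≤_) us → Sum us id ≤ 0ℚ → Prod us (_+_ 1ℚ) ≤ 1ℚ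
  Prod-1+≤1 []       _ = ≤-refl
  Prod-1+≤1 {u ∷ us} (p ∷ ps) h = subst (λ v → (1ℚ + v) * Prod us (_+_ 1ℚ) ≤ 1ℚ) (sym u≡0)
    (≤-trans (≤-reflexive (*-identityˡ _)) (Prod-1+≤1 ps (≤-trans (≤-by p (+-comm (Sum us id) u)) h)))
    where
    u≡0 : u ≡ 0ℚ
    u≡0 = ≤-antisym (≤-trans (≤-by (0≤Sum-All ps) refl) h) p

  Prod-1-≤1-All : ∀ {ds} → All UnitInterval ds → 0ℚ ≤ Prod ds (_-_ 1ℚ) × Prod ds (_-_ 1ℚ) ≤ 1ℚ
  Prod-1-≤1-All [] = 0≤1 , ≤-refl
  Prod-1-≤1-All {d ∷ ds} ((0≤d , d≤1) ∷ ps) =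
    let 0≤D , D≤1 = Prod-1-≤1-All ps
    in 0≤-* (≤⇒0≤ d≤1) 0≤D
     , *-mono {1ℚ - d} {1ℚ} (≤⇒0≤ d≤1) 0≤1 (≤-by 0≤d (solve 1 (λ y → (con 1ℚ :- y) :+ y := con 1ℚ) refl d)) D≤1

  -- A factor 1 + u against a factor 1 - d merges into the single factor 1 + (u - d),
  -- which only increases the product and leaves the balance of the sums unchanged.
  1+u*1-d≤1 : ∀ us ds → All (0ℚ ≤_) us → All UnitInterval ds → Sum us id ≤ Sum ds id →
    Prod us (_+_ 1ℚ) * Prod ds (_-_ 1ℚ) ≤ 1ℚ
  1+u-against-1-d : ∀ u us ds → 0ℚ ≤ u → All (0ℚ ≤_) us → All UnitInterval ds → u + Sum us id ≤ Sum ds id →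
    ((1ℚ + u) * Prod us (_+_ 1ℚ)) * Prod ds (_-_ 1ℚ) ≤ 1ℚ
  1+u*1-d≤1 [] ds [] pd h = ≤-trans (≤-reflexive (*-identityˡ _)) (proj₂ (Prod-1-≤1-All pd))
  1+u*1-d≤1 (u ∷ us) ds (p ∷ pu) pd h = 1+u-against-1-d u us ds p pu pd h
  1+u-against-1-d u us [] p pu pd h = ≤-trans (≤-reflexive (*-identityʳ _)) (Prod-1+≤1 (p ∷ pu) h)
  1+u-against-1-d u us (d ∷ ds) p pu ((0≤d , d≤1) ∷ pd) h with ≤-total d u
  ... | inj₁ d≤u = ≤-trans
    (≤-by (0≤-* (0≤-* p 0≤d) (0≤-* (≤-trans 0≤1 (1≤Prod-1+ pu)) (proj₁ (Prod-1-≤1-All pd))))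
      (solve 4 (λ u d P D → ((con 1ℚ :+ u) :* P) :* ((con 1ℚ :- d) :* D) :+ (u :* d) :* (P :* D)
                         := ((con 1ℚ :+ (u :- d)) :* P) :* D) refl u d (Prod us (_+_ 1ℚ)) (Prod ds (_-_ 1ℚ))))
    (1+u-against-1-d (u - d) us ds (≤⇒0≤ d≤u) pu pd
      (≤-by (≤⇒0≤ h) (solve 4 (λ u d S T → ((u :- d) :+ S) :+ ((d :+ T) :- (u :+ S)) := T) refl
        u d (Sum us id) (Sum ds id))))
  ... | inj₂ u≤d = ≤-trans
    (≤-by (0≤-* (0≤-* p 0≤d) (0≤-* (≤-trans 0≤1 (1≤Prod-1+ pu)) (proj₁ (Prod-1-≤1-All pd))))
      (solve 4 (λ u d P D → ((con 1ℚ :+ u) :* P) :* ((con 1ℚ :- d) :* D) :+ (u :* d) :* (P :* D)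
                         := P :* ((con 1ℚ :- (d :- u)) :* D)) refl u d (Prod us (_+_ 1ℚ)) (Prod ds (_-_ 1ℚ))))
    (1+u*1-d≤1 us (d - u ∷ ds) pu
      ((≤⇒0≤ u≤d , ≤-trans (≤-by p (solve 2 (λ u d → (d :- u) :+ u := d) refl u d)) d≤1) ∷ pd)
      (≤-by (≤⇒0≤ h) (solve 4 (λ u d S T → S :+ ((d :+ T) :- (u :+ S)) := (d :- u) :+ T) refl
        u d (Sum us id) (Sum ds id))))

  -- A rational certificate for P ≤ eˢ: P is bounded by a product of factors 1 + u with ∑ u ≤ S.
  infix 4 _≼exp_
  _≼exp_ : ℚ → ℚ → Set
  P ≼exp S = ∃[ us ] (All (0ℚ ≤_) us × Sum us id ≤ S × P ≤ Prod us (_+_ 1ℚ))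

  1+-≼exp : ∀ {u} → 0ℚ ≤ u → 1ℚ + u ≼exp u
  1+-≼exp {u} 0≤u = u ∷ [] , 0≤u ∷ [] , ≤-reflexive (+-identityʳ u) , ≤-reflexive (sym (*-identityʳ _))

  *-≼exp : ∀ {P Q S T} → 0ℚ ≤ P → P ≼exp S → Q ≼exp T → P * Q ≼exp S + T
  *-≼exp 0≤P (us , pu , hu , hP) (vs , pv , hv , hQ) =
      us ++ vs , ++⁺ pu pv
    , ≤-trans (≤-reflexive (Sum-++ us vs id)) (+-mono-≤ hu hv)
    , ≤-trans (*-mono 0≤P (≤-trans 0≤1 (1≤Prod-1+ pv)) hP hQ) (≤-reflexive (sym (Prod-++ us vs _)))

  weaken-≼exp : ∀ {P S T} → S ≤ T → P ≼exp S → P ≼exp T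
  weaken-≼exp S≤T (us , pu , hu , hP) = us , pu , ≤-trans hu S≤T , hP

  infixr 8 _^_
  _^_ : ℚ → ℕ → ℚ
  p ^ zero  = 1ℚ
  p ^ suc n = p * p ^ n

  ^-nonneg : ∀ {p} → 0ℚ ≤ p → ∀ n → 0ℚ ≤ p ^ n
  ^-nonneg 0≤p zero    = 0≤1
  ^-nonneg 0≤p (suc n) = 0≤-* 0≤p (^-nonneg 0≤p n)

  ^-≼exp : ∀ {P S} → 0ℚ ≤ P → P ≼exp S → ∀ n → P ^ n ≼exp nat n * S
  ^-≼exp {S = S} 0≤P h zero    = [] , [] , ≤-reflexive (sym (*-zeroˡ S)) , ≤-refl
  ^-≼exp {P} {S} 0≤P h (suc n) = subst (P ^ suc n ≼exp_)
    (trans (solve 2 (λ x s → s :+ x :* s := (con 1ℚ :+ x) :* s) refl (nat n) S) (cong (_* S) (sym (nat-suc n))))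
    (*-≼exp 0≤P h (^-≼exp 0≤P h n))

  -- The way a certificate is spent: factors `1ℚ - d` whose d sum to at least S play the part of e
  -- to the power -S.
  ≼exp-bound : ∀ {P S} → P ≼exp S → ∀ ds → All UnitInterval ds → S ≤ Sum ds id → P * Prod ds (_-_ 1ℚ) ≤ 1ℚ
  ≼exp-bound (us , pu , hu , hP) ds pd h =
    ≤-trans (*-monoʳ (proj₁ (Prod-1-≤1-All pd)) hP) (1+u*1-d≤1 us ds pu pd (≤-trans hu h))

  ≼exp-bound-family : ∀ {A : Set} {P S} → P ≼exp S → ∀ (xs : List A) (d : A → ℚ) →
    (∀ x → UnitInterval (d x)) → S ≤ Sum xs d → P * Prod xs (λ x → 1ℚ - d x) ≤ 1ℚ
  ≼exp-bound-family {P = P} hP xs d hd h =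
    subst (λ z → P * z ≤ 1ℚ) (Prod-map d xs (_-_ 1ℚ))
      (≼exp-bound hP (map d xs) (all xs) (≤-trans h (≤-reflexive (sym (Sum-map d xs id)))))
    where
    all : ∀ xs → All UnitInterval (map d xs)
    all []       = []
    all (x ∷ xs) = hd x ∷ all xs

  -- Riemann sums of the logarithm

  harmonicTerms : ℕ → ℕ → List ℚ
  harmonicTerms a zero    = []
  harmonicTerms a (suc N) = 1/ℕ (suc (a ℕ.+ N)) ∷ harmonicTerms a N

  Sum-harmonicTerms : ∀ a N → Sum (harmonicTerms a N) id ≡ harmonicBlock a N
  Sum-harmonicTerms a zero    = refl
  Sum-harmonicTerms a (suc N) = trans (cong (_+_ (1/ℕ (suc (a ℕ.+ N)))) (Sum-harmonicTerms a N))
      (+-comm (1/ℕ (suc (a ℕ.+ N))) _)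

  harmonicTerms-unit : ∀ a N → All UnitInterval (harmonicTerms a N)
  harmonicTerms-unit a zero    = []
  harmonicTerms-unit a (suc N) =
    (HarmonicProperties.recip-nonneg (a ℕ.+ N) , HarmonicProperties.recip-anti {0} {a ℕ.+ N} z≤n) ∷
        harmonicTerms-unit a N

  harmonicTerms-nonneg : ∀ a N → All (0ℚ ≤_) (harmonicTerms a N)
  harmonicTerms-nonneg a zero    = []
  harmonicTerms-nonneg a (suc N) = HarmonicProperties.recip-nonneg (a ℕ.+ N) ∷ harmonicTerms-nonneg a N

  harmonic-up : ∀ a N → nat (suc a) * Prod (harmonicTerms a N) (_+_ 1ℚ) ≡ nat (suc (a ℕ.+ N))
  harmonic-up a zero    = trans (*-identityʳ _) (cong (nat ∘ suc) (sym (ℕ.+-identityʳ a)))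
  harmonic-up a (suc N) = begin
    nat (suc a) * ((1ℚ + r) * P)
      ≡⟨ solve 3 (λ x r P → x :* ((con 1ℚ :+ r) :* P) := (x :* P) :+ (x :* P) :* r) refl (nat (suc a)) r P ⟩
    nat (suc a) * P + (nat (suc a) * P) * r   ≡⟨ cong (λ z → z + z * r) (harmonic-up a N) ⟩
    nat (suc b) + nat (suc b) * r             ≡⟨ cong (_+_ (nat (suc b))) (nat*1/ (suc b)) ⟩
    nat (suc b) + 1ℚ                          ≡⟨ +-comm (nat (suc b)) 1ℚ ⟩
    1ℚ + nat (suc b)                          ≡⟨ sym (nat-suc (suc b)) ⟩
    nat (suc (suc b))                         ≡⟨ cong (nat ∘ suc) (sym (ℕ.+-suc a N)) ⟩
    nat (suc (a ℕ.+ suc N))                   ∎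
    where
    open ≡-Reasoning
    b = a ℕ.+ N
    r = 1/ℕ (suc b)
    P = Prod (harmonicTerms a N) (_+_ 1ℚ)

  harmonic-down : ∀ a N → nat (a ℕ.+ N) * Prod (harmonicTerms a N) (_-_ 1ℚ) ≡ nat a
  harmonic-down a zero    = trans (*-identityʳ _) (cong nat (ℕ.+-identityʳ a))
  harmonic-down a (suc N) = begin
    nat (a ℕ.+ suc N) * ((1ℚ - r) * P)        ≡⟨ cong (λ k → nat k * ((1ℚ - r) * P)) (ℕ.+-suc a N) ⟩
    nat (suc b) * ((1ℚ - r) * P)
      ≡⟨ solve 3 (λ x r P → x :* ((con 1ℚ :- r) :* P) := (x :- x :* r) :* P) refl (nat (suc b)) r P ⟩
    (nat (suc b) - nat (suc b) * r) * P       ≡⟨ cong (λ z → (nat (suc b) - z) * P) (nat*1/ (suc b)) ⟩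
    (nat (suc b) - 1ℚ) * P                    ≡⟨ cong (λ z → (z - 1ℚ) * P) (nat-suc b) ⟩
    (1ℚ + nat b - 1ℚ) * P
        ≡⟨ cong (_* P) (solve 1 (λ x → con 1ℚ :+ x :- con 1ℚ := x) refl (nat b)) ⟩
    nat b * P                                 ≡⟨ harmonic-down a N ⟩
    nat a                                     ∎
    where
    open ≡-Reasoning
    b = a ℕ.+ N
    r = 1/ℕ (suc b)
    P = Prod (harmonicTerms a N) (_-_ 1ℚ)

  -- The i-th approximation to log (1 + p).
  logApprox : ℕ → ℕ → ℚ
  logApprox = HarmonicProperties.log-approx

  -- The block from 1/(i + 1) on, one term earlier than in `logApprox`, has ∏ (1 + 1/j) = (i + 1 +
  -- N)/(i + 1), which is exactly p + 1 for N = p(i + 1). Shifting the block costs at most 1/(i + 1)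
  -- ≤ 1, hence the `1ℚ` in the exponent.
  n≼exp-log : ∀ p i → nat (suc p) ≼exp logApprox p i + 1ℚ
  n≼exp-log p i = harmonicTerms i N , harmonicTerms-nonneg i N
    , ≤-trans (≤-reflexive (Sum-harmonicTerms i N))
        (≤-trans (HarmonicProperties.H-shift i N)
          (≤-trans (+-monoˡ-≤ (logApprox p i) (HarmonicProperties.recip-anti {0} {i} z≤n))
              (≤-reflexive (+-comm 1ℚ (logApprox p i)))))
    , ≤-reflexive (*-cancelˡ-≡ (0<nat i) (trans (sym (nat-* (suc i) (suc p)))
        (trans (cong nat (ℕ.*-comm (suc i) (suc p))) (sym (harmonic-up i N)))))
    where
    N = p ℕ.* suc i

  -- The terms of `logApprox p i` themselves, taken as factors 1 - 1/j, multiply to (i + 1)/(i + 1 +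
  -- N) = 1/(p + 1), so in this direction there is no additive loss.
  ≼exp-log : ∀ p i {P} → 0ℚ ≤ P → P ≼exp logApprox p i → P ≤ nat (suc p)
  ≼exp-log p i {P} 0≤P h = begin
    P                ≡⟨ sym (*-identityʳ P) ⟩
    P * 1ℚ           ≡⟨ cong (_*_ P) (sym nD≡1) ⟩
    P * (n * D)      ≡⟨ solve 3 (λ P n D → P :* (n :* D) := n :* (P :* D)) refl P n D ⟩
    n * (P * D)      ≤⟨ *-monoˡ (0≤nat (suc p)) (≼exp-bound h (harmonicTerms (suc i) N) (harmonicTerms-unit (suc i) N)
                          (≤-reflexive (sym (Sum-harmonicTerms (suc i) N)))) ⟩
    n * 1ℚ           ≡⟨ *-identityʳ n ⟩
    n                ∎
    where
    open ≤-Reasoning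
    N = p ℕ.* suc i
    n = nat (suc p)
    D = Prod (harmonicTerms (suc i) N) (_-_ 1ℚ)
    nD≡1 : n * D ≡ 1ℚ
    nD≡1 = *-cancelˡ-≡ (0<nat i) (trans (sym (*-assoc (nat (suc i)) n D))
      (trans (cong (_* D) (trans (sym (nat-* (suc i) (suc p))) (cong nat (ℕ.*-comm (suc i) (suc p)))))
        (trans (harmonic-down (suc i) N) (sym (*-identityʳ _)))))

open Arithmetic

module Counting where

  open Defs using (subsets; tuples; Connected; connected?; hypergraph)
  open import Data.Rational.Base using (_≤_; _<_; _+_; _*_; _-_)
  open Subset using (∣_∣)

  -- Sums over subsets of functions of the size

  Sum-subsets-suc : ∀ n (f : Subset (suc n) → ℚ) →
    Sum (subsets (suc n)) f ≡ Sum (subsets n) (f ∘ (outside ∷_)) + Sum (subsets n) (f ∘ (inside ∷_))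
  Sum-subsets-suc n f = trans (Sum-++ (map (outside ∷_) (subsets n)) _ f)
    (cong₂ _+_ (Sum-map (outside ∷_) (subsets n) f) (Sum-map (inside ∷_) (subsets n) f))

  sizeSum : ℕ → (ℕ → ℚ) → ℚ
  sizeSum n g = Sum (subsets n) (λ V → g ∣ V ∣)

  sizeSum-suc : ∀ n g → sizeSum (suc n) g ≡ sizeSum n g + sizeSum n (g ∘ suc)
  sizeSum-suc n g = Sum-subsets-suc n (λ V → g ∣ V ∣)

  sizeSum-cong : ∀ n {g h} → (∀ x → g x ≡ h x) → sizeSum n g ≡ sizeSum n h
  sizeSum-cong n e = Sum-cong (subsets n) (λ V → e ∣ V ∣)

  -- The identity x C(n + 1, x) = (n + 1) C(n, x - 1) summed against g: both sides count pairs of a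
  -- set and one of its nodes, the left one by fixing the node first.
  sizeSum-weighted : ∀ n g → nat (suc n) * sizeSum n (g ∘ suc) ≡ sizeSum (suc n) (λ x → nat x * g x)
  sizeSum-weighted zero g = solve 2 (λ a b → con 1ℚ :* (b :+ con 0ℚ) := con 0ℚ :* a :+ (con 1ℚ :* b :+ con 0ℚ)) refl
      (g 0) (g 1)
  sizeSum-weighted (suc n) g = begin
    nat (2 ℕ.+ n) * sizeSum (suc n) (g ∘ suc)
      ≡⟨ cong (_* sizeSum (suc n) (g ∘ suc)) (nat-suc (suc n)) ⟩
    (1ℚ + N) * sizeSum (suc n) (g ∘ suc)
      ≡⟨ solve 2 (λ N s → (con 1ℚ :+ N) :* s := N :* s :+ s) refl N (sizeSum (suc n) (g ∘ suc)) ⟩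
    N * sizeSum (suc n) (g ∘ suc) + sizeSum (suc n) (g ∘ suc)
      ≡⟨ cong (λ z → N * z + sizeSum (suc n) (g ∘ suc)) (sizeSum-suc n (g ∘ suc)) ⟩
    N * (sizeSum n (g ∘ suc) + sizeSum n (λ x → g (2 ℕ.+ x))) + sizeSum (suc n) (g ∘ suc)
      ≡⟨ cong (_+ sizeSum (suc n) (g ∘ suc)) (*-distribˡ-+ N (sizeSum n (g ∘ suc)) _) ⟩
    N * sizeSum n (g ∘ suc) + N * sizeSum n (λ x → g (2 ℕ.+ x)) + sizeSum (suc n) (g ∘ suc)
      ≡⟨ cong (_+ sizeSum (suc n) (g ∘ suc)) (cong₂ _+_ (sizeSum-weighted n g) (sizeSum-weighted n (g ∘ suc))) ⟩
    sizeSum (suc n) (λ x → nat x * g x) + sizeSum (suc n) (λ x → nat x * g (suc x)) + sizeSum (suc n) (g ∘ suc)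
      ≡⟨ +-assoc (sizeSum (suc n) (λ x → nat x * g x)) _ _ ⟩
    sizeSum (suc n) (λ x → nat x * g x) + (sizeSum (suc n) (λ x → nat x * g (suc x)) + sizeSum (suc n) (g ∘ suc))
      ≡⟨ cong (_+_ (sizeSum (suc n) (λ x → nat x * g x)))
          (trans (sym (Sum-+ (subsets (suc n)) _ _)) (sizeSum-cong (suc n) merge)) ⟩
    sizeSum (suc n) (λ x → nat x * g x) + sizeSum (suc n) (λ x → nat (suc x) * g (suc x))
      ≡⟨ sym (sizeSum-suc (suc n) (λ x → nat x * g x)) ⟩
    sizeSum (2 ℕ.+ n) (λ x → nat x * g x) ∎
    where
    open ≡-Reasoning
    N = nat (suc n)
    merge : ∀ x → nat x * g (suc x) + g (suc x) ≡ nat (suc x) * g (suc x)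
    merge x = trans (solve 2 (λ x y → x :* y :+ y := (con 1ℚ :+ x) :* y) refl (nat x) (g (suc x)))
      (cong (_* g (suc x)) (sym (nat-suc x)))

  sizeSum-weighted₂ : ∀ n g → nat (2 ℕ.+ n) * (nat (suc n) * sizeSum n (λ x → g (2 ℕ.+ x))) ≡
    sizeSum (2 ℕ.+ n) (λ x → nat x * ((nat x - 1ℚ) * g x))
  sizeSum-weighted₂ n g = trans (cong (_*_ (nat (2 ℕ.+ n))) (trans (sizeSum-weighted n (g ∘ suc))
      (sizeSum-cong (suc n) λ x → cong (_* g (suc x)) (pred x))))
    (sizeSum-weighted (suc n) (λ x → (nat x - 1ℚ) * g x))
    where
    pred : ∀ x → nat x ≡ nat (suc x) - 1ℚ
    pred x = trans (solve 1 (λ y → y := con 1ℚ :+ y :- con 1ℚ) refl (nat x)) (cong (_- 1ℚ) (sym (nat-suc x)))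

  -- Moments of the intersection with a fixed set

  χ : ∀ {n} → Subset n → Fin n → ℚ
  χ (_       ∷ V) (suc i) = χ V i
  χ (inside  ∷ V) zero    = 1ℚ
  χ (outside ∷ V) zero    = 0ℚ

  χ-idem : ∀ {n} (V : Subset n) i → χ V i * χ V i ≡ χ V i
  χ-idem (inside  ∷ V) zero    = refl
  χ-idem (outside ∷ V) zero    = refl
  χ-idem (_       ∷ V) (suc i) = χ-idem V i

  Sum-χ : ∀ {n} (V : Subset n) → Sum (allFin n) (χ V) ≡ nat ∣ V ∣
  Sum-χ []            = refl
  Sum-χ (inside  ∷ V) = trans (Sum-suc (χ (inside ∷ V))) (trans (cong (_+_ 1ℚ) (Sum-χ V)) (sym (nat-suc ∣ V ∣)))
  Sum-χ (outside ∷ V) = trans (Sum-suc (χ (outside ∷ V))) (trans (+-identityˡ _) (Sum-χ V))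

  χ-∩ : ∀ {n} (A V : Subset n) i → χ (A ∩ V) i ≡ χ A i * χ V i
  χ-∩ (inside  ∷ A) (inside  ∷ V) zero = refl
  χ-∩ (inside  ∷ A) (outside ∷ V) zero = refl
  χ-∩ (outside ∷ A) (inside  ∷ V) zero = refl
  χ-∩ (outside ∷ A) (outside ∷ V) zero = refl
  χ-∩ (_ ∷ A) (_ ∷ V) (suc i) = χ-∩ A V i

  Sum-χ-∩ : ∀ {n} (A V : Subset n) → nat ∣ A ∩ V ∣ ≡ Sum (allFin n) (λ i → χ A i * χ V i)
  Sum-χ-∩ {n} A V = trans (sym (Sum-χ (A ∩ V))) (Sum-cong (allFin n) (χ-∩ A V))

  containing₁ : ∀ n (i : Fin (suc n)) (g : ℕ → ℚ) →
      Sum (subsets (suc n)) (λ V → χ V i * g ∣ V ∣) ≡ sizeSum n (g ∘ suc)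
  containing₁ n zero g = trans (Sum-subsets-suc n _) (trans
    (cong₂ _+_ (trans (Sum-cong (subsets n) (λ V → *-zeroˡ (g ∣ V ∣))) (Sum-0 (subsets n)))
               (Sum-cong (subsets n) (λ V → *-identityˡ (g (suc ∣ V ∣)))))
    (+-identityˡ _))
  containing₁ (suc n) (suc i) g = trans (Sum-subsets-suc (suc n) _) (trans
    (cong₂ _+_ (containing₁ n i g) (containing₁ n i (g ∘ suc)))
    (sym (sizeSum-suc n (g ∘ suc))))

  containing₂ : ∀ n (i j : Fin (2 ℕ.+ n)) → i ≢ j → (g : ℕ → ℚ) →
    Sum (subsets (2 ℕ.+ n)) (λ V → (χ V i * χ V j) * g ∣ V ∣) ≡ sizeSum n (λ x → g (2 ℕ.+ x))
  containing₂ n zero zero i≢j g = contradiction refl i≢j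
  containing₂ n zero (suc j) i≢j g = trans (Sum-subsets-suc (suc n) _) (trans
    (cong₂ _+_ (trans (Sum-cong (subsets (suc n)) (λ V →
                   trans (cong (_* g ∣ V ∣) (*-zeroˡ (χ V j))) (*-zeroˡ (g ∣ V ∣)))) (Sum-0 (subsets (suc n))))
               (Sum-cong (subsets (suc n)) (λ V → cong (_* g (suc ∣ V ∣)) (*-identityˡ (χ V j)))))
    (trans (+-identityˡ _) (containing₁ n j (g ∘ suc))))
  containing₂ n (suc i) zero i≢j g =
      trans (Sum-cong (subsets (2 ℕ.+ n)) λ V → cong (_* g ∣ V ∣) (*-comm (χ V (suc i)) (χ V zero)))
    (containing₂ n zero (suc i) (i≢j ∘ sym) g)
  containing₂ zero (suc zero) (suc zero) i≢j g = contradiction refl i≢j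
  containing₂ (suc n) (suc i) (suc j) i≢j g = trans (Sum-subsets-suc (2 ℕ.+ n) _) (trans
    (cong₂ _+_ (containing₂ n i j (i≢j ∘ cong suc) g) (containing₂ n i j (i≢j ∘ cong suc) (g ∘ suc)))
    (sym (sizeSum-suc n (λ x → g (2 ℕ.+ x)))))

  -- The matrix M is q everywhere plus p - q on the diagonal, where idempotence reduces c² to c. It
  -- serves the second moment of |A ∩ V|, with the indicator of A as c, and that of the number of
  -- isolated nodes, with c constantly 1.
  Sum-pairs : ∀ {n} (c : Fin n → ℚ) (M : Fin n → Fin n → ℚ) p q → (∀ i → c i * c i ≡ c i) →
    (∀ i → M i i ≡ p) → (∀ i j → i ≢ j → M i j ≡ q) →
    Sum (allFin n) (λ i → Sum (allFin n) (λ j → (c i * c j) * M i j)) ≡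
    Sum (allFin n) c * Sum (allFin n) c * q + Sum (allFin n) c * (p - q)
  Sum-pairs {n} c M p q idem diag off = begin
    Sum xs (λ i → Sum xs (λ j → (c i * c j) * M i j))
      ≡⟨ Sum-cong xs (λ i → trans (Sum-cong xs (entry i)) (row i)) ⟩
    Sum xs (λ i → c i * (S * q + (p - q)))   ≡⟨ Sum-*ʳ xs (S * q + (p - q)) c ⟩
    S * (S * q + (p - q))
      ≡⟨ solve 3 (λ S p q → S :* (S :* q :+ (p :- q)) := S :* S :* q :+ S :* (p :- q)) refl S p q ⟩
    S * S * q + S * (p - q) ∎
    where
    open ≡-Reasoning
    xs = allFin n
    S = Sum xs c
    entry : ∀ i j → (c i * c j) * M i j ≡ (c i * q) * c j + ⟦ i Fin.≟ j ⟧ * (c i * (p - q))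
    entry i j with i Fin.≟ j
    ... | yes refl rewrite diag i = trans (cong (_* p) (idem i)) (sym (trans
            (cong (_+ 1ℚ * (c i * (p - q)))
                (trans (solve 2 (λ c q → c :* q :* c := c :* c :* q) refl (c i) q) (cong (_* q) (idem i))))
            (solve 3 (λ c p q → c :* q :+ con 1ℚ :* (c :* (p :- q)) := c :* p) refl (c i) p q)))
    ... | no  i≢j  rewrite off i j i≢j =
            solve 4 (λ c d p q → (c :* d) :* q := (c :* q) :* d :+ con 0ℚ :* (c :* (p :- q))) refl (c i) (c j) p q
    row : ∀ i → Sum xs (λ j → (c i * q) * c j + ⟦ i Fin.≟ j ⟧ * (c i * (p - q))) ≡ c i * (S * q + (p - q))
    row i = trans (Sum-+ xs _ _) (trans (cong₂ _+_ (Sum-* xs (c i * q) c) (Sum-δ i (λ _ → c i * (p - q))))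
      (solve 4 (λ c S p q → c :* q :* S :+ c :* (p :- q) := c :* (S :* q :+ (p :- q))) refl (c i) S p q))

  ∩-moment₁ : ∀ n (A : Subset (suc n)) (g : ℕ → ℚ) →
    Sum (subsets (suc n)) (λ V → nat ∣ A ∩ V ∣ * g ∣ V ∣) ≡ nat ∣ A ∣ * sizeSum n (g ∘ suc)
  ∩-moment₁ n A g = begin
    Sum (subsets (suc n)) (λ V → nat ∣ A ∩ V ∣ * g ∣ V ∣)
      ≡⟨ Sum-cong (subsets (suc n)) (λ V →
          trans (cong (_* g ∣ V ∣) (Sum-χ-∩ A V)) (trans (sym (Sum-*ʳ xs (g ∣ V ∣) (λ i → χ A i * χ V i)))
           (Sum-cong xs (λ i → *-assoc (χ A i) (χ V i) (g ∣ V ∣))))) ⟩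
    Sum (subsets (suc n)) (λ V → Sum xs (λ i → χ A i * (χ V i * g ∣ V ∣)))
      ≡⟨ Sum-swap (subsets (suc n)) xs _ ⟩
    Sum xs (λ i → Sum (subsets (suc n)) (λ V → χ A i * (χ V i * g ∣ V ∣)))
      ≡⟨ Sum-cong xs (λ i → trans (Sum-* (subsets (suc n)) (χ A i) _) (cong (_*_ (χ A i)) (containing₁ n i g))) ⟩
    Sum xs (λ i → χ A i * sizeSum n (g ∘ suc))
      ≡⟨ Sum-*ʳ xs (sizeSum n (g ∘ suc)) (χ A) ⟩
    Sum xs (χ A) * sizeSum n (g ∘ suc)   ≡⟨ cong (_* sizeSum n (g ∘ suc)) (Sum-χ A) ⟩
    nat ∣ A ∣ * sizeSum n (g ∘ suc) ∎
    where
    open ≡-Reasoning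
    xs = allFin (suc n)

  -- The square counts pairs of nodes of A that lie in V. A pair of equal nodes fixes one node of V,
  -- a pair of distinct nodes fixes two; this gives the two sums over smaller ground sets.
  ∩-moment₂ : ∀ n (A : Subset (2 ℕ.+ n)) (g : ℕ → ℚ) →
    Sum (subsets (2 ℕ.+ n)) (λ V → (nat ∣ A ∩ V ∣ * nat ∣ A ∩ V ∣) * g ∣ V ∣) ≡
    nat ∣ A ∣ * nat ∣ A ∣ * sizeSum n (λ x → g (2 ℕ.+ x))
      + nat ∣ A ∣ * (sizeSum (suc n) (g ∘ suc) - sizeSum n (λ x → g (2 ℕ.+ x)))
  ∩-moment₂ n A g = begin
    Sum Vs (λ V → (nat ∣ A ∩ V ∣ * nat ∣ A ∩ V ∣) * g ∣ V ∣)
      ≡⟨ Sum-cong Vs expand ⟩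
    Sum Vs (λ V → Sum xs (λ i → Sum xs (λ j → (χ A i * χ A j) * ((χ V i * χ V j) * g ∣ V ∣))))
      ≡⟨ Sum-swap Vs xs _ ⟩
    Sum xs (λ i → Sum Vs (λ V → Sum xs (λ j → (χ A i * χ A j) * ((χ V i * χ V j) * g ∣ V ∣))))
      ≡⟨ Sum-cong xs (λ i → trans (Sum-swap Vs xs _) (Sum-cong xs (λ j → Sum-* Vs (χ A i * χ A j) _))) ⟩
    Sum xs (λ i → Sum xs (λ j → (χ A i * χ A j) * Sum Vs (λ V → (χ V i * χ V j) * g ∣ V ∣)))
      ≡⟨ Sum-pairs (χ A) _ p q (χ-idem A)
           (λ i → trans (Sum-cong Vs (λ V → cong (_* g ∣ V ∣) (χ-idem V i))) (containing₁ (suc n) i g))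
           (λ i j i≢j → containing₂ n i j i≢j g) ⟩
    Sum xs (χ A) * Sum xs (χ A) * q + Sum xs (χ A) * (p - q)
      ≡⟨ cong (λ s → s * s * q + s * (p - q)) (Sum-χ A) ⟩
    nat ∣ A ∣ * nat ∣ A ∣ * q + nat ∣ A ∣ * (p - q) ∎
    where
    open ≡-Reasoning
    Vs = subsets (2 ℕ.+ n)
    xs = allFin (2 ℕ.+ n)
    p = sizeSum (suc n) (g ∘ suc)
    q = sizeSum n (λ x → g (2 ℕ.+ x))
    expand : ∀ V → (nat ∣ A ∩ V ∣ * nat ∣ A ∩ V ∣) * g ∣ V ∣ ≡
      Sum xs (λ i → Sum xs (λ j → (χ A i * χ A j) * ((χ V i * χ V j) * g ∣ V ∣)))
    expand V rewrite Sum-χ-∩ A V = trans (*-assoc Z Z (g ∣ V ∣))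
        (trans (sym (Sum-*ʳ xs (Z * g ∣ V ∣) (λ i → χ A i * χ V i)))
      (Sum-cong xs λ i → trans (solve 3 (λ a z g → a :* (z :* g) := (a :* g) :* z) refl (χ A i * χ V i) Z (g ∣ V ∣))
        (trans (sym (Sum-* xs ((χ A i * χ V i) * g ∣ V ∣) (λ j → χ A j * χ V j)))
          (Sum-cong xs λ j → solve 5 (λ a v g b w → ((a :* v) :* g) :* (b :* w) := (a :* b) :* ((v :* w) :* g)) refl
            (χ A i) (χ V i) (g ∣ V ∣) (χ A j) (χ V j)))))
      where Z = Sum xs (λ i → χ A i * χ V i)

  -- Binomial theorem and sums by size

  sizeSum-^ : ∀ n w → sizeSum n (w ^_) ≡ (1ℚ + w) ^ n
  sizeSum-^ zero    w = refl
  sizeSum-^ (suc n) w = trans (sizeSum-suc n (w ^_)) (trans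
    (cong₂ _+_ (sizeSum-^ n w) (trans (Sum-* (subsets n) w _) (cong (_*_ w) (sizeSum-^ n w))))
    (solve 2 (λ w P → P :+ w :* P := (con 1ℚ :+ w) :* P) refl w ((1ℚ + w) ^ n)))

  rangeSum : ℕ → (ℕ → ℚ) → ℚ
  rangeSum zero    u = 0ℚ
  rangeSum (suc n) u = u 0 + rangeSum n (u ∘ suc)

  rangeSum-cong : ∀ n {u v} → (∀ x → u x ≡ v x) → rangeSum n u ≡ rangeSum n v
  rangeSum-cong zero    e = refl
  rangeSum-cong (suc n) e = cong₂ _+_ (e 0) (rangeSum-cong n (e ∘ suc))

  rangeSum-+ : ∀ n u v → rangeSum n (λ x → u x + v x) ≡ rangeSum n u + rangeSum n v
  rangeSum-+ zero    u v = refl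
  rangeSum-+ (suc n) u v = trans (cong (_+_ (u 0 + v 0)) (rangeSum-+ n (u ∘ suc) (v ∘ suc)))
    (solve 4 (λ a b c d → (a :+ b) :+ (c :+ d) := (a :+ c) :+ (b :+ d)) refl
      (u 0) (v 0) (rangeSum n (u ∘ suc)) (rangeSum n (v ∘ suc)))

  rangeSum-last : ∀ n u → rangeSum (suc n) u ≡ rangeSum n u + u n
  rangeSum-last zero    u = +-comm (u 0) 0ℚ
  rangeSum-last (suc n) u = trans (cong (_+_ (u 0)) (rangeSum-last n (u ∘ suc))) (sym (+-assoc (u 0) _ _))

  rangeSum-allFin : ∀ n u → Sum (allFin n) (u ∘ toℕ) ≡ rangeSum n u
  rangeSum-allFin zero    u = refl
  rangeSum-allFin (suc n) u = trans (Sum-suc {n} (u ∘ toℕ)) (cong (_+_ (u 0)) (rangeSum-allFin n (u ∘ suc)))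

  -- The bridge from laws on sizes, in which distributions and moments are given, to sums over
  -- subsets.
  sizeSum-binomial : ∀ n u → sizeSum n u ≡ rangeSum (suc n) (λ x → nat (n ℕ.C x) * u x)
  sizeSum-binomial zero    u = cong (_+ 0ℚ) (sym (*-identityˡ (u 0)))
  sizeSum-binomial (suc n) u = begin
    sizeSum (suc n) u                  ≡⟨ sizeSum-suc n u ⟩
    sizeSum n u + sizeSum n (u ∘ suc)  ≡⟨ cong₂ _+_ (sizeSum-binomial n u) (sizeSum-binomial n (u ∘ suc)) ⟩
    (nat (n ℕ.C 0) * u 0 + rangeSum n B) + rangeSum (suc n) A
      -- C(n, n + 1) = 0, so `B n` can be appended to make both ranges equally long before Pascal's
      -- rule is applied term by term.
      ≡⟨ cong (λ z → (nat (n ℕ.C 0) * u 0 + z) + rangeSum (suc n) A) (sym (trans (rangeSum-last n B)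
           (trans (cong (_+_ (rangeSum n B)) last≡0) (+-identityʳ _)))) ⟩
    (nat (n ℕ.C 0) * u 0 + rangeSum (suc n) B) + rangeSum (suc n) A
      ≡⟨ solve 3 (λ a b c → (a :+ b) :+ c := a :+ (c :+ b)) refl (nat (n ℕ.C 0) * u 0) (rangeSum (suc n) B)
          (rangeSum (suc n) A) ⟩
    nat (n ℕ.C 0) * u 0 + (rangeSum (suc n) A + rangeSum (suc n) B)
      ≡⟨ cong (_+_ (nat (n ℕ.C 0) * u 0)) (trans (sym (rangeSum-+ (suc n) A B)) (rangeSum-cong (suc n) pascal)) ⟩
    nat (suc n ℕ.C 0) * u 0 + rangeSum (suc n) (λ x → nat (suc n ℕ.C suc x) * u (suc x)) ∎
    where
    open ≡-Reasoning
    A B : ℕ → ℚ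
    A x = nat (n ℕ.C x) * u (suc x)
    B x = nat (n ℕ.C suc x) * u (suc x)
    last≡0 : B n ≡ 0ℚ
    last≡0 = trans (cong (λ k → nat k * u (suc n)) (ℕ.k>n⇒nCk≡0 (ℕ.n<1+n n))) (*-zeroˡ (u (suc n)))
    pascal : ∀ x → A x + B x ≡ nat (suc n ℕ.C suc x) * u (suc x)
    pascal x = trans (sym (*-distribʳ-+ (u (suc x)) (nat (n ℕ.C x)) (nat (n ℕ.C suc x))))
      (cong (_* u (suc x)) (trans (sym (nat-+ (n ℕ.C x) (n ℕ.C suc x))) (cong nat (ℕ.nCk+nC[k+1]≡[n+1]C[k+1] n x))))

  -- Independent random edges: expectation and Chebyshev's inequality

  Sum-cartesianProductWith : ∀ {A B C : Set} (h : A → B → C) xs ys (f : C → ℚ) →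
    Sum (cartesianProductWith h xs ys) f ≡ Sum xs (λ x → Sum ys (λ y → f (h x y)))
  Sum-cartesianProductWith h []       ys f = refl
  Sum-cartesianProductWith h (x ∷ xs) ys f = trans (Sum-++ (map (h x) ys) _ f)
    (cong₂ _+_ (Sum-map (h x) ys f) (Sum-cartesianProductWith h xs ys f))

  -- Distributivity of products over sums. Through it, independence of the edges turns the
  -- expectation of a product over edges into a product of expectations.
  Sum-tuples : ∀ {A : Set} (xs : List A) m (h : Fin m → A → ℚ) →
    Sum (tuples xs m) (λ V → Prod (allFin m) (λ k → h k (lookup V k))) ≡ Prod (allFin m) (λ k → Sum xs (h k))
  Sum-tuples xs zero    h = refl
  Sum-tuples xs (suc m) h = begin
    Sum (tuples xs (suc m)) (λ V → Prod (allFin (suc m)) (λ k → h k (lookup V k)))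
      ≡⟨ Sum-cartesianProductWith _∷_ xs (tuples xs m) _ ⟩
    Sum xs (λ x → Sum (tuples xs m) (λ V → Prod (allFin (suc m)) (λ k → h k (lookup (x ∷ V) k))))
      ≡⟨ Sum-cong xs (λ x → trans (Sum-cong (tuples xs m) (λ V → Prod-suc (λ k → h k (lookup (x ∷ V) k))))
           (Sum-* (tuples xs m) (h zero x) _)) ⟩
    Sum xs (λ x → h zero x * Sum (tuples xs m) (λ V → Prod (allFin m) (λ k → h (suc k) (lookup V k))))
      ≡⟨ Sum-*ʳ xs _ (h zero) ⟩
    Sum xs (h zero) * Sum (tuples xs m) (λ V → Prod (allFin m) (λ k → h (suc k) (lookup V k)))
      ≡⟨ cong (_*_ (Sum xs (h zero))) (Sum-tuples xs m (h ∘ suc)) ⟩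
    Sum xs (h zero) * Prod (allFin m) (λ k → Sum xs (h (suc k)))
      ≡⟨ sym (Prod-suc (λ k → Sum xs (h k))) ⟩
    Prod (allFin (suc m)) (λ k → Sum xs (h k)) ∎
    where open ≡-Reasoning

  -- φ k x is the probability that Vₖ is a given set of size x.
  record Laws (n m : ℕ) : Set where
    field
      φ      : Fin m → ℕ → ℚ
      0≤φ    : ∀ k x → 0ℚ ≤ φ k x
      mass-1 : ∀ k → sizeSum n (φ k) ≡ 1ℚ

  module Expectation {n m : ℕ} (L : Laws n m) where

    open Laws L

    Tuple : Set
    Tuple = Vec (Subset n) m

    weight : Tuple → ℚ
    weight V = Prod (allFin m) (λ k → φ k ∣ lookup V k ∣)

    𝔼 : (Tuple → ℚ) → ℚ
    𝔼 X = Sum (tuples (subsets n) m) (λ V → weight V * X V)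

    𝔼₁ : Fin m → (Subset n → ℚ) → ℚ
    𝔼₁ k Y = Sum (subsets n) (λ V → φ k ∣ V ∣ * Y V)

    0≤weight : ∀ V → 0ℚ ≤ weight V
    0≤weight V = Prod-nonneg (allFin m) (λ k → 0≤φ k _)

    𝔼-mono : ∀ {X Y} → (∀ V → X V ≤ Y V) → 𝔼 X ≤ 𝔼 Y
    𝔼-mono h = Sum-mono (tuples (subsets n) m) (λ V → *-monoˡ (0≤weight V) (h V))

    𝔼-cong : ∀ {X Y} → (∀ V → X V ≡ Y V) → 𝔼 X ≡ 𝔼 Y
    𝔼-cong h = Sum-cong (tuples (subsets n) m) (λ V → cong (_*_ (weight V)) (h V))

    𝔼-+ : ∀ X Y → 𝔼 (λ V → X V + Y V) ≡ 𝔼 X + 𝔼 Y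
    𝔼-+ X Y = trans (Sum-cong (tuples (subsets n) m) (λ V → *-distribˡ-+ (weight V) (X V) (Y V)))
      (Sum-+ (tuples (subsets n) m) _ _)

    𝔼-* : ∀ c X → 𝔼 (λ V → c * X V) ≡ c * 𝔼 X
    𝔼-* c X = trans (Sum-cong (tuples (subsets n) m) (λ V →
        solve 3 (λ w c x → w :* (c :* x) := c :* (w :* x)) refl (weight V) c (X V)))
      (Sum-* (tuples (subsets n) m) c _)

    𝔼-Sum : ∀ {A : Set} (xs : List A) (X : A → Tuple → ℚ) →
      𝔼 (λ V → Sum xs (λ x → X x V)) ≡ Sum xs (λ x → 𝔼 (X x))
    𝔼-Sum xs X = trans (Sum-cong (tuples (subsets n) m) (λ V → sym (Sum-* xs (weight V) (λ x → X x V))))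
      (Sum-swap (tuples (subsets n) m) xs _)

    𝔼-Prod : ∀ (Y : Fin m → Subset n → ℚ) →
      𝔼 (λ V → Prod (allFin m) (λ k → Y k (lookup V k))) ≡ Prod (allFin m) (λ k → 𝔼₁ k (Y k))
    𝔼-Prod Y = trans
      (Sum-cong (tuples (subsets n) m) (λ V → sym (Prod-* (allFin m) _ _)))
      (Sum-tuples (subsets n) m (λ k V → φ k ∣ V ∣ * Y k V))

    𝔼₁-1 : ∀ k → 𝔼₁ k (λ _ → 1ℚ) ≡ 1ℚ
    𝔼₁-1 k = trans (Sum-cong (subsets n) (λ V → *-identityʳ _)) (mass-1 k)

    𝔼-1 : 𝔼 (λ _ → 1ℚ) ≡ 1ℚ
    𝔼-1 = trans (𝔼-cong (λ V → sym (Prod-1 (allFin m) {λ _ → 1ℚ} (λ _ → refl))))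
      (trans (𝔼-Prod (λ _ _ → 1ℚ)) (Prod-1 (allFin m) 𝔼₁-1))

    Pr : ∀ {Q : Pred Tuple _} → Decidable Q → ℚ
    Pr Q? = 𝔼 (λ V → ⟦ Q? V ⟧)

    0≤Pr : ∀ {Q : Pred Tuple _} (Q? : Decidable Q) → 0ℚ ≤ Pr Q?
    0≤Pr Q? = Sum-nonneg (tuples (subsets n) m) (λ V → 0≤-* (0≤weight V) (0≤⟦⟧ (Q? V)))

    Pr-filter : ∀ {Q : Pred Tuple _} (Q? : Decidable Q) → Sum (filter Q? (tuples (subsets n) m)) weight ≡ Pr Q?
    Pr-filter Q? = trans (Sum-filter Q? (tuples (subsets n) m) weight)
      (Sum-cong (tuples (subsets n) m) (λ V → *-comm ⟦ Q? V ⟧ (weight V)))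

    -- The inequality μ² 1(Q) ≤ (X - μ)² holds pointwise because X vanishes on Q, and is then
    -- averaged. Keeping μ² on the left avoids a division.
    chebyshev : ∀ {Q : Pred Tuple _} (Q? : Decidable Q) (X : Tuple → ℚ) → (∀ V → Q V → X V ≡ 0ℚ) →
      𝔼 X * 𝔼 X * Pr Q? ≤ 𝔼 (λ V → X V * X V) - 𝔼 X * 𝔼 X
    chebyshev Q? X h = begin
      μ * μ * Pr Q?                                      ≡⟨ sym (𝔼-* (μ * μ) (λ V → ⟦ Q? V ⟧)) ⟩
      𝔼 (λ V → μ * μ * ⟦ Q? V ⟧)                         ≤⟨ 𝔼-mono pointwise ⟩
      𝔼 (λ V → X V * X V + (ℚ.- (μ + μ) * X V + μ * μ * 1ℚ))
        ≡⟨ trans (𝔼-+ (λ V → X V * X V) _) (cong (_+_ (𝔼 (λ V → X V * X V)))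
             (trans (𝔼-+ (λ V → ℚ.- (μ + μ) * X V) _)
                 (cong₂ _+_ (𝔼-* (ℚ.- (μ + μ)) X) (trans (𝔼-* (μ * μ) (λ _ → 1ℚ)) (cong (_*_ (μ * μ)) 𝔼-1))))) ⟩
      𝔼 (λ V → X V * X V) + (ℚ.- (μ + μ) * μ + μ * μ * 1ℚ)
        ≡⟨ solve 2 (λ a μ → a :+ (:- (μ :+ μ) :* μ :+ μ :* μ :* con 1ℚ) := a :- μ :* μ) refl (𝔼 (λ V → X V * X V)) μ ⟩
      𝔼 (λ V → X V * X V) - μ * μ                        ∎
      where
      open ≤-Reasoning
      μ = 𝔼 X
      pointwise : ∀ V → μ * μ * ⟦ Q? V ⟧ ≤ X V * X V + (ℚ.- (μ + μ) * X V + μ * μ * 1ℚ)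
      pointwise V with Q? V
      ... | yes q = ≤-reflexive (trans
          (solve 1 (λ μ → μ :* μ :* con 1ℚ := con 0ℚ :* con 0ℚ :+ (:- (μ :+ μ) :* con 0ℚ :+ μ :* μ :* con 1ℚ)) refl μ)
          (cong (λ x → x * x + (ℚ.- (μ + μ) * x + μ * μ * 1ℚ)) (sym (h V q))))
      ... | no  _ = ≤-by (0≤∣p∣² (X V - μ))
          (solve 2 (λ x μ → μ :* μ :* con 0ℚ :+ (x :- μ) :* (x :- μ) :=
              x :* x :+ (:- (μ :+ μ) :* x :+ μ :* μ :* con 1ℚ)) refl (X V) μ)

  -- Connectedness, isolated nodes and separated sets

  atLeastTwo : ℕ → ℚ
  atLeastTwo 0             = 0ℚ
  atLeastTwo 1             = 0ℚ
  atLeastTwo (suc (suc _)) = 1ℚ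

  -- An edge consisting of i alone links i to nothing, hence the restriction to sizes at least two.
  -- The value is 0 or 1.
  avoids : ∀ {n} → Fin n → Subset n → ℚ
  avoids i V = 1ℚ - χ V i * atLeastTwo ∣ V ∣

  χ-∈ : ∀ {n i} {V : Subset n} → i ∈ V → χ V i ≡ 1ℚ
  χ-∈ here      = refl
  χ-∈ (there p) = χ-∈ p

  Prod-0 : ∀ {m} (f : Fin m → ℚ) k → f k ≡ 0ℚ → Prod (allFin m) f ≡ 0ℚ
  Prod-0 {suc m} f zero    e = trans (Prod-suc f)
      (trans (cong (_* Prod (allFin m) (f ∘ suc)) e) (*-zeroˡ (Prod (allFin m) (f ∘ suc))))
  Prod-0 f (suc k) e = trans (Prod-suc f) (trans (cong (_*_ (f zero)) (Prod-0 (f ∘ suc) k e)) (*-zeroʳ (f zero)))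

  two-elements : ∀ {n i j} {V : Subset n} → i ∈ V → j ∈ V → j ≢ i → atLeastTwo ∣ V ∣ ≡ 1ℚ
  two-elements {V = V} i∈V j∈V j≢i =
    large (ℕ.≤-trans (s≤s (ℕ.≤-<-trans z≤n (x∈p⇒∣p-x∣<∣p∣ (x∈p∧x≢y⇒x∈p-y j∈V j≢i)))) (x∈p⇒∣p-x∣<∣p∣ i∈V))
    where
    large : ∀ {x} → 2 ℕ.≤ x → atLeastTwo x ≡ 1ℚ
    large (s≤s (s≤s _)) = refl

  other : ∀ {n} (i : Fin (2 ℕ.+ n)) → ∃[ j ] j ≢ i
  other zero    = suc zero , λ ()
  other (suc i) = zero , λ ()

  -- Connectedness applied to the partition into {i} and its complement, nonempty because there are
  -- at least two nodes, yields an edge with i and another node; the factor of that edge is 0.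
  connected⇒covered : ∀ {n m} (V : Vec (Subset (2 ℕ.+ n)) m) → Connected (hypergraph V) → ∀ i →
    Prod (allFin m) (λ k → avoids i (lookup V k)) ≡ 0ℚ
  connected⇒covered {n} {m} V conn i =
    let j , j≢i = other i
        E , E∈V , (x , x∈) , (y , y∈) = conn ⁅ i ⁆ (∁ ⁅ i ⁆)
          ( (i , x∈⁅x⁆ i) , (j , x∉p⇒x∈∁p (j≢i ∘ x∈⁅y⁆⇒x≡y i))
          , p∪∁p≡⊤ ⁅ i ⁆ , ∩-inverseʳ ⁅ i ⁆)
        x∈E , x∈i = x∈p∩q⁻ E ⁅ i ⁆ x∈
        y∈E , y∉i = x∈p∩q⁻ E (∁ ⁅ i ⁆) y∈
        i∈E = subst (_∈ E) (x∈⁅y⁆⇒x≡y i x∈i) x∈E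
        y≢i = λ y≡i → x∈∁p⇒x∉p y∉i (subst (_∈ ⁅ i ⁆) (sym y≡i) (x∈⁅x⁆ i))
    in Prod-0 (λ k → avoids i (lookup V k)) (Any.index E∈V)
         (subst (λ W → avoids i W ≡ 0ℚ) (Any.lookup-index E∈V)
           (cong₂ (λ a b → 1ℚ - a * b) (χ-∈ i∈E) (two-elements i∈E y∈E y≢i)))

  -- V lies outside A or inside A. The form by cardinalities lets polynomials in |A ∩ V| and |V|
  -- bound the indicator.
  Separated : ∀ {n} → Subset n → Subset n → Set
  Separated A V = ∣ A ∩ V ∣ ≡ 0 ⊎ ∣ A ∩ V ∣ ≡ ∣ V ∣

  separated? : ∀ {n} (A V : Subset n) → Dec (Separated A V)
  separated? A V = (∣ A ∩ V ∣ ℕ.≟ 0) ⊎-dec (∣ A ∩ V ∣ ℕ.≟ ∣ V ∣)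

  Minor : ∀ {n} → Subset n → Set
  Minor {n} A = 1 ℕ.≤ ∣ A ∣ × 2 ℕ.* ∣ A ∣ ℕ.≤ n

  minor? : ∀ {n} (A : Subset n) → Dec (Minor A)
  minor? {n} A = (1 ℕ.≤? ∣ A ∣) ×-dec (2 ℕ.* ∣ A ∣ ℕ.≤? n)

  Nonempty⇒1≤∣p∣ : ∀ {n} {p : Subset n} → Nonempty p → 1 ℕ.≤ ∣ p ∣
  Nonempty⇒1≤∣p∣ (x , x∈p) = ℕ.≤-<-trans z≤n (x∈p⇒∣p-x∣<∣p∣ x∈p)

  ∣p∣≢0⇒Nonempty : ∀ {n} (p : Subset n) → ∣ p ∣ ≢ 0 → Nonempty p
  ∣p∣≢0⇒Nonempty {n} p h with nonempty? p
  ... | yes ne = ne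
  ... | no ¬ne = contradiction (trans (cong ∣_∣ (Empty-unique ¬ne)) (∣⊥∣≡0 n)) h

  joins : ∀ {n} (A B V : Subset n) → (∀ x → x ∈ A ⊎ x ∈ B) → ¬ Separated A V →
    Nonempty (V ∩ A) × Nonempty (V ∩ B)
  joins A B V cover ¬sep = meetsA , meetsB
    where
    meetsA : Nonempty (V ∩ A)
    meetsA = subst Nonempty (∩-comm A V) (∣p∣≢0⇒Nonempty (A ∩ V) (¬sep ∘ inj₁))
    meetsB : Nonempty (V ∩ B)
    meetsB with nonempty? (V ∩ B)
    ... | yes ne = ne
    ... | no ¬ne = contradiction (inj₂ (ℕ.≤-antisym (∣p∩q∣≤∣q∣ A V) (p⊆q⇒∣p∣≤∣q∣ V⊆))) ¬sep
      where
      V⊆ : ∀ {x} → x ∈ V → x ∈ A ∩ V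
      V⊆ {x} x∈V = [ (λ x∈A → x∈p∩q⁺ (x∈A , x∈V)) , (λ x∈B → contradiction (x , x∈p∩q⁺ (x∈V , x∈B)) ¬ne) ]′ (cover x)

  -- If there were no such A, every partition would be joined by an edge, because one of its two
  -- sides has at most n/2 nodes and is not separated from all edges. Finiteness makes the search
  -- for A and for that edge decidable.
  disconnected⇒separated : ∀ {n m} (V : Vec (Subset n) m) → ¬ Connected (hypergraph V) →
    ∃[ A ] (Minor A × (∀ k → Separated A (lookup V k)))
  disconnected⇒separated {n} {m} V ¬conn
    with anySubset? (λ A → minor? A ×-dec Fin.all? (λ k → separated? A (lookup V k)))
  ... | yes found = found
  ... | no ¬found = contradiction connected ¬conn
    where
    joining : ∀ A B → (∀ x → x ∈ A ⊎ x ∈ B) → Minor A →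
      ∃[ k ] (Nonempty (lookup V k ∩ A) × Nonempty (lookup V k ∩ B))
    joining A B cover minor =
      let k , ¬sep = Fin.¬∀⟶∃¬ m _ (λ k → separated? A (lookup V k)) (λ all → ¬found (A , minor , all))
      in k , joins A B (lookup V k) cover ¬sep
    connected : Connected (hypergraph V)
    connected A B (neA , neB , A∪B≡⊤ , A∩B≡⊥) with 2 ℕ.* ∣ A ∣ ℕ.≤? n
    ... | yes 2A≤n = let k , meetsA , meetsB = joining A B cover (Nonempty⇒1≤∣p∣ neA , 2A≤n)
                     in lookup V k , Any.∈-lookup k V , meetsA , meetsB
      where
      cover : ∀ x → x ∈ A ⊎ x ∈ B
      cover x = x∈p∪q⁻ A B (subst (x ∈_) (sym A∪B≡⊤) ∈⊤)
    -- Since |A| + |B| ≤ n and 2|A| > n, the other side is the small one, and the roles are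
    -- exchanged.
    ... | no 2A≰n = let k , meetsB , meetsA = joining B A cover (Nonempty⇒1≤∣p∣ neB , 2B≤n)
                    in lookup V k , Any.∈-lookup k V , meetsA , meetsB
      where
      cover : ∀ x → x ∈ B ⊎ x ∈ A
      cover x = swap (x∈p∪q⁻ A B (subst (x ∈_) (sym A∪B≡⊤) ∈⊤))
      B⊆∁A : ∀ {x} → x ∈ B → x ∈ ∁ A
      B⊆∁A x∈B = x∉p⇒x∈∁p (λ x∈A → ∉⊥ (subst (_ ∈_) A∩B≡⊥ (x∈p∩q⁺ (x∈A , x∈B))))
      A+B≤n : ∣ A ∣ ℕ.+ ∣ B ∣ ℕ.≤ n
      A+B≤n = ℕ.≤-trans (ℕ.+-monoʳ-≤ ∣ A ∣ (ℕ.≤-trans (p⊆q⇒∣p∣≤∣q∣ B⊆∁A) (ℕ.≤-reflexive (∣∁p∣≡n∸∣p∣ A))))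
        (ℕ.≤-reflexive (ℕ.m+[n∸m]≡n (∣p∣≤n A)))
      2B≤n : 2 ℕ.* ∣ B ∣ ℕ.≤ n
      2B≤n = ℕ.+-cancelˡ-≤ n _ _ (begin
        n ℕ.+ 2 ℕ.* ∣ B ∣               ≤⟨ ℕ.+-monoˡ-≤ _ (ℕ.<⇒≤ (ℕ.≰⇒> 2A≰n)) ⟩
        2 ℕ.* ∣ A ∣ ℕ.+ 2 ℕ.* ∣ B ∣     ≡⟨ sym (ℕ.*-distribˡ-+ 2 ∣ A ∣ ∣ B ∣) ⟩
        2 ℕ.* (∣ A ∣ ℕ.+ ∣ B ∣)         ≤⟨ ℕ.*-monoʳ-≤ 2 A+B≤n ⟩
        2 ℕ.* n                         ≡⟨ cong (n ℕ.+_) (ℕ.+-identityʳ n) ⟩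
        n ℕ.+ n                         ∎)
        where open ℕ.≤-Reasoning

  ≤Sum-subsets : ∀ {n} {f : Subset n → ℚ} → (∀ A → 0ℚ ≤ f A) → ∀ A → f A ≤ Sum (subsets n) f
  ≤Sum-subsets {f = f} 0≤f [] = ≤-reflexive (sym (+-identityʳ (f [])))
  ≤Sum-subsets {suc n} {f} 0≤f (outside ∷ A) = ≤-trans (≤Sum-subsets (λ B → 0≤f (outside ∷ B)) A)
    (≤-by (Sum-nonneg (subsets n) (λ B → 0≤f (inside ∷ B))) (sym (Sum-subsets-suc n f)))
  ≤Sum-subsets {suc n} {f} 0≤f (inside ∷ A) = ≤-trans (≤Sum-subsets (λ B → 0≤f (inside ∷ B)) A)
    (≤-by (Sum-nonneg (subsets n) (λ B → 0≤f (outside ∷ B)))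
        (trans (+-comm (Sum (subsets n) (f ∘ (inside ∷_))) _) (sym (Sum-subsets-suc n f))))

  union-bound : ∀ {n m} (V : Vec (Subset n) m) →
    ⟦ ¬? (connected? V) ⟧ ≤
    Sum (subsets n) (λ A → ⟦ minor? A ⟧ * Prod (allFin m) (λ k → ⟦ separated? A (lookup V k) ⟧))
  union-bound {n} {m} V with connected? V
  ... | yes _ = Sum-nonneg (subsets n) (λ A →
          0≤-* (0≤⟦⟧ (minor? A)) (Prod-nonneg (allFin m) (λ k → 0≤⟦⟧ (separated? A (lookup V k)))))
  ... | no ¬conn =
    let A , minor , sep = disconnected⇒separated V ¬conn
    in ≤-trans (≤-reflexive (sym (trans
        (cong₂ _*_ (⟦yes⟧ (minor? A) minor) (Prod-1 (allFin m) (λ k → ⟦yes⟧ (separated? A (lookup V k)) (sep k))))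
          (*-identityˡ 1ℚ))))
        (≤Sum-subsets (λ A → 0≤-* (0≤⟦⟧ (minor? A))
            (Prod-nonneg (allFin m) (λ k → 0≤⟦⟧ (separated? A (lookup V k))))) A)
    where
    ⟦yes⟧ : ∀ {P : Set} (P? : Dec P) → P → ⟦ P? ⟧ ≡ 1ℚ
    ⟦yes⟧ (yes _) _ = refl
    ⟦yes⟧ (no ¬p) p = contradiction p ¬p

  -- A single random edge

  0≤atLeastTwo : ∀ x → 0ℚ ≤ atLeastTwo x
  0≤atLeastTwo 0             = ≤-refl
  0≤atLeastTwo 1             = ≤-refl
  0≤atLeastTwo (suc (suc _)) = 0≤1

  atLeastTwo-idem : ∀ x → atLeastTwo x * atLeastTwo x ≡ atLeastTwo x
  atLeastTwo-idem 0             = refl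
  atLeastTwo-idem 1             = refl
  atLeastTwo-idem (suc (suc _)) = refl

  0≤atLeastTwo*[x-2] : ∀ x → 0ℚ ≤ atLeastTwo x * (nat x - nat 2)
  0≤atLeastTwo*[x-2] 0             = ≤-reflexive refl
  0≤atLeastTwo*[x-2] 1             = ≤-reflexive refl
  0≤atLeastTwo*[x-2] (suc (suc x)) = 0≤-* 0≤1 (≤⇒0≤ (nat-mono {2} {2 ℕ.+ x} (s≤s (s≤s z≤n))))

  module SingleLaw (n : ℕ) (φ : ℕ → ℚ) (0≤φ : ∀ x → 0ℚ ≤ φ x)
    (mass-1 : sizeSum (2 ℕ.+ n) φ ≡ 1ℚ) where

    Vs : List (Subset (2 ℕ.+ n))
    Vs = subsets (2 ℕ.+ n)

    N N-1 : ℚ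
    N = nat (2 ℕ.+ n)
    N-1 = nat (suc n)

    ψ : ℕ → ℚ
    ψ x = atLeastTwo x * φ x

    -- `t₀`, `t₁`, `t₂` are the means of 1, |V|, |V|² restricted to |V| ≥ 2; `p` and `q` are the
    -- probabilities that an edge with |V| ≥ 2 occurs and contains one given node, respectively two
    -- given distinct nodes. Fixing nodes leaves a subset of the others, whence the smaller ground
    -- sets.
    t₀ t₁ t₂ p q : ℚ
    t₀ = sizeSum (2 ℕ.+ n) ψ
    t₁ = sizeSum (2 ℕ.+ n) (λ x → nat x * ψ x)
    t₂ = sizeSum (2 ℕ.+ n) (λ x → nat x * (nat x * ψ x))
    p = sizeSum (suc n) (λ x → ψ (suc x))
    q = sizeSum n (λ x → ψ (2 ℕ.+ x))

    0≤ψ : ∀ x → 0ℚ ≤ ψ x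
    0≤ψ x = 0≤-* (0≤atLeastTwo x) (0≤φ x)

    0≤p : 0ℚ ≤ p
    0≤p = Sum-nonneg (subsets (suc n)) (λ V → 0≤ψ (suc ∣ V ∣))

    0≤q : 0ℚ ≤ q
    0≤q = Sum-nonneg (subsets n) (λ V → 0≤ψ (2 ℕ.+ ∣ V ∣))

    0≤t₀ : 0ℚ ≤ t₀
    0≤t₀ = Sum-nonneg Vs (λ V → 0≤ψ ∣ V ∣)

    0≤t₁ : 0ℚ ≤ t₁
    0≤t₁ = Sum-nonneg Vs (λ V → 0≤-* (0≤nat ∣ V ∣) (0≤ψ ∣ V ∣))

    0≤t₂ : 0ℚ ≤ t₂
    0≤t₂ = Sum-nonneg Vs (λ V → 0≤-* (0≤nat ∣ V ∣) (0≤-* (0≤nat ∣ V ∣) (0≤ψ ∣ V ∣)))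

    N≡1+N-1 : N ≡ 1ℚ + N-1
    N≡1+N-1 = nat-suc (suc n)

    Np≡t₁ : N * p ≡ t₁
    Np≡t₁ = sizeSum-weighted (suc n) ψ

    NN-1q≡t₂-t₁ : N * (N-1 * q) ≡ t₂ - t₁
    NN-1q≡t₂-t₁ = trans (sizeSum-weighted₂ n ψ) (trans
      (sizeSum-cong (2 ℕ.+ n) (λ x → solve 2 (λ x y → x :* ((x :- con 1ℚ) :* y) := x :* (x :* y) :- x :* y) refl
          (nat x) (ψ x)))
      (Sum-- Vs _ _))

    2t₀≤t₁ : nat 2 * t₀ ≤ t₁
    2t₀≤t₁ = ≤-trans (≤-reflexive (sym (Sum-* Vs (nat 2) (λ V → ψ ∣ V ∣)))) (Sum-mono Vs (λ V →
      ≤-by (0≤-* (0≤atLeastTwo*[x-2] ∣ V ∣) (0≤φ ∣ V ∣))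
        (solve 3 (λ b x f → con (nat 2) :* (b :* f) :+ b :* (x :- con (nat 2)) :* f := x :* (b :* f)) refl
          (atLeastTwo ∣ V ∣) (nat ∣ V ∣) (φ ∣ V ∣))))

    2t₁≤t₂ : nat 2 * t₁ ≤ t₂
    2t₁≤t₂ = ≤-trans (≤-reflexive (sym (Sum-* Vs (nat 2) (λ V → nat ∣ V ∣ * ψ ∣ V ∣)))) (Sum-mono Vs (λ V →
      ≤-by (0≤-* (0≤nat ∣ V ∣) (0≤-* (0≤atLeastTwo*[x-2] ∣ V ∣) (0≤φ ∣ V ∣)))
        (solve 3 (λ b x f → con (nat 2) :* (x :* (b :* f)) :+ x :* (b :* (x :- con (nat 2)) :* f) :=
            x :* (x :* (b :* f))) refl
          (atLeastTwo ∣ V ∣) (nat ∣ V ∣) (φ ∣ V ∣))))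

    t₂≤Nt₁ : t₂ ≤ N * t₁
    t₂≤Nt₁ = ≤-trans (Sum-mono Vs (λ V → *-monoʳ (0≤-* (0≤nat ∣ V ∣) (0≤ψ ∣ V ∣)) (nat-mono (∣p∣≤n V))))
      (≤-reflexive (Sum-* Vs N (λ V → nat ∣ V ∣ * ψ ∣ V ∣)))

    -- q is the mean of x(x - 1)/(N(N - 1)), and this is at most x²/N² for x ≤ N. In moments: N(N -
    -- 1)q = t₂ - t₁ and t₂ ≤ N t₁.
    N²q≤t₂ : N * N * q ≤ t₂
    N²q≤t₂ = *-cancelˡ (0<nat n) (≤-by (≤⇒0≤ t₂≤Nt₁) (begin
      N-1 * (N * N * q) + (N * t₁ - t₂)
        ≡⟨ solve 5 (λ N M q t₁ t₂ → M :* (N :* N :* q) :+ (N :* t₁ :- t₂) :=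
            N :* (N :* (M :* q)) :+ (N :* t₁ :- t₂)) refl N N-1 q t₁ t₂ ⟩
      N * (N * (N-1 * q)) + (N * t₁ - t₂)      ≡⟨ cong (λ z → N * z + (N * t₁ - t₂)) NN-1q≡t₂-t₁ ⟩
      N * (t₂ - t₁) + (N * t₁ - t₂)
          ≡⟨ solve 3 (λ N t₁ t₂ → N :* (t₂ :- t₁) :+ (N :* t₁ :- t₂) := (N :- con 1ℚ) :* t₂) refl N t₁ t₂ ⟩
      (N - 1ℚ) * t₂                            ≡⟨ cong (λ z → (z - 1ℚ) * t₂) N≡1+N-1 ⟩
      (1ℚ + N-1 - 1ℚ) * t₂
          ≡⟨ solve 2 (λ M t → (con 1ℚ :+ M :- con 1ℚ) :* t := M :* t) refl N-1 t₂ ⟩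
      N-1 * t₂ ∎))
      where open ≡-Reasoning

    -- The variance of |V| 1(|V| ≥ 2) is nonnegative; `Y` is the deviation from the mean `t₁`.
    t₁²≤t₂ : t₁ * t₁ ≤ t₂
    t₁²≤t₂ = ≤-by (Sum-nonneg Vs {λ V → Y V * Y V * φ ∣ V ∣} (λ V → 0≤-* (0≤∣p∣² (Y V)) (0≤φ ∣ V ∣))) (begin
      t₁ * t₁ + Sum Vs (λ V → Y V * Y V * φ ∣ V ∣)
        ≡⟨ cong (_+_ (t₁ * t₁)) (trans (Sum-cong Vs expand)
            (trans (Sum-+ Vs _ _) (cong₂ _+_ (Sum-- Vs _ _) (Sum-* Vs (t₁ * t₁) (λ V → φ ∣ V ∣))))) ⟩
      t₁ * t₁ + (t₂ - Sum Vs (λ V → (t₁ + t₁) * (nat ∣ V ∣ * ψ ∣ V ∣)) + t₁ * t₁ * sizeSum (2 ℕ.+ n) φ)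
        ≡⟨ cong₂ (λ a b → t₁ * t₁ + (t₂ - a + t₁ * t₁ * b)) (Sum-* Vs (t₁ + t₁) (λ V → nat ∣ V ∣ * ψ ∣ V ∣)) mass-1 ⟩
      t₁ * t₁ + (t₂ - (t₁ + t₁) * t₁ + t₁ * t₁ * 1ℚ)
        ≡⟨ solve 2 (λ a b → a :* a :+ (b :- (a :+ a) :* a :+ a :* a :* con 1ℚ) := b) refl t₁ t₂ ⟩
      t₂ ∎)
      where
      open ≡-Reasoning
      Y : Subset (2 ℕ.+ n) → ℚ
      Y V = nat ∣ V ∣ * atLeastTwo ∣ V ∣ - t₁
      expand : ∀ V → Y V * Y V * φ ∣ V ∣ ≡
        nat ∣ V ∣ * (nat ∣ V ∣ * ψ ∣ V ∣) - (t₁ + t₁) * (nat ∣ V ∣ * ψ ∣ V ∣) + t₁ * t₁ * φ ∣ V ∣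
      expand V = trans
        (solve 4 (λ x b t f → (x :* b :- t) :* (x :* b :- t) :* f :=
            x :* (x :* ((b :* b) :* f)) :- (t :+ t) :* (x :* (b :* f)) :+ t :* t :* f) refl
          (nat ∣ V ∣) (atLeastTwo ∣ V ∣) t₁ (φ ∣ V ∣))
        (cong (λ b → nat ∣ V ∣ * (nat ∣ V ∣ * (b * φ ∣ V ∣)) - (t₁ + t₁) *
            (nat ∣ V ∣ * ψ ∣ V ∣) + t₁ * t₁ * φ ∣ V ∣) (atLeastTwo-idem ∣ V ∣))

    E-χ : ∀ i → Sum Vs (λ V → χ V i * ψ ∣ V ∣) ≡ p
    E-χ i = containing₁ (suc n) i ψ

    E-avoids : ∀ i → Sum Vs (λ V → φ ∣ V ∣ * avoids i V) ≡ 1ℚ - p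
    E-avoids i = trans (Sum-cong Vs (λ V → solve 3 (λ f c b → f :* (con 1ℚ :- c :* b) := f :- c :* (b :* f)) refl
        (φ ∣ V ∣) (χ V i) (atLeastTwo ∣ V ∣)))
      (trans (Sum-- Vs _ _) (cong₂ _-_ mass-1 (E-χ i)))

    avoids-idem : ∀ i (V : Subset (2 ℕ.+ n)) → avoids i V * avoids i V ≡ avoids i V
    avoids-idem i V = trans
      (solve 2 (λ c b → (con 1ℚ :- c :* b) :* (con 1ℚ :- c :* b) :=
          con 1ℚ :- c :* b :- c :* b :+ (c :* c) :* (b :* b)) refl c b)
      (trans (cong₂ (λ x y → 1ℚ - c * b - c * b + x * y) (χ-idem V i) (atLeastTwo-idem ∣ V ∣))
        (solve 2 (λ c b → con 1ℚ :- c :* b :- c :* b :+ c :* b := con 1ℚ :- c :* b) refl c b))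
      where
      c = χ V i
      b = atLeastTwo ∣ V ∣

    E-avoids-diag : ∀ i → Sum Vs (λ V → φ ∣ V ∣ * (avoids i V * avoids i V)) ≡ 1ℚ - p
    E-avoids-diag i = trans (Sum-cong Vs (λ V → cong (_*_ (φ ∣ V ∣)) (avoids-idem i V))) (E-avoids i)

    E-avoids-off : ∀ i j → i ≢ j → Sum Vs (λ V → φ ∣ V ∣ * (avoids i V * avoids j V)) ≡ 1ℚ - p - p + q
    E-avoids-off i j i≢j = trans (Sum-cong Vs expand)
      (trans (Sum-+ Vs _ _) (cong₂ _+_
        (trans (Sum-- Vs _ _) (cong₂ _-_ (trans (Sum-- Vs _ _) (cong₂ _-_ mass-1 (E-χ i))) (E-χ j)))
        (containing₂ n i j i≢j ψ)))
      where
      expand : ∀ V → φ ∣ V ∣ * (avoids i V * avoids j V) ≡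
        φ ∣ V ∣ - χ V i * ψ ∣ V ∣ - χ V j * ψ ∣ V ∣ + (χ V i * χ V j) * ψ ∣ V ∣
      expand V = trans
        (solve 4 (λ f c d b → f :* ((con 1ℚ :- c :* b) :* (con 1ℚ :- d :* b)) :=
            f :- c :* (b :* f) :- d :* (b :* f) :+ (c :* d) :* ((b :* b) :* f)) refl
          (φ ∣ V ∣) (χ V i) (χ V j) (atLeastTwo ∣ V ∣))
        (cong (λ b → φ ∣ V ∣ - χ V i * ψ ∣ V ∣ - χ V j * ψ ∣ V ∣ + (χ V i * χ V j) * (b * φ ∣ V ∣))
            (atLeastTwo-idem ∣ V ∣))

    -- The probability that the edge joins A to its complement.
    J : Subset (2 ℕ.+ n) → ℚ
    J A = Sum Vs (λ V → φ ∣ V ∣ * (1ℚ - ⟦ separated? A V ⟧))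

    E-separated : ∀ A → Sum Vs (λ V → φ ∣ V ∣ * ⟦ separated? A V ⟧) ≡ 1ℚ - J A
    E-separated A = trans
      (solve 2 (λ a b → a := a :+ b :- b) refl _ (J A))
      (cong (_- J A) (trans (sym (Sum-+ Vs _ _)) (trans (Sum-cong Vs (λ V →
        solve 2 (λ f s → f :* s :+ f :* (con 1ℚ :- s) := f) refl (φ ∣ V ∣) ⟦ separated? A V ⟧)) mass-1)))

    0≤1-⟦⟧ : ∀ {P : Set} (P? : Dec P) → 0ℚ ≤ 1ℚ - ⟦ P? ⟧
    0≤1-⟦⟧ (yes _) = ≤-reflexive refl
    0≤1-⟦⟧ (no _)  = 0≤1

    J-unit : ∀ A → UnitInterval (J A)
    J-unit A = Sum-nonneg Vs (λ V → 0≤-* (0≤φ ∣ V ∣) (0≤1-⟦⟧ (separated? A V)))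
      , ≤-by (Sum-nonneg Vs (λ V → 0≤-* (0≤φ ∣ V ∣) (0≤⟦⟧ (separated? A V))))
          (trans (cong (_+_ (J A)) (E-separated A)) (solve 1 (λ j → j :+ (con 1ℚ :- j) := con 1ℚ) refl (J A)))

    -- With Z = |A ∩ V|, a joining edge contributes at most 1, since 2Z - Z² = 1 - (1 - Z)². An edge
    -- outside A contributes 0, and one inside A contributes Z(2 - Z) ≤ 0 because it has at least
    -- two elements.
    J-bonferroni : ∀ A → nat ∣ A ∣ * p + nat ∣ A ∣ * q - nat ∣ A ∣ * nat ∣ A ∣ * q ≤ J A
    J-bonferroni A = begin
      s * p + s * q - s * s * q
        ≡⟨ solve 3 (λ s p q → s :* p :+ s :* q :- s :* s :* q :=
            con (nat 2) :* (s :* p) :- (s :* s :* q :+ s :* (p :- q))) refl s p q ⟩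
      nat 2 * (s * p) - (s * s * q + s * (p - q))
        ≡⟨ sym (trans (Sum-- Vs _ _) (cong₂ _-_
            (trans (Sum-* Vs (nat 2) _) (cong (_*_ (nat 2)) (∩-moment₁ (suc n) A ψ))) (∩-moment₂ n A ψ))) ⟩
      Sum Vs (λ V → nat 2 * (nat ∣ A ∩ V ∣ * ψ ∣ V ∣) - nat ∣ A ∩ V ∣ * nat ∣ A ∩ V ∣ * ψ ∣ V ∣)
        ≤⟨ Sum-mono Vs pointwise ⟩
      J A ∎
      where
      open ≤-Reasoning
      s = nat ∣ A ∣
      factor : ∀ z x (f : ℚ) → 0ℚ ≤ f → (P? : Dec (z ≡ 0 ⊎ z ≡ x)) →
        nat 2 * (nat z * (atLeastTwo x * f)) - nat z * nat z * (atLeastTwo x * f) ≤ f * (1ℚ - ⟦ P? ⟧)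
      factor z x f 0≤f (yes (inj₁ refl)) = ≤-reflexive (solve 2 (λ b f →
        con (nat 2) :* (con 0ℚ :* (b :* f)) :- con 0ℚ :* con 0ℚ :* (b :* f) := f :* (con 1ℚ :- con 1ℚ)) refl
            (atLeastTwo x) f)
      factor z x f 0≤f (yes (inj₂ refl)) = ≤-by (0≤-* (0≤-* (0≤nat z) (0≤atLeastTwo*[x-2] z)) 0≤f)
        (solve 3 (λ z b f → con (nat 2) :* (z :* (b :* f)) :- z :* z :* (b :* f) :+ z :*
            (b :* (z :- con (nat 2))) :* f := f :* (con 1ℚ :- con 1ℚ))
          refl (nat z) (atLeastTwo z) f)
      factor z 0 f 0≤f (no _) = ≤-trans
          (≤-reflexive (solve 2 (λ z f → con (nat 2) :* (z :* (con 0ℚ :* f)) :- z :* z :* (con 0ℚ :* f) := con 0ℚ)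
          refl (nat z) f)) (0≤-* 0≤f 0≤1)
      factor z 1 f 0≤f (no _) = ≤-trans
          (≤-reflexive (solve 2 (λ z f → con (nat 2) :* (z :* (con 0ℚ :* f)) :- z :* z :* (con 0ℚ :* f) := con 0ℚ)
          refl (nat z) f)) (0≤-* 0≤f 0≤1)
      factor z (suc (suc x)) f 0≤f (no _) = ≤-by (0≤-* (0≤∣p∣² (1ℚ - nat z)) 0≤f)
        (solve 2 (λ z f → con (nat 2) :* (z :* (con 1ℚ :* f)) :- z :* z :* (con 1ℚ :* f) :+ (con 1ℚ :- z) :*
            (con 1ℚ :- z) :* f := f :* (con 1ℚ :- con 0ℚ))
          refl (nat z) f)
      pointwise : ∀ V → nat 2 * (nat ∣ A ∩ V ∣ * ψ ∣ V ∣) - nat ∣ A ∩ V ∣ * nat ∣ A ∩ V ∣ * ψ ∣ V ∣ ≤ φ ∣ V ∣ *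
          (1ℚ - ⟦ separated? A V ⟧)
      pointwise V = factor ∣ A ∩ V ∣ ∣ V ∣ (φ ∣ V ∣) (0≤φ ∣ V ∣) (separated? A V)

    -- `ψ x` divided by x(x - 1). The default 0 at sizes 0 and 1 keeps `x[x-1]θ≡ψ` valid for every
    -- size.
    θ : ℕ → ℚ
    θ 0 = 0ℚ
    θ 1 = 0ℚ
    θ (suc (suc x)) = 1/ℕ (suc (suc x) ℕ.* suc x) * φ (suc (suc x))

    0≤θ : ∀ x → 0ℚ ≤ θ x
    0≤θ 0 = ≤-refl
    0≤θ 1 = ≤-refl
    0≤θ (suc (suc x)) = 0≤-* (0≤1/ (suc (suc x) ℕ.* suc x)) (0≤φ (suc (suc x)))

    x[x-1]θ≡ψ : ∀ x → nat x * ((nat x - 1ℚ) * θ x) ≡ ψ x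
    x[x-1]θ≡ψ 0 = sym (*-zeroˡ (φ 0))
    x[x-1]θ≡ψ 1 = sym (*-zeroˡ (φ 1))
    x[x-1]θ≡ψ (suc (suc x)) = begin
      nat (suc (suc x)) * ((nat (suc (suc x)) - 1ℚ) * (r * f))
        ≡⟨ cong (λ z → nat (suc (suc x)) * (z * (r * f))) (trans (cong (_- 1ℚ) (nat-suc (suc x)))
             (solve 1 (λ x → con 1ℚ :+ x :- con 1ℚ := x) refl (nat (suc x)))) ⟩
      nat (suc (suc x)) * (nat (suc x) * (r * f))
        ≡⟨ solve 4 (λ a b r f → a :* (b :* (r :* f)) := (a :* b) :* r :* f) refl (nat (suc (suc x)))
            (nat (suc x)) r f ⟩
      nat (suc (suc x)) * nat (suc x) * r * f   ≡⟨ cong (λ z → z * r * f) (sym (nat-* (suc (suc x)) (suc x))) ⟩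
      nat (suc (suc x) ℕ.* suc x) * r * f       ≡⟨ cong (_* f) (nat*1/ (suc (suc x) ℕ.* suc x)) ⟩
      1ℚ * f ∎
      where
      open ≡-Reasoning
      r = 1/ℕ (suc (suc x) ℕ.* suc x)
      f = φ (suc (suc x))

    -- Z(|V| - Z)/(|V|(|V| - 1)) is the proportion of ordered pairs of distinct nodes of V that lead
    -- from A to its complement. By symmetry its mean is s(N - s)/(N(N - 1)) times `t₀`, and s ≤ N/2
    -- makes (N - s)/(N - 1) at least 1/2.
    J-pairs : ∀ A → 2 ℕ.* ∣ A ∣ ℕ.≤ 2 ℕ.+ n → nat ∣ A ∣ * t₀ ≤ nat 2 * N * J A
    J-pairs A 2s≤n = ≤-trans (*-cancelˡ (0<nat n) (begin
      N-1 * (s * t₀)                         ≤⟨ *-monoʳ (0≤-* (0≤nat ∣ A ∣) 0≤t₀) N-1≤2N-s ⟩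
      (nat 2 * (N - s)) * (s * t₀)           ≡⟨ cong (λ z → (nat 2 * (z - s)) * (s * t₀)) N≡1+N-1 ⟩
      (nat 2 * (1ℚ + N-1 - s)) * (s * t₀)
        ≡⟨ solve 3 (λ M s t → (con (nat 2) :* (con 1ℚ :+ M :- s)) :* (s :* t) :=
            con (nat 2) :* (M :* (s :* t) :- (s :* s :- s) :* t)) refl N-1 s t₀ ⟩
      nat 2 * (N-1 * (s * t₀) - (s * s - s) * t₀)
        ≡⟨ cong₂ (λ a b → nat 2 * (N-1 * (s * a) - (s * s - s) * b)) (sym Np₁-Np'≡t₀) (sym NN-1q'≡t₀) ⟩
      nat 2 * (N-1 * (s * (N * p₁ - N * p')) - (s * s - s) * (N * (N-1 * q')))
        ≡⟨ solve 6 (λ N M s p₁ p' q' → con (nat 2) :*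
            (M :* (s :* (N :* p₁ :- N :* p')) :- (s :* s :- s) :* (N :* (M :* q')))
               := M :* (con (nat 2) :* N :* (s :* p₁ :- (s :* s :* q' :+ s :* (p' :- q'))))) refl N N-1 s p₁ p' q' ⟩
      N-1 * (nat 2 * N * (s * p₁ - (s * s * q' + s * (p' - q')))) ∎))
      (*-monoˡ (0≤-* (0≤nat 2) (0≤nat (2 ℕ.+ n))) (begin
        s * p₁ - (s * s * q' + s * (p' - q'))
          ≡⟨ sym (trans (Sum-- Vs _ _) (cong₂ _-_ (∩-moment₁ (suc n) A (λ x → nat x * θ x)) (∩-moment₂ n A θ))) ⟩
        Sum Vs (λ V → nat ∣ A ∩ V ∣ * (nat ∣ V ∣ * θ ∣ V ∣) - nat ∣ A ∩ V ∣ * nat ∣ A ∩ V ∣ * θ ∣ V ∣)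
          ≤⟨ Sum-mono Vs pointwise ⟩
        J A ∎))
      where
      open ≤-Reasoning
      s = nat ∣ A ∣
      p₁ = sizeSum (suc n) (λ x → nat (suc x) * θ (suc x))
      p' = sizeSum (suc n) (λ x → θ (suc x))
      q' = sizeSum n (λ x → θ (2 ℕ.+ x))
      NN-1q'≡t₀ : N * (N-1 * q') ≡ t₀
      NN-1q'≡t₀ = trans (sizeSum-weighted₂ n θ) (sizeSum-cong (2 ℕ.+ n) x[x-1]θ≡ψ)
      Np₁-Np'≡t₀ : N * p₁ - N * p' ≡ t₀
      Np₁-Np'≡t₀ = trans (cong₂ _-_ (sizeSum-weighted (suc n) (λ x → nat x * θ x)) (sizeSum-weighted (suc n) θ))
        (trans (sym (Sum-- Vs _ _)) (sizeSum-cong (2 ℕ.+ n) (λ x → trans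
          (solve 2 (λ x t → x :* (x :* t) :- x :* t := x :* ((x :- con 1ℚ) :* t)) refl (nat x) (θ x)) (x[x-1]θ≡ψ x))))
      N-1≤2N-s : N-1 ≤ nat 2 * (N - s)
      N-1≤2N-s = ≤-by (0≤-+ 0≤1 (≤⇒0≤ (subst (_≤ N) (nat-* 2 ∣ A ∣) (nat-mono 2s≤n))))
        (trans (cong (λ z → N-1 + (1ℚ + (z - nat 2 * s))) N≡1+N-1)
          (trans (solve 2 (λ M s → M :+ (con 1ℚ :+ ((con 1ℚ :+ M) :- con (nat 2) :* s)) :=
              con (nat 2) :* ((con 1ℚ :+ M) :- s)) refl N-1 s)
            (cong (λ z → nat 2 * (z - s)) (sym N≡1+N-1))))
      1≤nat : ∀ {z} → z ≢ 0 → 1ℚ ≤ nat z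
      1≤nat z≢0 = nat-mono {1} (ℕ.n≢0⇒n>0 z≢0)
      pointwise : ∀ V → nat ∣ A ∩ V ∣ * (nat ∣ V ∣ * θ ∣ V ∣) - nat ∣ A ∩ V ∣ * nat ∣ A ∩ V ∣ * θ ∣ V ∣ ≤ φ ∣ V ∣ *
          (1ℚ - ⟦ separated? A V ⟧)
      pointwise V with separated? A V
      ... | yes (inj₁ e) rewrite e = ≤-reflexive
          (solve 3 (λ x t f → con 0ℚ :* (x :* t) :- con 0ℚ :* con 0ℚ :* t := f :* (con 1ℚ :- con 1ℚ))
              refl (nat ∣ V ∣) (θ ∣ V ∣) (φ ∣ V ∣))
      ... | yes (inj₂ e) rewrite e = ≤-reflexive
          (solve 3 (λ x t f → x :* (x :* t) :- x :* x :* t := f :* (con 1ℚ :- con 1ℚ))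
              refl (nat ∣ V ∣) (θ ∣ V ∣) (φ ∣ V ∣))
      ... | no ¬sep = begin
        z * (x * t) - z * z * t
          ≤⟨ ≤-by (0≤-* (0≤-+ (0≤-* (≤⇒0≤ (nat-mono (∣p∩q∣≤∣q∣ A V))) (≤⇒0≤ 1≤x))
              (0≤-* (0≤nat ∣ A ∩ V ∣) (≤⇒0≤ 1≤z))) (0≤θ ∣ V ∣))
               (solve 3 (λ z x t → z :* (x :* t) :- z :* z :* t :+
                   ((x :- z) :* (x :- con 1ℚ) :+ z :* (z :- con 1ℚ)) :* t
                  := x :* ((x :- con 1ℚ) :* t)) refl z x t) ⟩
        x * ((x - 1ℚ) * t)        ≡⟨ x[x-1]θ≡ψ ∣ V ∣ ⟩
        ψ ∣ V ∣                   ≤⟨ *-monoʳ (0≤φ ∣ V ∣) (atLeastTwo≤1 ∣ V ∣) ⟩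
        1ℚ * φ ∣ V ∣              ≡⟨ *-comm 1ℚ (φ ∣ V ∣) ⟩
        φ ∣ V ∣ * 1ℚ ∎
        where
        z = nat ∣ A ∩ V ∣
        x = nat ∣ V ∣
        t = θ ∣ V ∣
        1≤z : 1ℚ ≤ z
        1≤z = 1≤nat (¬sep ∘ inj₁)
        1≤x : 1ℚ ≤ x
        1≤x = ≤-trans 1≤z (nat-mono (∣p∩q∣≤∣q∣ A V))
        atLeastTwo≤1 : ∀ x → atLeastTwo x ≤ 1ℚ
        atLeastTwo≤1 0             = 0≤1
        atLeastTwo≤1 1             = 0≤1
        atLeastTwo≤1 (suc (suc _)) = ≤-refl

  -- All edges together: moments and isolated nodes

  Prod-1+-≼exp : ∀ {A : Set} (xs : List A) (u : A → ℚ) → (∀ x → 0ℚ ≤ u x) →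
    Prod xs (λ x → 1ℚ + u x) ≼exp Sum xs u
  Prod-1+-≼exp []       u 0≤u = [] , [] , ≤-refl , ≤-refl
  Prod-1+-≼exp (x ∷ xs) u 0≤u = *-≼exp (≤-trans 0≤1 (≤-by (0≤u x) refl)) (1+-≼exp (0≤u x)) (Prod-1+-≼exp xs u 0≤u)

  ≤Sum-allFin : ∀ {m} {f : Fin m → ℚ} → (∀ k → 0ℚ ≤ f k) → ∀ k → f k ≤ Sum (allFin m) f
  ≤Sum-allFin {suc m} {f} 0≤f zero = ≤-by (Sum-nonneg (allFin m) (λ k → 0≤f (suc k))) (sym (Sum-suc f))
  ≤Sum-allFin {suc m} {f} 0≤f (suc k) = ≤-trans (≤Sum-allFin (λ k → 0≤f (suc k)) k)
    (≤-by (0≤f zero) (trans (+-comm _ (f zero)) (sym (Sum-suc f))))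

  -- (1 + H/2)² has a certificate with exponent H and is therefore at most n, while H² ≤ 4(1 +
  -- H/2)². This growth bound makes the correlations negligible in the sparse case.
  logApprox²≤4n : ∀ p i → 0ℚ ≤ logApprox p i → logApprox p i * logApprox p i ≤ nat 4 * nat (suc p)
  logApprox²≤4n p i 0≤H = ≤-trans
    (≤-by (0≤-+ (0≤nat 4) (0≤-* (0≤nat 4) 0≤H))
      (solve 1 (λ h → h :* h :+ (con (nat 4) :+ con (nat 4) :* h) :=
          con (nat 4) :* ((con 1ℚ :+ con ½ :* h) :* (con 1ℚ :+ con ½ :* h))) refl H))
    (*-monoˡ (0≤nat 4) (≼exp-log p i (0≤-* 0≤1+½H 0≤1+½H)
      (subst ((1ℚ + ½ * H) * (1ℚ + ½ * H) ≼exp_) (solve 1 (λ h → con ½ :* h :+ con ½ :* h := h) refl H)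
          (*-≼exp 0≤1+½H (1+-≼exp 0≤½H) (1+-≼exp 0≤½H)))))
    where
    H = logApprox p i
    0≤½H : 0ℚ ≤ ½ * H
    0≤½H = 0≤-* (nonNegative⁻¹ ½) 0≤H
    0≤1+½H : 0ℚ ≤ 1ℚ + ½ * H
    0≤1+½H = 0≤-+ 0≤1 0≤½H

  module Model {n m : ℕ} (L : Laws (2 ℕ.+ n) m) where

    open Laws L public
    open Expectation L public

    module Law (k : Fin m) = SingleLaw n (φ k) (0≤φ k) (mass-1 k)

    ks : List (Fin m)
    ks = allFin m

    N r : ℚ
    N = nat (2 ℕ.+ n)
    r = proj₁ (inverse (0<nat (suc n)))

    0≤r : 0ℚ ≤ r
    0≤r = <⇒≤ (proj₁ (proj₂ (inverse (0<nat (suc n)))))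

    Nr≡1 : N * r ≡ 1ℚ
    Nr≡1 = proj₂ (proj₂ (inverse (0<nat (suc n))))

    0≤N : 0ℚ ≤ N
    0≤N = 0≤nat (2 ℕ.+ n)

    r≤1 : r ≤ 1ℚ
    r≤1 = ≤-trans (≤-reflexive (sym (*-identityˡ r)))
        (≤-trans (*-monoʳ 0≤r (nat-mono {1} {2 ℕ.+ n} (s≤s z≤n))) (≤-reflexive Nr≡1))

    p q : Fin m → ℚ
    p k = Law.p k
    q k = Law.q k

    -- The first three are m times the moments (F)₀, (F)₁, (F)₂ of the laws. `Q`, which is T₂/N²,
    -- bounds both the sum of the pₖ² and the sum of the qₖ.
    T₀ T₁ T₂ Q : ℚ
    T₀ = Sum ks (λ k → Law.t₀ k)
    T₁ = Sum ks (λ k → Law.t₁ k)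
    T₂ = Sum ks (λ k → Law.t₂ k)
    Q = r * r * T₂

    0≤T₁ : 0ℚ ≤ T₁
    0≤T₁ = Sum-nonneg ks (λ k → Law.0≤t₁ k)

    2T₀≤T₁ : nat 2 * T₀ ≤ T₁
    2T₀≤T₁ = ≤-trans (≤-reflexive (sym (Sum-* ks (nat 2) _))) (Sum-mono ks (λ k → Law.2t₀≤t₁ k))

    2T₁≤T₂ : nat 2 * T₁ ≤ T₂
    2T₁≤T₂ = ≤-trans (≤-reflexive (sym (Sum-* ks (nat 2) _))) (Sum-mono ks (λ k → Law.2t₁≤t₂ k))

    0≤T₀ : 0ℚ ≤ T₀
    0≤T₀ = Sum-nonneg ks (λ k → Law.0≤t₀ k)

    T₀≤T₁ : T₀ ≤ T₁
    T₀≤T₁ = ≤-trans (≤-by 0≤T₀ (solve 1 (λ t → t :+ t := con (nat 2) :* t) refl T₀)) 2T₀≤T₁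

    0≤r² : 0ℚ ≤ r * r
    0≤r² = 0≤-* 0≤r 0≤r

    0≤Q : 0ℚ ≤ Q
    0≤Q = 0≤-* 0≤r² (Sum-nonneg ks (λ k → Law.0≤t₂ k))

    p≡rt₁ : ∀ k → p k ≡ r * Law.t₁ k
    p≡rt₁ k = begin
      p k                ≡⟨ sym (*-identityˡ (p k)) ⟩
      1ℚ * p k           ≡⟨ cong (_* p k) (sym Nr≡1) ⟩
      N * r * p k        ≡⟨ solve 3 (λ N r p → N :* r :* p := r :* (N :* p)) refl N r (p k) ⟩
      r * (N * p k)      ≡⟨ cong (_*_ r) (Law.Np≡t₁ k) ⟩
      r * Law.t₁ k       ∎
      where open ≡-Reasoning

    Sum-p : Sum ks p ≡ r * T₁
    Sum-p = trans (Sum-cong ks p≡rt₁) (Sum-* ks r _)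

    p²≤r²t₂ : ∀ k → p k * p k ≤ r * r * Law.t₂ k
    p²≤r²t₂ k = ≤-trans (≤-reflexive (trans (cong (λ z → z * z) (p≡rt₁ k))
        (solve 2 (λ r t → (r :* t) :* (r :* t) := r :* r :* (t :* t)) refl r (Law.t₁ k))))
      (*-monoˡ 0≤r² (Law.t₁²≤t₂ k))

    Sum-r²t₂ : Sum ks (λ k → r * r * Law.t₂ k) ≡ Q
    Sum-r²t₂ = Sum-* ks (r * r) _

    q≤r²t₂ : ∀ k → q k ≤ r * r * Law.t₂ k
    q≤r²t₂ k = ≤-trans (≤-reflexive (begin
      q k                        ≡⟨ sym (trans (*-identityʳ _) (*-identityˡ (q k))) ⟩
      1ℚ * q k * 1ℚ              ≡⟨ cong₂ (λ a b → a * q k * b) (sym Nr≡1) (sym Nr≡1) ⟩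
      N * r * q k * (N * r)      ≡⟨ solve 3 (λ N r q → N :* r :* q :* (N :* r) := r :* r :* (N :* N :* q)) refl N r
          (q k) ⟩
      r * r * (N * N * q k)      ∎))
      (*-monoˡ 0≤r² (Law.N²q≤t₂ k))
      where open ≡-Reasoning

    isolated : Fin (2 ℕ.+ n) → Tuple → ℚ
    isolated i V = Prod ks (λ k → avoids i (lookup V k))

    isolatedCount : Tuple → ℚ
    isolatedCount V = Sum (allFin (2 ℕ.+ n)) (λ i → isolated i V)

    -- The probabilities that one given node, respectively two given distinct nodes, are isolated; 1
    -- - 2p + q is inclusion and exclusion for a single edge.
    P₁ P₂ : ℚ
    P₁ = Prod ks (λ k → 1ℚ - p k)
    P₂ = Prod ks (λ k → 1ℚ - p k - p k + q k)

    𝔼-isolatedCount : 𝔼 isolatedCount ≡ N * P₁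
    𝔼-isolatedCount = trans (𝔼-Sum (allFin (2 ℕ.+ n)) isolated)
      (trans (Sum-cong (allFin (2 ℕ.+ n))
          (λ i → trans (𝔼-Prod (λ k → avoids i)) (Prod-cong ks (λ k → Law.E-avoids k i))))
        (Sum-const (2 ℕ.+ n) P₁))

    𝔼-isolatedCount² : 𝔼 (λ V → isolatedCount V * isolatedCount V) ≡ N * N * P₂ + N * (P₁ - P₂)
    𝔼-isolatedCount² = begin
      𝔼 (λ V → isolatedCount V * isolatedCount V)
        ≡⟨ 𝔼-cong (λ V → trans (sym (Sum-*ʳ is (isolatedCount V) (λ i → isolated i V)))
             (Sum-cong is (λ i → trans (sym (Sum-* is (isolated i V) (λ j → isolated j V)))
               (Sum-cong is (λ j → trans (sym (Prod-* ks _ _)) (sym (*-identityˡ _))))))) ⟩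
      -- The factor `1ℚ` prepares the form of `Sum-pairs` with constant coefficients.
      𝔼 (λ V → Sum is (λ i → Sum is (λ j → 1ℚ * Prod ks (λ k → avoids i (lookup V k) * avoids j (lookup V k)))))
        ≡⟨ trans (𝔼-Sum is _) (Sum-cong is (λ i → trans (𝔼-Sum is _) (Sum-cong is (λ j →
             trans (𝔼-* 1ℚ _) (cong (_*_ 1ℚ) (𝔼-Prod (λ k V → avoids i V * avoids j V))))))) ⟩
      Sum is (λ i → Sum is (λ j → (1ℚ * 1ℚ) * Prod ks (λ k → 𝔼₁ k (λ V → avoids i V * avoids j V))))
        ≡⟨ Sum-pairs (λ _ → 1ℚ) _ P₁ P₂ (λ _ → refl)
             (λ i → Prod-cong ks (λ k → Law.E-avoids-diag k i))
             (λ i j i≢j → Prod-cong ks (λ k → Law.E-avoids-off k i j i≢j)) ⟩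
      S * S * P₂ + S * (P₁ - P₂)
        ≡⟨ cong (λ s → s * s * P₂ + s * (P₁ - P₂)) (trans (Sum-const (2 ℕ.+ n) 1ℚ) (*-identityʳ N)) ⟩
      N * N * P₂ + N * (P₁ - P₂) ∎
      where
      open ≡-Reasoning
      is = allFin (2 ℕ.+ n)
      S = Sum is (λ _ → 1ℚ)

    -- Sparse case: many isolated nodes, weakly correlated

    module Sparse (b K : ℚ) (i : ℕ) (1≤b : 1ℚ ≤ b) (64b≤K : nat 64 * b ≤ K)
      (T₂≤bT₀+1 : T₂ ≤ b * T₀ + 1ℚ) (K≤H-rT₁ : K ≤ logApprox (suc n) i - r * T₁) where

      open ≤-Reasoning

      H : ℚ
      H = logApprox (suc n) i

      0≤b : 0ℚ ≤ b
      0≤b = ≤-trans 0≤1 1≤b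

      1≤K : 1ℚ ≤ K
      1≤K = ≤-trans (≤-trans 1≤b (≤-by (0≤-* (0≤nat 63) 0≤b)
          (solve 1 (λ b → b :+ con (nat 63) :* b := con (nat 64) :* b) refl b))) 64b≤K

      0≤K : 0ℚ ≤ K
      0≤K = ≤-trans 0≤1 1≤K

      0≤rT₁ : 0ℚ ≤ r * T₁
      0≤rT₁ = 0≤-* 0≤r 0≤T₁

      K+rT₁≤H : K + r * T₁ ≤ H
      K+rT₁≤H = ≤-by (≤⇒0≤ K≤H-rT₁) (solve 3 (λ k t h → k :+ t :+ ((h :- t) :- k) := h) refl K (r * T₁) H)

      K≤H : K ≤ H
      K≤H = ≤-trans (≤-by 0≤rT₁ refl) K+rT₁≤H

      1≤H : 1ℚ ≤ H
      1≤H = ≤-trans 1≤K K≤H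

      0≤H : 0ℚ ≤ H
      0≤H = ≤-trans 0≤1 1≤H

      rT₁≤H : r * T₁ ≤ H
      rT₁≤H = ≤-trans (≤-by 0≤K (+-comm (r * T₁) K)) K+rT₁≤H

      rT₂≤2bH : r * T₂ ≤ nat 2 * b * H
      rT₂≤2bH = begin
        r * T₂                         ≤⟨ *-monoˡ 0≤r T₂≤bT₀+1 ⟩
        r * (b * T₀ + 1ℚ)              ≤⟨ *-monoˡ 0≤r (+-monoˡ-≤ 1ℚ (*-monoˡ 0≤b T₀≤T₁)) ⟩
        r * (b * T₁ + 1ℚ)              ≡⟨ solve 3
            (λ r b t → r :* (b :* t :+ con 1ℚ) := b :* (r :* t) :+ r) refl r b T₁ ⟩
        b * (r * T₁) + r               ≤⟨ +-mono-≤ (*-monoˡ 0≤b rT₁≤H) r≤bH ⟩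
        b * H + b * H                  ≡⟨ solve 2 (λ b h → b :* h :+ b :* h := con (nat 2) :* b :* h) refl b H ⟩
        nat 2 * b * H                  ∎
        where
        r≤bH : r ≤ b * H
        r≤bH = ≤-trans r≤1 (≤-trans (≤-reflexive (sym (*-identityʳ 1ℚ))) (*-mono 0≤1 0≤H 1≤b 1≤H))

      -- Q is of order (log n)/n by `rT₂≤2bH`, so that QH is of order (log n)²/n, which
      -- `logApprox²≤4n` bounds. Since K ≤ H, the same bound holds for QK.
      QH≤8b : Q * H ≤ nat 8 * b
      QH≤8b = begin
        r * r * T₂ * H                 ≡⟨ solve 3 (λ r t h → r :* r :* t :* h := (r :* h) :* (r :* t)) refl r T₂ H ⟩
        r * H * (r * T₂)               ≤⟨ *-monoˡ (0≤-* 0≤r 0≤H) rT₂≤2bH ⟩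
        r * H * (nat 2 * b * H)        ≡⟨ solve 3
            (λ r b h → r :* h :* (con (nat 2) :* b :* h) := (con (nat 2) :* b :* r) :* (h :* h)) refl r b H ⟩
        nat 2 * b * r * (H * H)        ≤⟨ *-monoˡ (0≤-* (0≤-* (0≤nat 2) 0≤b) 0≤r) (logApprox²≤4n (suc n) i 0≤H) ⟩
        nat 2 * b * r * (nat 4 * N)    ≡⟨ solve 3
            (λ b r N → con (nat 2) :* b :* r :* (con (nat 4) :* N) := con (nat 8) :* b :* (N :* r)) refl b r N ⟩
        nat 8 * b * (N * r)            ≡⟨ trans (cong (_*_ (nat 8 * b)) Nr≡1) (*-identityʳ _) ⟩
        nat 8 * b                      ∎

      QK≤8b : Q * K ≤ nat 8 * b
      QK≤8b = ≤-trans (*-monoˡ 0≤Q K≤H) QH≤8b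

      -- The assumption 64b ≤ K is made for this: 64bQ ≤ QK ≤ 8b.
      8Q≤1 : nat 8 * Q ≤ 1ℚ
      8Q≤1 = *-cancelˡ (<-≤-trans (0<1) 1≤8b) (begin
        nat 8 * b * (nat 8 * Q)   ≡⟨ solve 2
            (λ b q → con (nat 8) :* b :* (con (nat 8) :* q) := q :* (con (nat 64) :* b)) refl b Q ⟩
        Q * (nat 64 * b)          ≤⟨ *-monoˡ 0≤Q 64b≤K ⟩
        Q * K                     ≤⟨ QK≤8b ⟩
        nat 8 * b                 ≡⟨ sym (*-identityʳ _) ⟩
        nat 8 * b * 1ℚ            ∎)
        where
        1≤8b : 1ℚ ≤ nat 8 * b
        1≤8b = ≤-trans 1≤b (≤-by (0≤-* (0≤nat 7) 0≤b)
            (solve 1 (λ b → b :+ con (nat 7) :* b := con (nat 8) :* b) refl b))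

      p²≤¼ : ∀ k → nat 4 * (p k * p k) ≤ 1ℚ
      p²≤¼ k = begin
        nat 4 * (p k * p k)            ≤⟨ *-monoˡ (0≤nat 4) (≤-trans (p²≤r²t₂ k) (≤-trans
                                            (≤Sum-allFin (λ k → 0≤-* 0≤r² (Law.0≤t₂ k)) k) (≤-reflexive Sum-r²t₂))) ⟩
        nat 4 * Q                      ≤⟨ ≤-by (0≤-* (0≤nat 4) 0≤Q)
            (solve 1 (λ q → con (nat 4) :* q :+ con (nat 4) :* q := con (nat 8) :* q) refl Q) ⟩
        nat 8 * Q                      ≤⟨ 8Q≤1 ⟩
        1ℚ                             ∎

      0≤1-2p : ∀ k → 0ℚ ≤ 1ℚ - nat 2 * p k
      0≤1-2p k with ≤-total (nat 2 * p k) 1ℚ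
      ... | inj₁ h = ≤⇒0≤ h
      -- If 2p ≥ 1, then 2p ≤ (2p)² ≤ 1, which replaces taking a square root.
      ... | inj₂ h = ≤⇒0≤ (begin
        nat 2 * p k                    ≡⟨ sym (*-identityʳ _) ⟩
        nat 2 * p k * 1ℚ               ≤⟨ *-monoˡ (≤-trans 0≤1 h) h ⟩
        nat 2 * p k * (nat 2 * p k)    ≡⟨ solve 1
            (λ p → con (nat 2) :* p :* (con (nat 2) :* p) := con (nat 4) :* (p :* p)) refl (p k) ⟩
        nat 4 * (p k * p k)            ≤⟨ p²≤¼ k ⟩
        1ℚ                             ∎)

      0≤1-p : ∀ k → 0ℚ ≤ 1ℚ - p k
      0≤1-p k = ≤-trans (0≤1-2p k) (≤-by (Law.0≤p k)
          (solve 1 (λ p → con 1ℚ :- con (nat 2) :* p :+ p := con 1ℚ :- p) refl (p k)))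

      -- 1 + p + 2p² is an upper bound of 1/(1 - p) for p ≤ 1/2, as (1 + u)(1 - p) = 1 + p²(1 - 2p).
      -- Thus a lower bound for ∏ (1 - p) is obtained from an upper bound for ∏ (1 + u).
      u : Fin m → ℚ
      u k = p k + nat 2 * (p k * p k)

      0≤u : ∀ k → 0ℚ ≤ u k
      0≤u k = 0≤-+ (Law.0≤p k) (0≤-* (0≤nat 2) (0≤∣p∣² (p k)))

      Sum-u : Sum ks u ≤ r * T₁ + 1ℚ
      Sum-u = begin
        Sum ks u
            ≡⟨ trans (Sum-+ ks p _) (cong₂ _+_ Sum-p (Sum-* ks (nat 2) _)) ⟩
        r * T₁ + nat 2 * Sum ks (λ k → p k * p k)
            ≤⟨ +-monoʳ-≤ (r * T₁) (*-monoˡ (0≤nat 2) (≤-trans (Sum-mono ks p²≤r²t₂) (≤-reflexive Sum-r²t₂))) ⟩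
        r * T₁ + nat 2 * Q                                  ≤⟨ +-monoʳ-≤ (r * T₁) (≤-trans (≤-by (0≤-* (0≤nat 6) 0≤Q)
                                                                 (solve 1 (λ q → con (nat 2) :* q :+ con
                                                                     (nat 6) :* q := con (nat 8) :* q) refl Q))
                                                                     8Q≤1) ⟩
        r * T₁ + 1ℚ                                         ∎

      U : ℚ
      U = Prod ks (λ k → 1ℚ + u k)

      0≤U : 0ℚ ≤ U
      0≤U = Prod-nonneg ks (λ k → 0≤-+ 0≤1 (0≤u k))

      -- K = 1 + (K - 1) costs only K - 1 in the exponent. The 1 thus saved covers the quadratic
      -- part of ∑ u, so that the total is K + r T₁ ≤ H.
      KU≤N : K * U ≤ N
      KU≤N = ≼exp-log (suc n) i (0≤-* 0≤K 0≤U)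
        (weaken-≼exp total (subst (λ z → z * U ≼exp (K - 1ℚ) + Sum ks u)
            (solve 1 (λ k → con 1ℚ :+ (k :- con 1ℚ) := k) refl K)
          (*-≼exp (≤-trans 0≤1 (≤-by (≤⇒0≤ 1≤K) refl)) (1+-≼exp (≤⇒0≤ 1≤K)) (Prod-1+-≼exp ks u 0≤u))))
        where
        total : (K - 1ℚ) + Sum ks u ≤ H
        total = ≤-trans (+-monoʳ-≤ (K - 1ℚ) Sum-u)
          (≤-trans (≤-reflexive (solve 2 (λ k t → (k :- con 1ℚ) :+ (t :+ con 1ℚ) := k :+ t) refl K (r * T₁))) K+rT₁≤H)

      0≤P₁ : 0ℚ ≤ P₁
      0≤P₁ = Prod-nonneg ks 0≤1-p

      1≤UP₁ : 1ℚ ≤ U * P₁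
      1≤UP₁ = begin
        1ℚ                                          ≡⟨ sym (Prod-1 ks {λ _ → 1ℚ} (λ _ → refl)) ⟩
        Prod ks (λ _ → 1ℚ)
            ≤⟨ Prod-mono ks (λ _ → 0≤1) (λ k → ≤-by (0≤-* (0≤∣p∣² (p k)) (0≤1-2p k))
          (solve 1 (λ p → con 1ℚ :+ p :* p :* (con 1ℚ :- con (nat 2) :* p) :=
              (con 1ℚ :+ (p :+ con (nat 2) :* (p :* p))) :* (con 1ℚ :- p)) refl (p k))) ⟩
        Prod ks (λ k → (1ℚ + u k) * (1ℚ - p k))     ≡⟨ Prod-* ks _ _ ⟩
        U * P₁                                      ∎

      μ : ℚ
      μ = N * P₁

      K≤μ : K ≤ μ
      K≤μ = begin
        K               ≡⟨ sym (*-identityʳ K) ⟩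
        K * 1ℚ          ≤⟨ *-monoˡ 0≤K 1≤UP₁ ⟩
        K * (U * P₁)    ≡⟨ sym (*-assoc K U P₁) ⟩
        K * U * P₁      ≤⟨ *-monoʳ 0≤P₁ KU≤N ⟩
        N * P₁          ∎

      -- Bounds the correlation of two isolated nodes: (1 - p)² ≥ 1/4 turns the summand q of 1 - 2p
      -- + q into a factor 1 + 4q next to (1 - p)².
      G : ℚ
      G = Prod ks (λ k → 1ℚ + nat 4 * q k)

      0≤4q : ∀ k → 0ℚ ≤ nat 4 * q k
      0≤4q k = 0≤-* (0≤nat 4) (Law.0≤q k)

      Sum-4q : Sum ks (λ k → nat 4 * q k) ≤ nat 4 * Q
      Sum-4q = ≤-trans (≤-reflexive (Sum-* ks (nat 4) q))
        (*-monoˡ (0≤nat 4) (≤-trans (Sum-mono ks q≤r²t₂) (≤-reflexive Sum-r²t₂)))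

      -- The certificate for G, tested against the single factor 1 - 4Q, gives G(1 - 4Q) ≤ 1, and (1
      -- - 4Q)(1 + 8Q) = 1 + 4Q(1 - 8Q) ≥ 1.
      G≤1+8Q : G ≤ 1ℚ + nat 8 * Q
      G≤1+8Q = begin
        G
          ≤⟨ ≤-by (0≤-* 0≤G (0≤-* (0≤-* (0≤nat 4) 0≤Q) (≤⇒0≤ 8Q≤1)))
               (solve 2 (λ g q → g :+ g :* (con (nat 4) :* q :* (con 1ℚ :- con (nat 8) :* q))
                  := g :* ((con 1ℚ :- con (nat 4) :* q) :* con 1ℚ) :* (con 1ℚ :+ con (nat 8) :* q)) refl G Q) ⟩
        G * ((1ℚ - nat 4 * Q) * 1ℚ) * (1ℚ + nat 8 * Q)
          ≤⟨ *-monoʳ (0≤-+ 0≤1 (0≤-* (0≤nat 8) 0≤Q)) (≼exp-bound (Prod-1+-≼exp ks (λ k → nat 4 * q k) 0≤4q)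
               (nat 4 * Q ∷ []) ((0≤-* (0≤nat 4) 0≤Q , 4Q≤1) ∷ [])
                   (≤-trans Sum-4q (≤-reflexive (sym (+-identityʳ _))))) ⟩
        1ℚ * (1ℚ + nat 8 * Q)    ≡⟨ *-identityˡ _ ⟩
        1ℚ + nat 8 * Q ∎
        where
        0≤G : 0ℚ ≤ G
        0≤G = Prod-nonneg ks (λ k → 0≤-+ 0≤1 (0≤4q k))
        4Q≤1 : nat 4 * Q ≤ 1ℚ
        4Q≤1 = ≤-trans (≤-by (0≤-* (0≤nat 4) 0≤Q)
            (solve 1 (λ q → con (nat 4) :* q :+ con (nat 4) :* q := con (nat 8) :* q) refl Q)) 8Q≤1

      0≤1-2p+q : ∀ k → 0ℚ ≤ 1ℚ - p k - p k + q k
      0≤1-2p+q k = subst (0ℚ ≤_) (solve 2 (λ p q → (con 1ℚ :- con (nat 2) :* p) :+ q := con 1ℚ :- p :- p :+ q) refl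
          (p k) (q k))
        (0≤-+ (0≤1-2p k) (Law.0≤q k))

      0≤P₂ : 0ℚ ≤ P₂
      0≤P₂ = Prod-nonneg ks 0≤1-2p+q

      P₂≤P₁²G : P₂ ≤ P₁ * P₁ * G
      P₂≤P₁²G = begin
        P₂
          ≤⟨ Prod-mono ks 0≤1-2p+q (λ k → ≤-by
               (0≤-+ (0≤∣p∣² (p k)) (0≤-* (Law.0≤q k) (0≤-* (0≤1-2p k) (0≤-+ (0≤-+ 0≤1 (0≤1-2p k)) 0≤1))))
               (solve 2 (λ p q → con 1ℚ :- p :- p :+ q :+
                   (p :* p :+ q :* ((con 1ℚ :- con (nat 2) :* p) :*
                   (con 1ℚ :+ (con 1ℚ :- con (nat 2) :* p) :+ con 1ℚ)))
                 := (con 1ℚ :- p) :* (con 1ℚ :- p) :* (con 1ℚ :+ con (nat 4) :* q)) refl (p k) (q k))) ⟩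
        Prod ks (λ k → (1ℚ - p k) * (1ℚ - p k) * (1ℚ + nat 4 * q k))
          ≡⟨ trans (Prod-* ks _ _) (cong (_* G) (Prod-* ks _ _)) ⟩
        P₁ * P₁ * G ∎

      0<μ : 0ℚ < μ
      0<μ = <-≤-trans (0<1) (≤-trans 1≤K K≤μ)

      connectedness : ℚ
      connectedness = Pr (connected? {2 ℕ.+ n} {m})

      μμPr≤ : μ * μ * connectedness ≤ μ * (nat 8 * Q * μ + 1ℚ)
      μμPr≤ = begin
        μ * μ * connectedness
          ≡⟨ cong (λ z → z * z * connectedness) (sym 𝔼-isolatedCount) ⟩
        𝔼 isolatedCount * 𝔼 isolatedCount * connectedness
          ≤⟨ chebyshev connected? isolatedCount (λ V conn → trans
               (Sum-cong (allFin (2 ℕ.+ n)) (λ i → connected⇒covered V conn i)) (Sum-0 (allFin (2 ℕ.+ n)))) ⟩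
        𝔼 (λ V → isolatedCount V * isolatedCount V) - 𝔼 isolatedCount * 𝔼 isolatedCount
          ≡⟨ cong₂ (λ a b → a - b * b) 𝔼-isolatedCount² 𝔼-isolatedCount ⟩
        N * N * P₂ + N * (P₁ - P₂) - μ * μ
          ≤⟨ ≤-by (0≤-* 0≤N 0≤P₂) (solve 3
              (λ N P₁ P₂ → N :* N :* P₂ :+ N :* (P₁ :- P₂) :- (N :* P₁) :* (N :* P₁) :+ N :* P₂
               := N :* N :* P₂ :+ N :* P₁ :- (N :* P₁) :* (N :* P₁)) refl N P₁ P₂) ⟩
        N * N * P₂ + μ - μ * μ
          ≤⟨ +-monoˡ-≤ _ (+-monoˡ-≤ μ (*-monoˡ (0≤-* 0≤N 0≤N) (≤-trans P₂≤P₁²G (*-monoˡ (0≤-* 0≤P₁ 0≤P₁) G≤1+8Q)))) ⟩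
        N * N * (P₁ * P₁ * (1ℚ + nat 8 * Q)) + μ - μ * μ
          ≡⟨ solve 3 (λ N P q → N :* N :* (P :* P :* (con 1ℚ :+ con (nat 8) :* q)) :+ N :* P :- (N :* P) :* (N :* P)
               := N :* P :* (con (nat 8) :* q :* (N :* P) :+ con 1ℚ)) refl N P₁ Q ⟩
        μ * (nat 8 * Q * μ + 1ℚ) ∎

      μPr≤ : μ * connectedness ≤ nat 8 * Q * μ + 1ℚ
      μPr≤ = *-cancelˡ 0<μ (≤-trans (≤-reflexive (sym (*-assoc μ μ connectedness))) μμPr≤)

      -- Chebyshev's inequality amounts to Pr ≤ 8Q + 1/μ. Both summands are of order 1/K, by QK ≤ 8b
      -- and K ≤ μ.
      K*Pr-connected≤ : K * connectedness ≤ nat 64 * b + 1ℚ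
      K*Pr-connected≤ = *-cancelˡ 0<μ (begin
        μ * (K * connectedness)
            ≡⟨ solve 3 (λ a b c → a :* (b :* c) := b :* (a :* c)) refl μ K connectedness ⟩
        K * (μ * connectedness)              ≤⟨ *-monoˡ 0≤K μPr≤ ⟩
        K * (nat 8 * Q * μ + 1ℚ)
            ≡⟨ solve 3 (λ k q μ → k :* (con (nat 8) :* q :* μ :+ con 1ℚ) := μ :* (con (nat 8) :* (q :* k)) :+ k)
            refl K Q μ ⟩
        μ * (nat 8 * (Q * K)) + K            ≤⟨ +-mono-≤ (*-monoˡ (<⇒≤ 0<μ) (*-monoˡ (0≤nat 8) QK≤8b)) K≤μ ⟩
        μ * (nat 8 * (nat 8 * b)) + μ
            ≡⟨ solve 2 (λ μ b → μ :* (con (nat 8) :* (con (nat 8) :* b)) :+ μ := μ :* (con (nat 64) :* b :+ con 1ℚ))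
            refl μ b ⟩
        μ * (nat 64 * b + 1ℚ)                ∎)

  -- Dense case: union bound with weights

  ^-inverse : ∀ {a b} → a * b ≡ 1ℚ → ∀ s → a ^ s * b ^ s ≡ 1ℚ
  ^-inverse e zero = refl
  ^-inverse {a} {b} e (suc s) = trans
    (solve 4 (λ a b c d → (a :* c) :* (b :* d) := (a :* b) :* (c :* d)) refl a b (a ^ s) (b ^ s))
    (trans (cong₂ _*_ e (^-inverse e s)) (*-identityʳ 1ℚ))

  1≤^ : ∀ {a} → 1ℚ ≤ a → ∀ s → 1ℚ ≤ a ^ s
  1≤^ 1≤a zero    = ≤-refl
  1≤^ {a} 1≤a (suc s) = *-mono {1ℚ} {a} 0≤1 (≤-trans 0≤1 (1≤^ 1≤a s)) 1≤a (1≤^ 1≤a s)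

  module Disconnection {n m : ℕ} (L : Laws (2 ℕ.+ n) m) where

    open Model L public

    Vs : List (Subset (2 ℕ.+ n))
    Vs = subsets (2 ℕ.+ n)

    disconnected? : Decidable _
    disconnected? V = ¬? (connected? {2 ℕ.+ n} {m} V)

    Pr-complement : Pr (connected? {2 ℕ.+ n} {m}) + Pr disconnected? ≡ 1ℚ
    Pr-complement = trans (sym (𝔼-+ (λ V → ⟦ connected? V ⟧) (λ V → ⟦ disconnected? V ⟧)))
      (trans (𝔼-cong (λ V → complement (connected? V))) 𝔼-1)
      where
      complement : ∀ {P : Set} (P? : Dec P) → ⟦ P? ⟧ + ⟦ ¬? P? ⟧ ≡ 1ℚ
      complement (yes _) = refl
      complement (no _)  = refl

    J : Subset (2 ℕ.+ n) → Fin m → ℚ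
    J A k = Law.J k A

    separation : Subset (2 ℕ.+ n) → ℚ
    separation A = Prod ks (λ k → 1ℚ - J A k)

    Pr-disconnected≤ : Pr disconnected? ≤ Sum Vs (λ A → ⟦ minor? A ⟧ * separation A)
    Pr-disconnected≤ = ≤-trans (𝔼-mono union-bound) (≤-reflexive (trans (𝔼-Sum Vs _)
      (Sum-cong Vs (λ A → trans (𝔼-* ⟦ minor? A ⟧ _) (cong (_*_ ⟦ minor? A ⟧)
        (trans (𝔼-Prod (λ k V → ⟦ separated? A V ⟧)) (Prod-cong ks (λ k → Law.E-separated k A))))))))

    -- Since ∑ w^|A| = (1 + w)ⁿ, it is enough to compare each set A with one of two such weights.
    two-weights : ∀ {c v w} → 0ℚ ≤ c → 0ℚ ≤ v → 0ℚ ≤ w →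
      (∀ A → Minor A → c * (1ℚ + v) ^ (2 ℕ.+ n) * separation A ≤ v ^ ∣ A ∣
                     ⊎ c * (1ℚ + w) ^ (2 ℕ.+ n) * separation A ≤ w ^ ∣ A ∣) →
      c * Pr disconnected? ≤ nat 2
    two-weights {c} {v} {w} 0≤c 0≤v 0≤w h = begin
      c * Pr disconnected?                                    ≤⟨ *-monoˡ 0≤c Pr-disconnected≤ ⟩
      c * Sum Vs (λ A → ⟦ minor? A ⟧ * separation A)          ≡⟨ sym (Sum-* Vs c _) ⟩
      Sum Vs (λ A → c * (⟦ minor? A ⟧ * separation A))        ≤⟨ Sum-mono Vs (λ A → termwise A (minor? A)) ⟩
      Sum Vs (λ A → ρ₁ * v ^ ∣ A ∣ + ρ₂ * w ^ ∣ A ∣)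
          ≡⟨ trans (Sum-+ Vs _ _) (cong₂ _+_ (Sum-* Vs ρ₁ _) (Sum-* Vs ρ₂ _)) ⟩
      ρ₁ * sizeSum (2 ℕ.+ n) (v ^_) + ρ₂ * sizeSum (2 ℕ.+ n) (w ^_)
        ≡⟨ cong₂ (λ x y → ρ₁ * x + ρ₂ * y) (sizeSum-^ (2 ℕ.+ n) v) (sizeSum-^ (2 ℕ.+ n) w) ⟩
      ρ₁ * P + ρ₂ * R
          ≡⟨ cong₂ _+_ (trans (*-comm ρ₁ P) Pρ₁≡1) (trans (*-comm ρ₂ R) Rρ₂≡1) ⟩
      nat 2                                                   ∎
      where
      open ≤-Reasoning
      P R ρ₁ ρ₂ : ℚ
      P = (1ℚ + v) ^ (2 ℕ.+ n)
      R = (1ℚ + w) ^ (2 ℕ.+ n)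
      1≤P : 1ℚ ≤ P
      1≤P = 1≤^ (≤-by 0≤v refl) (2 ℕ.+ n)
      1≤R : 1ℚ ≤ R
      1≤R = 1≤^ (≤-by 0≤w refl) (2 ℕ.+ n)
      P⁻¹ = inverse (<-≤-trans (0<1) 1≤P)
      R⁻¹ = inverse (<-≤-trans (0<1) 1≤R)
      ρ₁ = proj₁ P⁻¹
      ρ₂ = proj₁ R⁻¹
      0≤ρ₁ : 0ℚ ≤ ρ₁
      0≤ρ₁ = <⇒≤ (proj₁ (proj₂ P⁻¹))
      0≤ρ₂ : 0ℚ ≤ ρ₂
      0≤ρ₂ = <⇒≤ (proj₁ (proj₂ R⁻¹))
      Pρ₁≡1 : P * ρ₁ ≡ 1ℚ
      Pρ₁≡1 = proj₂ (proj₂ P⁻¹)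
      Rρ₂≡1 : R * ρ₂ ≡ 1ℚ
      Rρ₂≡1 = proj₂ (proj₂ R⁻¹)
      scale : ∀ {X ρ D y} → X * ρ ≡ 1ℚ → 0ℚ ≤ ρ → c * X * D ≤ y → c * D ≤ ρ * y
      scale {X} {ρ} {D} {y} Xρ≡1 0≤ρ h = begin
        c * D                  ≡⟨ sym (*-identityʳ (c * D)) ⟩
        c * D * 1ℚ             ≡⟨ cong (_*_ (c * D)) (sym Xρ≡1) ⟩
        c * D * (X * ρ)        ≡⟨ solve 4 (λ c D X ρ → c :* D :* (X :* ρ) := ρ :* (c :* X :* D)) refl c D X ρ ⟩
        ρ * (c * X * D)        ≤⟨ *-monoˡ 0≤ρ h ⟩
        ρ * y                  ∎
      termwise : ∀ A (minor : Dec (Minor A)) → c * (⟦ minor ⟧ * separation A) ≤ ρ₁ * v ^ ∣ A ∣ + ρ₂ * w ^ ∣ A ∣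
      termwise A (no _) = ≤-trans (≤-reflexive (solve 2 (λ c d → c :* (con 0ℚ :* d) := con 0ℚ) refl c (separation A)))
        (0≤-+ (0≤-* 0≤ρ₁ (^-nonneg 0≤v ∣ A ∣)) (0≤-* 0≤ρ₂ (^-nonneg 0≤w ∣ A ∣)))
      termwise A (yes minor) = ≤-trans (≤-reflexive (cong (_*_ c) (*-identityˡ (separation A))))
          ([ light , heavy ]′ (h A minor))
        where
        light : c * P * separation A ≤ v ^ ∣ A ∣ → c * separation A ≤ ρ₁ * v ^ ∣ A ∣ + ρ₂ * w ^ ∣ A ∣
        light e = ≤-trans (scale Pρ₁≡1 0≤ρ₁ e) (≤-by (0≤-* 0≤ρ₂ (^-nonneg 0≤w ∣ A ∣)) refl)
        heavy : c * R * separation A ≤ w ^ ∣ A ∣ → c * separation A ≤ ρ₁ * v ^ ∣ A ∣ + ρ₂ * w ^ ∣ A ∣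
        heavy e = ≤-trans (scale Rρ₂≡1 0≤ρ₂ e) (≤-by (0≤-* 0≤ρ₁ (^-nonneg 0≤v ∣ A ∣)) (+-comm (ρ₂ * w ^ ∣ A ∣) _))

    -- Reduces the comparison of A with its weight to one of exponents. Here v = 1/w, the
    -- certificate is tested against the factors 1 - J of `separation A`, and multiplying by w^|A|
    -- removes the power of v.
    from-≼exp : ∀ {c v w S} A → c * (1ℚ + w) ^ (2 ℕ.+ n) * v ^ ∣ A ∣ ≼exp S → v * w ≡ 1ℚ → 0ℚ ≤ w →
      S ≤ Sum ks (J A) → c * (1ℚ + w) ^ (2 ℕ.+ n) * separation A ≤ w ^ ∣ A ∣
    from-≼exp {c} {v} {w} A h vw≡1 0≤w S≤J = begin
      C * D                          ≡⟨ sym (*-identityʳ (C * D)) ⟩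
      C * D * 1ℚ                     ≡⟨ cong (_*_ (C * D)) (sym (^-inverse vw≡1 ∣ A ∣)) ⟩
      C * D * (v ^ s * w ^ s)        ≡⟨ solve 4 (λ C D x y → C :* D :* (x :* y) := C :* x :* D :* y) refl C D
          (v ^ s) (w ^ s) ⟩
      C * v ^ s * D * w ^ s          ≤⟨ *-monoʳ (^-nonneg 0≤w s)
          (≼exp-bound-family h ks (J A) (λ k → Law.J-unit k A) S≤J) ⟩
      1ℚ * w ^ s                     ≡⟨ *-identityˡ _ ⟩
      w ^ s                          ∎
      where
      open ≤-Reasoning
      s = ∣ A ∣
      C = c * (1ℚ + w) ^ (2 ℕ.+ n)
      D = separation A

    -- The positive summand s q of the bound for one edge is dropped, and q is replaced by r² t₂ in
    -- the negative one.
    Sum-J-bonferroni : ∀ A → nat ∣ A ∣ * (r * T₁) - nat ∣ A ∣ * nat ∣ A ∣ * Q ≤ Sum ks (J A)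
    Sum-J-bonferroni A = begin
      s * (r * T₁) - s * s * Q
        ≡⟨ sym (trans (Sum-- ks _ _) (cong₂ _-_ (trans (Sum-* ks s p) (cong (_*_ s) Sum-p))
            (trans (Sum-* ks (s * s) _) (cong (_*_ (s * s)) Sum-r²t₂)))) ⟩
      Sum ks (λ k → s * p k - s * s * (r * r * Law.t₂ k))
        ≤⟨ Sum-mono ks (λ k → ≤-trans
             (≤-by (0≤-+ (0≤-* (0≤nat ∣ A ∣) (Law.0≤q k)) (0≤-* (0≤-* (0≤nat ∣ A ∣) (0≤nat ∣ A ∣)) (≤⇒0≤ (q≤r²t₂ k))))
               (solve 4 (λ s p q x → s :* p :- s :* s :* x :+ (s :* q :+ s :* s :* (x :- q)) :=
                   s :* p :+ s :* q :- s :* s :* q) refl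
                 s (p k) (q k) (r * r * Law.t₂ k)))
             (Law.J-bonferroni k A)) ⟩
      Sum ks (J A) ∎
      where
      open ≤-Reasoning
      s = nat ∣ A ∣

    Sum-J-pairs : ∀ A → Minor A → nat ∣ A ∣ * T₀ ≤ nat 2 * N * Sum ks (J A)
    Sum-J-pairs A (_ , 2s≤n) = ≤-trans (≤-reflexive (sym (Sum-* ks (nat ∣ A ∣) _)))
      (≤-trans (Sum-mono ks (λ k → Law.J-pairs k A 2s≤n)) (≤-reflexive (Sum-* ks (nat 2 * N) (J A))))

    -- Dense case: exponents for small and large sets

    module Dense (b t : ℚ) (i : ℕ) (0≤b : 0ℚ ≤ b) (0≤t : 0ℚ ≤ t)
      (T₂≤bT₀+1 : T₂ ≤ b * T₀ + 1ℚ)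
      (H+ω≤rT₁ : logApprox (suc n) i + (nat 2 * t + nat 6) ≤ r * T₁)
      (2≤H : nat 2 ≤ logApprox (suc n) i)
      (H-large : nat 32 * ((b + 1ℚ) * (b + 1ℚ) * (b + 1ℚ)) + nat 8 * ((b + 1ℚ) * t) ≤ logApprox (suc n) i) where

      open ≤-Reasoning

      -- Since T₁ ≥ 1 in this case, adding 1 to b absorbs the summand `1ℚ` of the moment assumption
      -- into a multiple of T₁.
      β H : ℚ
      β = b + 1ℚ
      H = logApprox (suc n) i

      1≤β : 1ℚ ≤ β
      1≤β = ≤-by 0≤b (+-comm 1ℚ b)

      0≤β : 0ℚ ≤ β
      0≤β = ≤-trans 0≤1 1≤β

      0≤H : 0ℚ ≤ H
      0≤H = ≤-trans (0≤nat 2) 2≤H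

      H≤rT₁ : H ≤ r * T₁
      H≤rT₁ = ≤-trans (≤-by (0≤-+ (0≤-* (0≤nat 2) 0≤t) (0≤nat 6)) refl) H+ω≤rT₁

      1≤T₁ : 1ℚ ≤ T₁
      1≤T₁ = begin
        1ℚ             ≤⟨ ≤-trans (nat-mono {1} {2} (s≤s z≤n)) (≤-trans 2≤H H≤rT₁) ⟩
        r * T₁         ≤⟨ *-monoʳ 0≤T₁ r≤1 ⟩
        1ℚ * T₁        ≡⟨ *-identityˡ T₁ ⟩
        T₁             ∎

      T₂≤βT₁ : T₂ ≤ β * T₁
      T₂≤βT₁ = begin
        T₂              ≤⟨ T₂≤bT₀+1 ⟩
        b * T₀ + 1ℚ     ≤⟨ +-mono-≤ (*-monoˡ 0≤b T₀≤T₁) 1≤T₁ ⟩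
        b * T₁ + T₁     ≡⟨ solve 2 (λ b t → b :* t :+ t := (b :+ con 1ℚ) :* t) refl b T₁ ⟩
        β * T₁          ∎

      -- The edges counted have at least two elements, so 2T₁ ≤ T₂ ≤ bT₀ + T₁, and one T₁ cancels.
      T₁≤βT₀ : T₁ ≤ β * T₀
      T₁≤βT₀ = ≤-trans (≤-by (≤⇒0≤ 2T₁≤bT₀+T₁)
          (solve 2 (λ t x → t :+ ((x :+ t) :- con (nat 2) :* t) := x) refl T₁ (b * T₀)))
        (≤-by 0≤T₀ (solve 2 (λ b t → b :* t :+ t := (b :+ con 1ℚ) :* t) refl b T₀))
        where
        2T₁≤bT₀+T₁ : nat 2 * T₁ ≤ b * T₀ + T₁
        2T₁≤bT₀+T₁ = ≤-trans 2T₁≤T₂ (≤-trans T₂≤bT₀+1 (+-monoʳ-≤ (b * T₀) 1≤T₁))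

      0≤1+t : 0ℚ ≤ 1ℚ + t
      0≤1+t = 0≤-+ 0≤1 0≤t

      certificate : ∀ {v w S} (A : Subset (2 ℕ.+ n)) → 0ℚ ≤ v → v ≼exp S → 0ℚ ≤ w →
        (1ℚ + t) * (1ℚ + w) ^ (2 ℕ.+ n) * v ^ ∣ A ∣ ≼exp t + N * w + nat ∣ A ∣ * S
      certificate {v} {w} A 0≤v hv 0≤w =
        *-≼exp {(1ℚ + t) * (1ℚ + w) ^ (2 ℕ.+ n)} {v ^ ∣ A ∣} (0≤-* 0≤1+t (^-nonneg 0≤1+w (2 ℕ.+ n)))
          (*-≼exp {1ℚ + t} {(1ℚ + w) ^ (2 ℕ.+ n)} 0≤1+t (1+-≼exp 0≤t) (^-≼exp 0≤1+w (1+-≼exp 0≤w) (2 ℕ.+ n)))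
          (^-≼exp 0≤v hv ∣ A ∣)
        where
        0≤1+w : 0ℚ ≤ 1ℚ + w
        0≤1+w = 0≤-+ 0≤1 0≤w

      -- The weight is w = 1/N: its power (1 + w) ^ N costs at most 1 in the exponent, and each
      -- factor N costs H + 1. The case |A| ≤ n/(β log n) keeps the loss s²Q within the fraction y =
      -- βs/N of the main term s r T₁.
      small : ∀ A → Minor A → β * nat ∣ A ∣ * r * H ≤ 1ℚ →
        (1ℚ + t) * (1ℚ + r) ^ (2 ℕ.+ n) * separation A ≤ r ^ ∣ A ∣
      small A (1≤∣A∣ , _) yH≤1 =
        from-≼exp {1ℚ + t} {N} {r} A (certificate {N} {r} A 0≤N (n≼exp-log (suc n) i) 0≤r) Nr≡1 0≤r (begin
          t + N * r + s * (H + 1ℚ)         ≡⟨ cong (λ z → t + z + s * (H + 1ℚ)) Nr≡1 ⟩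
          t + 1ℚ + s * (H + 1ℚ)
            ≤⟨ ≤-by (0≤-* (≤⇒0≤ 1≤s) (0≤-+ 0≤t 0≤1))
                (solve 3 (λ t s h → t :+ con 1ℚ :+ s :* (h :+ con 1ℚ) :+ (s :- con 1ℚ) :* (t :+ con 1ℚ)
                 := s :* (h :+ con (nat 2) :+ t)) refl t s H) ⟩
          s * (H + nat 2 + t)              ≤⟨ *-monoˡ (0≤nat ∣ A ∣) bracket ⟩
          s * (r * T₁ * (1ℚ - y))
              ≡⟨ solve 4 (λ s r T β → s :* (r :* T :* (con 1ℚ :- β :* s :* r)) :=
              s :* (r :* T) :- s :* s :* (r :* r :* (β :* T))) refl s r T₁ β ⟩
          s * (r * T₁) - s * s * (r * r * (β * T₁))
            ≤⟨ ≤-by (0≤-* (0≤-* (0≤nat ∣ A ∣) (0≤nat ∣ A ∣)) (0≤-* 0≤r² (≤⇒0≤ T₂≤βT₁)))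
                 (solve 5 (λ x s r² d T → x :- s :* s :* (r² :* d) :+ s :* s :* (r² :* (d :- T)) :=
                     x :- s :* s :* (r² :* T)) refl (s * (r * T₁)) s (r * r) (β * T₁) T₂) ⟩
          s * (r * T₁) - s * s * Q         ≤⟨ Sum-J-bonferroni A ⟩
          Sum ks (J A)                     ∎)
        where
        s y : ℚ
        s = nat ∣ A ∣
        y = β * s * r
        1≤s : 1ℚ ≤ s
        1≤s = nat-mono {1} {∣ A ∣} 1≤∣A∣
        0≤y : 0ℚ ≤ y
        0≤y = 0≤-* (0≤-* 0≤β (0≤nat ∣ A ∣)) 0≤r
        2y≤1 : y * nat 2 ≤ 1ℚ
        2y≤1 = ≤-trans (*-monoˡ 0≤y 2≤H) yH≤1
        0≤1-y : 0ℚ ≤ 1ℚ - y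
        0≤1-y = ≤⇒0≤ {y} {1ℚ} (≤-trans (≤-by 0≤y (solve 1 (λ y → y :+ y := y :* con (nat 2)) refl y)) 2y≤1)
        -- The margin 2t + 6 is made for this: (H + 2t + 6)y ≤ 1 + (t + 3) by yH ≤ 1 and 2y ≤ 1,
        -- which leaves H + 2 + t.
        bracket : H + nat 2 + t ≤ r * T₁ * (1ℚ - y)
        bracket = ≤-trans
          (≤-by (0≤-+ (≤⇒0≤ yH≤1) (0≤-* (0≤-+ 0≤t (0≤nat 3)) (≤⇒0≤ 2y≤1)))
            (solve 3 (λ h t y → h :+ con (nat 2) :+ t :+
                ((con 1ℚ :- y :* h) :+ (t :+ con (nat 3)) :* (con 1ℚ :- y :* con (nat 2)))
               := (h :+ (con (nat 2) :* t :+ con (nat 6))) :* (con 1ℚ :- y)) refl H t y))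
          (*-monoʳ 0≤1-y H+ω≤rT₁)

      γ : ℚ
      γ = proj₁ (inverse (<-≤-trans (0<1) 1≤β))

      0≤γ : 0ℚ ≤ γ
      0≤γ = <⇒≤ (proj₁ (proj₂ (inverse (<-≤-trans (0<1) 1≤β))))

      βγ≡1 : β * γ ≡ 1ℚ
      βγ≡1 = proj₂ (proj₂ (inverse (<-≤-trans (0<1) 1≤β)))

      -- The pair bound provides the exponent ½γsH, where γ = 1/β and s = |A|. It is spent as sv =
      -- ¼γsH on the factors 1 + v = 1/w, as ⅛γsH on t, and as ⅛γsH on Nw.
      ¼ ⅛ v w : ℚ
      ¼ = ½ * ½
      ⅛ = ½ * ¼
      v = ¼ * (γ * H)

      0≤¼ : 0ℚ ≤ ¼
      0≤¼ = nonNegative⁻¹ ¼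

      0≤⅛ : 0ℚ ≤ ⅛
      0≤⅛ = nonNegative⁻¹ ⅛

      0≤v : 0ℚ ≤ v
      0≤v = 0≤-* 0≤¼ (0≤-* 0≤γ 0≤H)

      1≤1+v : 1ℚ ≤ 1ℚ + v
      1≤1+v = ≤-by 0≤v refl

      w = proj₁ (inverse (<-≤-trans (0<1) 1≤1+v))

      0≤w : 0ℚ ≤ w
      0≤w = <⇒≤ (proj₁ (proj₂ (inverse (<-≤-trans (0<1) 1≤1+v))))

      [1+v]w≡1 : (1ℚ + v) * w ≡ 1ℚ
      [1+v]w≡1 = proj₂ (proj₂ (inverse (<-≤-trans (0<1) 1≤1+v)))

      γβx≡x : ∀ x → γ * (β * x) ≡ x
      γβx≡x x = trans (solve 3 (λ g b x → g :* (b :* x) := (b :* g) :* x) refl γ β x)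
          (trans (cong (_* x) βγ≡1) (*-identityˡ x))

      -- H ≥ 32β³ gives v ≥ 8β², so 1/w = 1 + v ≥ 8β². Large sets satisfy N ≤ βsH, and the two
      -- together yield Nw ≤ ⅛γsH.
      w≤⅛γ² : w ≤ ⅛ * (γ * γ)
      w≤⅛γ² = begin
        w                                      ≡⟨ sym (trans (cong (_*_ γ) (γβx≡x (β * w))) (γβx≡x w)) ⟩
        γ * (γ * (β * (β * w)))
            ≡⟨ solve 3 (λ g b w → g :* (g :* (b :* (b :* w))) :=
            con ⅛ :* (g :* g) :* ((con (nat 8) :* (b :* b)) :* w)) refl γ β w ⟩
        ⅛ * (γ * γ) * (nat 8 * (β * β) * w)    ≤⟨ *-monoˡ (0≤-* 0≤⅛ (0≤-* 0≤γ 0≤γ)) (*-monoʳ 0≤w 8β²≤1+v) ⟩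
        ⅛ * (γ * γ) * ((1ℚ + v) * w)           ≡⟨ trans (cong (_*_ (⅛ * (γ * γ))) [1+v]w≡1) (*-identityʳ _) ⟩
        ⅛ * (γ * γ)                            ∎
        where
        8β²≤1+v : nat 8 * (β * β) ≤ 1ℚ + v
        8β²≤1+v = begin
          nat 8 * (β * β)                          ≡⟨ sym (γβx≡x (nat 8 * (β * β))) ⟩
          γ * (β * (nat 8 * (β * β)))
              ≡⟨ solve 2 (λ g b → g :* (b :* (con (nat 8) :* (b :* b))) :=
              con ¼ :* (g :* (con (nat 32) :* (b :* b :* b)))) refl γ β ⟩
          ¼ * (γ * (nat 32 * (β * β * β)))
              ≤⟨ *-monoˡ 0≤¼ (*-monoˡ 0≤γ (≤-trans (≤-by (0≤-* (0≤nat 8) (0≤-* 0≤β 0≤t)) refl) H-large)) ⟩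
          v                                        ≤⟨ ≤-by 0≤1 (+-comm v 1ℚ) ⟩
          1ℚ + v                                   ∎

      -- Origin of the summand 8βt in the lower bound demanded of H.
      t≤⅛γH : t ≤ ⅛ * (γ * H)
      t≤⅛γH = begin
        t                            ≡⟨ sym (γβx≡x t) ⟩
        γ * (β * t)                  ≡⟨ solve 3
            (λ g b t → g :* (b :* t) := con ⅛ :* (g :* (con (nat 8) :* (b :* t)))) refl γ β t ⟩
        ⅛ * (γ * (nat 8 * (β * t)))
          ≤⟨ *-monoˡ 0≤⅛ (*-monoˡ 0≤γ (≤-trans
              (≤-by (0≤-* (0≤nat 32) (0≤-* (0≤-* 0≤β 0≤β) 0≤β)) (+-comm (nat 8 * (β * t)) _)) H-large)) ⟩
        ⅛ * (γ * H)                  ∎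

      -- The pair bound is governed by T₀, whereas the gap concerns T₁; `T₁≤βT₀` translates between
      -- them at the price of a factor β.
      sH≤2βJ : ∀ A → Minor A → nat ∣ A ∣ * H ≤ nat 2 * β * Sum ks (J A)
      sH≤2βJ A minor = begin
        s * H                                      ≤⟨ *-monoˡ (0≤nat ∣ A ∣) H≤rT₁ ⟩
        s * (r * T₁)                               ≤⟨ *-monoˡ (0≤nat ∣ A ∣) (*-monoˡ 0≤r T₁≤βT₀) ⟩
        s * (r * (β * T₀))
            ≡⟨ solve 4 (λ s r b t → s :* (r :* (b :* t)) := (r :* b) :* (s :* t)) refl s r β T₀ ⟩
        r * β * (s * T₀)                           ≤⟨ *-monoˡ (0≤-* 0≤r 0≤β) (Sum-J-pairs A minor) ⟩
        r * β * (nat 2 * N * Sum ks (J A))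
            ≡⟨ solve 4 (λ r b N j → r :* b :* (con (nat 2) :* N :* j) := (N :* r) :* (con (nat 2) :* b :* j)) refl r
            β N (Sum ks (J A)) ⟩
        N * r * (nat 2 * β * Sum ks (J A))
            ≡⟨ trans (cong (_* (nat 2 * β * Sum ks (J A))) Nr≡1) (*-identityˡ _) ⟩
        nat 2 * β * Sum ks (J A)                   ∎
        where
        s : ℚ
        s = nat ∣ A ∣

      Nγ≤sH : ∀ s → 1ℚ ≤ β * s * r * H → N * γ ≤ s * H
      Nγ≤sH s 1≤yH = begin
        N * γ                                  ≡⟨ sym (*-identityʳ (N * γ)) ⟩
        N * γ * 1ℚ                             ≤⟨ *-monoˡ (0≤-* 0≤N 0≤γ) 1≤yH ⟩
        N * γ * (β * s * r * H)
            ≡⟨ solve 6 (λ N g b s r h → N :* g :* (b :* s :* r :* h) := (N :* r) :* (g :* (b :* (s :* h)))) refl N γ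
            β s r H ⟩
        N * r * (γ * (β * (s * H)))            ≡⟨ cong₂ _*_ Nr≡1 (γβx≡x (s * H)) ⟩
        1ℚ * (s * H)                           ≡⟨ *-identityˡ _ ⟩
        s * H                                  ∎

      Nw≤⅛γsH : ∀ s → 1ℚ ≤ β * s * r * H → N * w ≤ ⅛ * (γ * (s * H))
      Nw≤⅛γsH s 1≤yH = begin
        N * w                    ≤⟨ *-monoˡ 0≤N w≤⅛γ² ⟩
        N * (⅛ * (γ * γ))        ≡⟨ solve 2 (λ N g → N :* (con ⅛ :* (g :* g)) := con ⅛ :* (g :* (N :* g))) refl N γ ⟩
        ⅛ * (γ * (N * γ))        ≤⟨ *-monoˡ 0≤⅛ (*-monoˡ 0≤γ (Nγ≤sH s 1≤yH)) ⟩
        ⅛ * (γ * (s * H))        ∎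

      exponent≤ : ∀ s {X} → 1ℚ ≤ s → 1ℚ ≤ β * s * r * H → s * H ≤ nat 2 * β * X → t + N * w + s * v ≤ X
      exponent≤ s {X} 1≤s 1≤yH sH≤2βX = begin
        t + N * w + s * v                  ≤⟨ +-monoˡ-≤ (s * v) (+-mono-≤ t≤⅛γsH (Nw≤⅛γsH s 1≤yH)) ⟩
        ⅛ * (γ * (s * H)) + ⅛ * (γ * (s * H)) + s * v
          ≡⟨ solve 3 (λ g s h → con ⅛ :* (g :* (s :* h)) :+ con ⅛ :* (g :* (s :* h)) :+ s :* (con ¼ :* (g :* h)) :=
              con ½ :* (g :* (s :* h))) refl γ s H ⟩
        ½ * (γ * (s * H))                  ≤⟨ *-monoˡ (nonNegative⁻¹ ½) (*-monoˡ 0≤γ sH≤2βX) ⟩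
        ½ * (γ * (nat 2 * β * X))
            ≡⟨ solve 3 (λ g b j → con ½ :* (g :* (con (nat 2) :* b :* j)) := g :* (b :* j)) refl γ β X ⟩
        γ * (β * X)                        ≡⟨ γβx≡x X ⟩
        X                                  ∎
        where
        t≤⅛γsH : t ≤ ⅛ * (γ * (s * H))
        t≤⅛γsH = ≤-trans t≤⅛γH (*-monoˡ 0≤⅛ (*-monoˡ 0≤γ
          (≤-trans (≤-reflexive (sym (*-identityˡ H))) (*-monoʳ 0≤H 1≤s))))

      large : ∀ A → Minor A → 1ℚ ≤ β * nat ∣ A ∣ * r * H →
        (1ℚ + t) * (1ℚ + w) ^ (2 ℕ.+ n) * separation A ≤ w ^ ∣ A ∣
      large A minor 1≤yH =
        from-≼exp {1ℚ + t} {1ℚ + v} {w} A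
            (certificate {1ℚ + v} {w} {v} A (≤-trans 0≤1 1≤1+v) (1+-≼exp 0≤v) 0≤w) [1+v]w≡1 0≤w
          (exponent≤ (nat ∣ A ∣) (nat-mono {1} {∣ A ∣} (proj₁ minor)) 1≤yH (sH≤2βJ A minor))

      [1+t]*Pr-disconnected≤2 : (1ℚ + t) * Pr disconnected? ≤ nat 2
      [1+t]*Pr-disconnected≤2 = two-weights 0≤1+t 0≤r 0≤w (λ A minor →
        map-⊎ (small A minor) (large A minor) (≤-total (β * nat ∣ A ∣ * r * H) 1ℚ))

open Counting

module Approximation where

  open Defs using (ℝ; approx; cauchy; ∑; ∏; 0ℝ; 1ℝ; IsCauchy; Distribution; pmf; ProductDistribution; moment;
    ℙ-connected; subsetProbability; nCk-nonZero; subsets; tuples; connected?; fromℚ; log;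
    module HarmonicProperties; module CauchyProperties)
  open CauchyProperties using (bounded; ∣*∣-mono; ∣p∣≤∣p-q∣+∣q∣; ∣p∣≤r; ∣p-q∣≤r; halves; half-pos)
  open import Data.Integer.Base using (+_)
  open import Data.Rational.Base using (_≤_; _<_; _+_; _*_; _-_; -_; _⊔_; _/_) renaming (∣_∣ to abs)

  -- Bounded rational sequences with vanishing difference

  Ultimately : (ℕ → Set) → Set
  Ultimately P = ∃[ N ] (∀ i → N ℕ.≤ i → P i)

  always : ∀ {P : ℕ → Set} → (∀ i → P i) → Ultimately P
  always h = 0 , λ i _ → h i

  ultimately-map : ∀ {P Q : ℕ → Set} → (∀ i → P i → Q i) → Ultimately P → Ultimately Q
  ultimately-map f (N , h) = N , λ i N≤i → f i (h i N≤i)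

  infixr 2 _&_
  _&_ : ∀ {P Q : ℕ → Set} → Ultimately P → Ultimately Q → Ultimately (λ i → P i × Q i)
  (M , f) & (N , g) = M ℕ.⊔ N , λ i h → f i (ℕ.m⊔n≤o⇒m≤o M N h) , g i (ℕ.m⊔n≤o⇒n≤o M N h)

  Bounded : (ℕ → ℚ) → Set
  Bounded x = ∃[ B ] (0ℚ < B × Ultimately (λ i → abs (x i) ≤ B))

  Near : (ℕ → ℚ) → (ℕ → ℚ) → Set
  Near x y = ∀ ε → 0ℚ < ε → Ultimately (λ i → abs (x i - y i) ≤ ε)

  infix 4 _≋_
  -- Compares bare sequences, so that adjusted approximations are handled without being packaged as
  -- reals. Boundedness is carried along because products require it; it is recorded on the left,
  -- and `near` passes it to the right.
  record _≋_ (x y : ℕ → ℚ) : Set where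
    constructor ≋-intro
    field
      bounded-by : Bounded x
      near       : Near x y

  open _≋_ public

  ∣p∣≤∣q-p∣+∣q∣ : ∀ p q → abs p ≤ abs (q - p) + abs q
  ∣p∣≤∣q-p∣+∣q∣ p q = subst (λ z → abs p ≤ z + abs q)
    (trans (sym (∣-p∣≡∣p∣ (p - q))) (cong abs (solve 2 (λ p q → :- (p :- q) := q :- p) refl p q)))
    (∣p∣≤∣p-q∣+∣q∣ p q)

  bounded-right : ∀ {x y} → x ≋ y → Bounded y
  bounded-right {x} {y} (≋-intro (B , 0<B , hB) near) =
    1ℚ + B , +-mono-<-≤ 0<1 (<⇒≤ 0<B)
    , ultimately-map (λ i (b , d) → ≤-trans (∣p∣≤∣q-p∣+∣q∣ (y i) (x i)) (+-mono-≤ d b)) (hB & near 1ℚ 0<1)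

  ∣p-p∣≤ : ∀ {ε} p → 0ℚ < ε → abs (p - p) ≤ ε
  ∣p-p∣≤ p 0<ε = ≤-trans (≤-reflexive (cong abs (+-inverseʳ p))) (<⇒≤ 0<ε)

  bounded⇒≋-refl : ∀ {x} → Bounded x → x ≋ x
  bounded⇒≋-refl {x} b = ≋-intro b λ ε 0<ε → always (λ i → ∣p-p∣≤ (x i) 0<ε)

  const-≋ : ∀ q → (λ _ → q) ≋ (λ _ → q)
  const-≋ q = bounded⇒≋-refl (1ℚ + abs q , +-mono-<-≤ 0<1 (0≤∣p∣ q) , always (λ _ → ≤-by 0≤1 (+-comm (abs q) 1ℚ)))

  cauchy⇒≋-refl : ∀ {x} → IsCauchy x → x ≋ x
  cauchy⇒≋-refl c = bounded⇒≋-refl (bounded c)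

  ≋-trans : ∀ {x y z} → x ≋ y → y ≋ z → x ≋ z
  ≋-trans {x} {y} {z} (≋-intro bx nx) (≋-intro _ ny) = ≋-intro bx λ ε 0<ε →
    ultimately-map (λ i (p , q) → begin
      abs (x i - z i)
        ≡⟨ cong abs (solve 3 (λ x y z → x :- z := (x :- y) :+ (y :- z)) refl (x i) (y i) (z i)) ⟩
      abs ((x i - y i) + (y i - z i))          ≤⟨ ∣p+q∣≤∣p∣+∣q∣ (x i - y i) (y i - z i) ⟩
      abs (x i - y i) + abs (y i - z i)          ≤⟨ +-mono-≤ p q ⟩
      ½ * ε + ½ * ε                          ≡⟨ halves ε ⟩
      ε                                      ∎)
    (nx (½ * ε) (half-pos 0<ε) & ny (½ * ε) (half-pos 0<ε))
    where open ≤-Reasoning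

  ≋-resp : ∀ {x x′ y y′} → (∀ i → x i ≡ x′ i) → (∀ i → y i ≡ y′ i) → x ≋ y → x′ ≋ y′
  ≋-resp ex ey (≋-intro (B , 0<B , hB) nxy) = ≋-intro
    (B , 0<B , ultimately-map (λ i → subst (λ z → abs z ≤ B) (ex i)) hB)
    (λ ε 0<ε → ultimately-map (λ i → subst₂ (λ a b → abs (a - b) ≤ ε) (ex i) (ey i)) (nxy ε 0<ε))

  ≋-+ : ∀ {x x′ y y′} → x ≋ x′ → y ≋ y′ → (λ i → x i + y i) ≋ (λ i → x′ i + y′ i)
  ≋-+ {x} {x′} {y} {y′} (≋-intro (A , 0<A , hA) nx) (≋-intro (B , 0<B , hB) ny) = ≋-intro
    (A + B , +-mono-< 0<A 0<B , ultimately-map (λ i (a , b) → ≤-trans (∣p+q∣≤∣p∣+∣q∣ (x i) (y i)) (+-mono-≤ a b))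
        (hA & hB))
    (λ ε 0<ε → ultimately-map (λ i (p , q) → begin
      abs (x i + y i - (x′ i + y′ i))
        ≡⟨ cong abs (solve 4 (λ x y x′ y′ → x :+ y :- (x′ :+ y′) := (x :- x′) :+ (y :- y′)) refl (x i) (y i) (x′ i)
            (y′ i)) ⟩
      abs ((x i - x′ i) + (y i - y′ i))        ≤⟨ ∣p+q∣≤∣p∣+∣q∣ (x i - x′ i) (y i - y′ i) ⟩
      abs (x i - x′ i) + abs (y i - y′ i)        ≤⟨ +-mono-≤ p q ⟩
      ½ * ε + ½ * ε                          ≡⟨ halves ε ⟩
      ε                                      ∎)
     (nx (½ * ε) (half-pos 0<ε) & ny (½ * ε) (half-pos 0<ε)))
    where open ≤-Reasoning

  ≋-* : ∀ {x x′ y y′} → x ≋ x′ → y ≋ y′ → (λ i → x i * y i) ≋ (λ i → x′ i * y′ i)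
  ≋-* {x} {x′} {y} {y′} hx@(≋-intro (A , 0<A , hA) nx) hy@(≋-intro (B , 0<B , hB) ny) = ≋-intro
    (A * B , 0<-* 0<A 0<B , ultimately-map (λ i (a , b) → ∣*∣-mono {x i} {y i} 0<A a b) (hA & hB))
    λ ε 0<ε → near-* ε 0<ε
    where
    open ≤-Reasoning
    near-* : ∀ ε → 0ℚ < ε → Ultimately (λ i → abs (x i * y i - x′ i * y′ i) ≤ ε)
    near-* ε 0<ε =
      let B′ , 0<B′ , hB′ = bounded-right hy
          A⁻¹ , 0<A⁻¹ , AA⁻¹≡1 = inverse 0<A
          B⁻¹ , 0<B⁻¹ , BB⁻¹≡1 = inverse 0<B′
          α = A⁻¹ * (½ * ε)
          β = B⁻¹ * (½ * ε)
      in ultimately-map (λ i (a , b , p , q) → begin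
        abs (x i * y i - x′ i * y′ i)
          ≡⟨ cong abs (solve 4 (λ x y x′ y′ → x :* y :- x′ :* y′ := x :* (y :- y′) :+ y′ :* (x :- x′)) refl (x i)
              (y i) (x′ i) (y′ i)) ⟩
        abs (x i * (y i - y′ i) + y′ i * (x i - x′ i))
            ≤⟨ ∣p+q∣≤∣p∣+∣q∣ (x i * (y i - y′ i)) (y′ i * (x i - x′ i)) ⟩
        abs (x i * (y i - y′ i)) + abs (y′ i * (x i - x′ i))
            ≤⟨ +-mono-≤ (∣*∣-mono {x i} 0<A a p) (∣*∣-mono {y′ i} 0<B′ b q) ⟩
        A * α + B′ * β
          ≡⟨ cong₂ _+_ (trans (sym (*-assoc A A⁻¹ (½ * ε))) (cong (_* (½ * ε)) AA⁻¹≡1))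
                       (trans (sym (*-assoc B′ B⁻¹ (½ * ε))) (cong (_* (½ * ε)) BB⁻¹≡1)) ⟩
        1ℚ * (½ * ε) + 1ℚ * (½ * ε)                       ≡⟨ cong₂ _+_ (*-identityˡ (½ * ε)) (*-identityˡ (½ * ε)) ⟩
        ½ * ε + ½ * ε                                     ≡⟨ halves ε ⟩
        ε                                                 ∎)
      (hA & hB′ & ny α (0<-* 0<A⁻¹ (half-pos 0<ε)) & nx β (0<-* 0<B⁻¹ (half-pos 0<ε)))

  ≋-neg : ∀ {x y} → x ≋ y → (λ i → - x i) ≋ (λ i → - y i)
  ≋-neg {x} {y} h = ≋-resp (λ i → solve 1 (λ x → con (- 1ℚ) :* x := :- x) refl (x i))
    (λ i → solve 1 (λ x → con (- 1ℚ) :* x := :- x) refl (y i)) (≋-* (const-≋ (- 1ℚ)) h)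

  ≋-Sum : ∀ {A : Set} (as : List A) {x y : A → ℕ → ℚ} → (∀ a → x a ≋ y a) →
    (λ i → Sum as (λ a → x a i)) ≋ (λ i → Sum as (λ a → y a i))
  ≋-Sum []       h = const-≋ 0ℚ
  ≋-Sum (a ∷ as) h = ≋-+ (h a) (≋-Sum as h)

  ≋-Prod : ∀ {A : Set} (as : List A) {x y : A → ℕ → ℚ} → (∀ a → x a ≋ y a) →
    (λ i → Prod as (λ a → x a i)) ≋ (λ i → Prod as (λ a → y a i))
  ≋-Prod []       h = const-≋ 1ℚ
  ≋-Prod (a ∷ as) h = ≋-* (h a) (≋-Prod as h)

  approx-∑ : ∀ {A : Set} (as : List A) (f : A → ℝ) i → approx (∑ as f) i ≡ Sum as (λ a → approx (f a) i)
  approx-∑ []       f i = refl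
  approx-∑ (a ∷ as) f i = cong (_+_ (approx (f a) i)) (approx-∑ as f i)

  approx-∏ : ∀ {A : Set} (as : List A) (f : A → ℝ) i → approx (∏ as f) i ≡ Prod as (λ a → approx (f a) i)
  approx-∏ []       f i = refl
  approx-∏ (a ∷ as) f i = cong (_*_ (approx (f a) i)) (approx-∏ as f i)

  ≋-approx : ∀ (x : ℝ) → approx x ≋ approx x
  ≋-approx x = cauchy⇒≋-refl (cauchy x)

  ≃⇒≋ : ∀ {x y : ℝ} → x Defs.≃ y → approx x ≋ approx y
  ≃⇒≋ {x} {y} (x≤y , y≤x) = ≋-intro (bounded-by (≋-approx x)) λ ε 0<ε →
    ultimately-map (λ i (p , q) → ∣p-q∣≤r
        (≤-trans p (≤-reflexive (+-comm (approx y i) ε))) (≤-trans q (≤-reflexive (+-comm (approx x i) ε))))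
      (x≤y ε 0<ε & y≤x ε 0<ε)

  p≤∣p∣ : ∀ p → p ≤ abs p
  p≤∣p∣ p = [ (λ 0≤p → ≤-reflexive (sym (0≤p⇒∣p∣≡p 0≤p))) , (λ p≤0 → ≤-trans p≤0 (0≤∣p∣ p)) ]′ (≤-total 0ℚ p)

  ≋-sym : ∀ {x y} → x ≋ y → y ≋ x
  ≋-sym {x} {y} h = ≋-intro (bounded-right h) λ ε 0<ε → ultimately-map (λ i p → ≤-trans (≤-reflexive
    (trans (sym (∣-p∣≡∣p∣ (y i - x i))) (cong abs (solve 2 (λ x y → :- (y :- x) := x :- y) refl (x i) (y i))))) p)
        (near h ε 0<ε)

  -- Exact rational distributions near the given ones

  ⊔-0-near : ∀ x ε → 0ℚ ≤ ε → 0ℚ ≤ x + ε → abs (x - (0ℚ ⊔ x)) ≤ ε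
  ⊔-0-near x ε 0≤ε h = [ positive-case , negative-case ]′ (≤-total 0ℚ x)
    where
    positive-case : 0ℚ ≤ x → abs (x - (0ℚ ⊔ x)) ≤ ε
    positive-case 0≤x = subst (λ z → abs (x - z) ≤ ε) (sym (p≤q⇒p⊔q≡q 0≤x))
        (≤-trans (≤-reflexive (cong abs (+-inverseʳ x))) 0≤ε)
    negative-case : x ≤ 0ℚ → abs (x - (0ℚ ⊔ x)) ≤ ε
    negative-case x≤0 = subst (λ z → abs (x - z) ≤ ε) (sym (p≥q⇒p⊔q≡p x≤0))
      (∣p∣≤r (≤-trans (≤-reflexive (+-identityʳ x)) (≤-trans x≤0 0≤ε))
        (≤-by h (solve 2 (λ x e → :- (x :- con 0ℚ) :+ (x :+ e) := e) refl x ε)))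

  -- Replacing the i-th approximations a of a distribution by max(a, 0) · u, where u = max(2 - S, 0) and
  -- S = ∑ max(a, 0), and putting the missing mass 1 - S u ≥ (1 - S)² on the point 0, yields
  -- a rational distribution for every i, and the same limits, without a division.
  module Renormalised {n : ℕ} (f : Distribution n) where

    points : List (Fin (suc n))
    points = allFin (suc n)

    clipped : Fin (suc n) → ℕ → ℚ
    clipped x i = 0ℚ ⊔ approx (pmf f x) i

    S u : ℕ → ℚ
    S i = Sum points (λ x → clipped x i)
    u i = 0ℚ ⊔ (nat 2 - S i)

    atZero : Fin (suc n) → ℚ
    atZero zero    = 1ℚ
    atZero (suc _) = 0ℚ

    g : ℕ → Fin (suc n) → ℚ
    g i x = clipped x i * u i + atZero x * (1ℚ - S i * u i)

    Su≤1 : ∀ i → S i * u i ≤ 1ℚ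
    Su≤1 i = [ below , above ]′ (≤-total 0ℚ (nat 2 - S i))
      where
      below : 0ℚ ≤ nat 2 - S i → S i * u i ≤ 1ℚ
      below h = subst (λ z → S i * z ≤ 1ℚ) (sym (p≤q⇒p⊔q≡q h))
        (≤-by (0≤∣p∣² (1ℚ - S i)) (solve 1
            (λ s → s :* (con (nat 2) :- s) :+ (con 1ℚ :- s) :* (con 1ℚ :- s) := con 1ℚ) refl (S i)))
      above : nat 2 - S i ≤ 0ℚ → S i * u i ≤ 1ℚ
      above h = subst (λ z → S i * z ≤ 1ℚ) (sym (p≥q⇒p⊔q≡p h)) (≤-trans (≤-reflexive (*-zeroʳ (S i))) 0≤1)

    0≤atZero : ∀ x → 0ℚ ≤ atZero x
    0≤atZero zero    = 0≤1
    0≤atZero (suc _) = ≤-refl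

    0≤g : ∀ i x → 0ℚ ≤ g i x
    0≤g i x = 0≤-+ (0≤-* (p≤p⊔q 0ℚ (approx (pmf f x) i)) (p≤p⊔q 0ℚ (nat 2 - S i))) (0≤-* (0≤atZero x) (≤⇒0≤ (Su≤1 i)))

    Sum-g : ∀ i → Sum points (g i) ≡ 1ℚ
    Sum-g i = begin
      Sum points (g i)
          ≡⟨ trans (Sum-+ points (λ x → clipped x i * u i) (λ x → atZero x * (1ℚ - S i * u i)))
          (cong₂ _+_ (Sum-*ʳ points (u i) (λ x → clipped x i)) (Sum-*ʳ points (1ℚ - S i * u i) atZero)) ⟩
      S i * u i + Sum points atZero * (1ℚ - S i * u i)
        ≡⟨ cong (λ z → S i * u i + z * (1ℚ - S i * u i))
            (trans (Sum-suc atZero) (trans (cong (_+_ 1ℚ) (Sum-0 (allFin n))) (+-identityʳ 1ℚ))) ⟩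
      S i * u i + 1ℚ * (1ℚ - S i * u i)
          ≡⟨ solve 1 (λ y → y :+ con 1ℚ :* (con 1ℚ :- y) := con 1ℚ) refl (S i * u i) ⟩
      1ℚ ∎
      where open ≡-Reasoning

    ≋-clipped : ∀ x → approx (pmf f x) ≋ clipped x
    ≋-clipped x = ≋-intro (bounded-by (≋-approx (pmf f x))) λ ε 0<ε →
      ultimately-map (λ i h → ⊔-0-near (approx (pmf f x) i) ε (<⇒≤ 0<ε) h) (proj₁ (proj₂ f) x ε 0<ε)

    ≋-S : (λ _ → 1ℚ) ≋ S
    ≋-S = ≋-trans (≋-sym (≃⇒≋ {∑ points (pmf f)} {1ℝ} (proj₂ (proj₂ f))))
      (≋-resp (λ i → sym (approx-∑ points (pmf f) i)) (λ _ → refl) (≋-Sum points ≋-clipped))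

    ≋-u : (λ _ → 1ℚ) ≋ u
    ≋-u = ≋-trans 1≋2-S (≋-intro (bounded-right 1≋2-S) λ ε 0<ε →
        ultimately-map (λ i p → ⊔-0-near (nat 2 - S i) ε (<⇒≤ 0<ε)
            (≤-by (0≤-+ 0≤1 (≤⇒0≤ (≤-trans (p≤∣p∣ (1ℚ - (nat 2 - S i))) p)))
            (solve 2 (λ s e → con 0ℚ :+ (con 1ℚ :+ (e :- (con 1ℚ :- (con (nat 2) :- s)))) :=
                (con (nat 2) :- s) :+ e) refl (S i) ε)))
          (near 1≋2-S ε 0<ε))
      where
      1≋2-S : (λ _ → 1ℚ) ≋ (λ i → nat 2 - S i)
      1≋2-S = ≋-+ (const-≋ (nat 2)) (≋-neg ≋-S)

    ≋-g : ∀ x → approx (pmf f x) ≋ (λ i → g i x)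
    -- In the limit S and u become 1, so the correction at the point 0 vanishes and the formula
    -- returns the original value.
    ≋-g x = ≋-resp (λ i → solve 2 (λ a z → a :* con 1ℚ :+ z :* (con 1ℚ :- con 1ℚ :* con 1ℚ) := a) refl
        (approx (pmf f x) i) (atZero x)) (λ _ → refl)
      (≋-+ (≋-* (≋-clipped x) ≋-u) (≋-* (const-≋ (atZero x)) (≋-+ (const-≋ 1ℚ) (≋-neg (≋-* ≋-S ≋-u)))))

    -- The probability of one given set of size x, extended by 0 beyond n because `Laws` uses
    -- functions on all natural numbers.
    φ : ℕ → ℕ → ℚ
    φ i x with x ℕ.≤? n
    ... | yes x≤n = g i (fromℕ< (s≤s x≤n)) * 1/ℕ (n ℕ.C x) ⦃ nCk-nonZero x≤n ⦄
    ... | no  _   = 0ℚ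

    φ-≤ : ∀ i {x} (x≤n : x ℕ.≤ n) → φ i x ≡ g i (fromℕ< (s≤s x≤n)) * 1/ℕ (n ℕ.C x) ⦃ nCk-nonZero x≤n ⦄
    φ-≤ i {x} x≤n with x ℕ.≤? n
    ... | yes p   = cong (λ q → g i (fromℕ< (s≤s q)) * 1/ℕ (n ℕ.C x) ⦃ nCk-nonZero x≤n ⦄) (ℕ.≤-irrelevant p x≤n)
    ... | no  x≰n = contradiction x≤n x≰n

    0≤φ : ∀ i x → 0ℚ ≤ φ i x
    0≤φ i x with x ℕ.≤? n
    ... | yes x≤n = 0≤-* (0≤g i _) (0≤1/ (n ℕ.C x) ⦃ nCk-nonZero x≤n ⦄)
    ... | no  _   = ≤-refl

    binomial-φ : ∀ i (x : Fin (suc n)) → nat (n ℕ.C toℕ x) * φ i (toℕ x) ≡ g i x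
    binomial-φ i x = begin
      nat (n ℕ.C toℕ x) * φ i (toℕ x)           ≡⟨ cong (_*_ (nat (n ℕ.C toℕ x))) (φ-≤ i x≤n) ⟩
      nat (n ℕ.C toℕ x) * (g i y * c⁻¹)
          ≡⟨ solve 3 (λ c g r → c :* (g :* r) := g :* (c :* r)) refl (nat (n ℕ.C toℕ x)) (g i y) c⁻¹ ⟩
      g i y * (nat (n ℕ.C toℕ x) * c⁻¹)
          ≡⟨ cong₂ (λ a b → g i a * b) (Fin.fromℕ<-toℕ x (s≤s x≤n)) (nat*1/ (n ℕ.C toℕ x) ⦃ nCk-nonZero x≤n ⦄) ⟩
      g i x * 1ℚ                              ≡⟨ *-identityʳ (g i x) ⟩
      g i x                                   ∎
      where
      open ≡-Reasoning
      x≤n : toℕ x ℕ.≤ n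
      x≤n = ℕ.s≤s⁻¹ (Fin.toℕ<n x)
      y : Fin (suc n)
      y = fromℕ< (s≤s x≤n)
      c⁻¹ : ℚ
      c⁻¹ = 1/ℕ (n ℕ.C toℕ x) ⦃ nCk-nonZero x≤n ⦄

    -- The C(n, x) sets of size x share the mass that g puts on x equally.
    sizeSum-φ : ∀ i (w : ℕ → ℚ) → sizeSum n (λ x → w x * φ i x) ≡ Sum points (λ x → w (toℕ x) * g i x)
    sizeSum-φ i w = trans (sizeSum-binomial n (λ x → w x * φ i x))
      (trans (sym (rangeSum-allFin (suc n) (λ x → nat (n ℕ.C x) * (w x * φ i x))))
        (Sum-cong points (λ x → trans (solve 3 (λ c w f → c :* (w :* f) := w :* (c :* f)) refl (nat (n ℕ.C toℕ x))
            (w (toℕ x)) (φ i (toℕ x)))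
          (cong (_*_ (w (toℕ x))) (binomial-φ i x)))))

    mass-1 : ∀ i → sizeSum n (φ i) ≡ 1ℚ
    mass-1 i = trans (sizeSum-cong n (λ x → sym (*-identityˡ (φ i x))))
      (trans (sizeSum-φ i (λ _ → 1ℚ)) (trans (Sum-cong points (λ x → *-identityˡ (g i x))) (Sum-g i)))

    ≋-subsetProbability : ∀ A → approx (subsetProbability f A) ≋ (λ i → φ i Subset.∣ A ∣)
    ≋-subsetProbability A = ≋-resp (λ _ → refl) (λ i → sym (φ-≤ i (∣p∣≤n A)))
      (≋-* (≋-g (fromℕ< (s≤s (∣p∣≤n A)))) (const-≋ (1/ℕ (n ℕ.C Subset.∣ A ∣) ⦃ nCk-nonZero (∣p∣≤n A) ⦄)))

  ⟦2≤?⟧ : ∀ x → ⟦ 2 ℕ.≤? x ⟧ ≡ atLeastTwo x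
  ⟦2≤?⟧ x = ⟦⟧-value x (2 ℕ.≤? x)
    where
    ⟦⟧-value : ∀ x (d : Dec (2 ℕ.≤ x)) → ⟦ d ⟧ ≡ atLeastTwo x
    ⟦⟧-value 0 (yes ())
    ⟦⟧-value 0 (no _) = refl
    ⟦⟧-value 1 (yes (s≤s ()))
    ⟦⟧-value 1 (no _) = refl
    ⟦⟧-value (suc (suc x)) (yes _) = refl
    ⟦⟧-value (suc (suc x)) (no ¬p) = contradiction (s≤s (s≤s z≤n)) ¬p

  module Rationalised {n m : ℕ} (F : ProductDistribution n m) where

    module R (k : Fin m) = Renormalised (F k)

    laws : ℕ → Laws n m
    laws i = record { φ = λ k → R.φ k i ; 0≤φ = λ k → R.0≤φ k i ; mass-1 = λ k → R.mass-1 k i }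

    ≋-ℙ-connected : approx (ℙ-connected F) ≋ (λ i → Expectation.Pr (laws i) (connected? {n} {m}))
    ≋-ℙ-connected = ≋-resp (λ i → sym (approx-∑ Vs _ i)) (λ i → Expectation.Pr-filter (laws i) connected?)
      (≋-Sum Vs (λ V → ≋-resp (λ i → sym (approx-∏ (allFin m) _ i)) (λ _ → refl)
        (≋-Prod (allFin m) (λ k → R.≋-subsetProbability k (lookup V k)))))
      where
      Vs : List (Vec (Subset n) m)
      Vs = filter connected? (tuples (subsets n) m)

    momentSum : ℕ → ℕ → ℚ
    momentSum r i = Sum (allFin m) (λ k → Sum (filter (λ x → 2 ℕ.≤? toℕ x) (allFin (suc n))) (λ x →
      nat (toℕ x ℕ.^ r) * approx (pmf (F k) x) i))

    approx-moment : ∀ .⦃ _ : NonZero m ⦄ r i → approx (moment F r) i ≡ 1/ℕ m * momentSum r i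
    approx-moment r i = cong (_*_ (1/ℕ m)) (trans (approx-∑ (allFin m) _ i)
      (Sum-cong (allFin m) (λ k → approx-∑ (filter (λ x → 2 ℕ.≤? toℕ x) (allFin (suc n))) _ i)))

    -- The weight w is any expression equal to xʳ, so that T₀, T₁ and T₂ can be reached in the form
    -- in which the counting writes them.
    ≋-momentSum : ∀ r (w : ℕ → ℚ) → (∀ x → w x ≡ nat (x ℕ.^ r)) →
      momentSum r ≋ (λ i → Sum (allFin m) (λ k → sizeSum n (λ x → w x * (atLeastTwo x * R.φ k i x))))
    ≋-momentSum r w w≡ = ≋-Sum (allFin m) (λ k → ≋-resp
      (λ i → sym (Sum-filter (λ x → 2 ℕ.≤? toℕ x) (allFin (suc n))
          (λ x → nat (toℕ x ℕ.^ r) * approx (pmf (F k) x) i)))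
      (λ i → trans (Sum-cong (allFin (suc n)) (λ x → trans
          (cong₂ (λ a b → a * (b * R.g k i x)) (⟦2≤?⟧ (toℕ x)) (sym (w≡ (toℕ x))))
          (solve 3 (λ a b c → a :* (b :* c) := (b :* a) :* c) refl (atLeastTwo (toℕ x)) (w (toℕ x)) (R.g k i x))))
        (trans (sym (R.sizeSum-φ k i (λ x → w x * atLeastTwo x)))
          (sizeSum-cong n (λ x → *-assoc (w x) (atLeastTwo x) (R.φ k i x)))))
      (≋-Sum (allFin (suc n)) (λ x → ≋-* (const-≋ ⟦ 2 ℕ.≤? toℕ x ⟧) (≋-* (const-≋ (nat (toℕ x ℕ.^ r))) (R.≋-g k x)))))

  -- Growth of the logarithm

  archimedean : ∀ {X} → 0ℚ < X → ∃[ M ] X ≤ nat M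
  archimedean {X} 0<X =
    let Y , 0<Y , XY≡1 = inverse 0<X
        M , 1/M≤Y = HarmonicProperties.archimedes Y 0<Y
    in suc M , (begin
      X                                          ≡⟨ sym (trans (cong (X *_) (nat*1/ (suc M))) (*-identityʳ X)) ⟩
      X * (nat (suc M) * 1/ℕ (suc M))
          ≡⟨ solve 3 (λ x n r → x :* (n :* r) := n :* (x :* r)) refl X (nat (suc M)) (1/ℕ (suc M)) ⟩
      nat (suc M) * (X * 1/ℕ (suc M))            ≤⟨ *-monoˡ (0≤nat (suc M)) (*-monoˡ (<⇒≤ 0<X) 1/M≤Y) ⟩
      nat (suc M) * (X * Y)                      ≡⟨ trans (cong (nat (suc M) *_) XY≡1) (*-identityʳ _) ⟩
      nat (suc M)                                ∎)
    where open ≤-Reasoning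

  Prod-halves : ∀ k → nat (2 ℕ.^ k) * Prod (allFin k) (λ _ → 1ℚ - ½) ≡ 1ℚ
  Prod-halves zero    = refl
  Prod-halves (suc k) = begin
    nat (2 ℕ.* 2 ℕ.^ k) * Prod (allFin (suc k)) (λ _ → 1ℚ - ½)
      ≡⟨ cong₂ _*_ (nat-* 2 (2 ℕ.^ k)) (Prod-suc {k} (λ _ → 1ℚ - ½)) ⟩
    nat 2 * nat (2 ℕ.^ k) * ((1ℚ - ½) * P)
      ≡⟨ solve 2 (λ a p → con (nat 2) :* a :* (con (1ℚ - ½) :* p) := a :* p) refl (nat (2 ℕ.^ k)) P ⟩
    nat (2 ℕ.^ k) * P    ≡⟨ Prod-halves k ⟩
    1ℚ                   ∎
    where
    open ≡-Reasoning
    P = Prod (allFin k) (λ _ → 1ℚ - ½)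

  -- If log n + 1 ≤ k/2, then n · 2⁻ᵏ ≤ 1.
  log-lower-bound : ∀ {X} k → nat 2 * (X + 1ℚ) ≤ nat k → ∀ p i → 2 ℕ.^ k ℕ.≤ p → X ≤ logApprox p i
  log-lower-bound {X} k 2X+2≤k p i 2ᵏ≤p =
    [ id , (λ H≤X → contradiction refl (<⇒≢ (<-≤-trans n<1+n (too-small H≤X)))) ]′ (≤-total X (logApprox p i))
    where
    open ≤-Reasoning
    c P : ℚ
    c = nat (2 ℕ.^ k)
    P = Prod (allFin k) (λ _ → 1ℚ - ½)
    n<1+n : c < 1ℚ + c
    n<1+n = subst (_< 1ℚ + c) (+-identityˡ c) (+-monoˡ-< c 0<1)
    0≤½ : 0ℚ ≤ ½
    0≤½ = nonNegative⁻¹ ½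
    H+1≤½k : logApprox p i ≤ X → logApprox p i + 1ℚ ≤ Sum (allFin k) (λ _ → ½)
    H+1≤½k H≤X = begin
      logApprox p i + 1ℚ        ≤⟨ +-monoˡ-≤ 1ℚ H≤X ⟩
      X + 1ℚ                    ≡⟨ solve 1 (λ x → x := con (nat 2) :* x :* con ½) refl (X + 1ℚ) ⟩
      nat 2 * (X + 1ℚ) * ½      ≤⟨ *-monoʳ 0≤½ 2X+2≤k ⟩
      nat k * ½                 ≡⟨ sym (Sum-const k ½) ⟩
      Sum (allFin k) (λ _ → ½)  ∎
    nP≤1 : logApprox p i ≤ X → nat (suc p) * P ≤ 1ℚ
    nP≤1 H≤X = ≼exp-bound-family (n≼exp-log p i) (allFin k) (λ _ → ½) (λ _ → 0≤½ , ≤-by {½} {1ℚ} {½} 0≤½ refl)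
        (H+1≤½k H≤X)
    too-small : logApprox p i ≤ X → 1ℚ + c ≤ c
    too-small H≤X = begin
      1ℚ + c                  ≡⟨ sym (nat-suc (2 ℕ.^ k)) ⟩
      nat (suc (2 ℕ.^ k))     ≤⟨ nat-mono (s≤s 2ᵏ≤p) ⟩
      nat (suc p)             ≡⟨ sym (*-identityʳ (nat (suc p))) ⟩
      nat (suc p) * 1ℚ        ≡⟨ cong (nat (suc p) *_) (sym (Prod-halves k)) ⟩
      nat (suc p) * (c * P)   ≡⟨ solve 3 (λ a b c → a :* (b :* c) := b :* (a :* c)) refl (nat (suc p)) c P ⟩
      c * (nat (suc p) * P)   ≤⟨ *-monoˡ (0≤nat (2 ℕ.^ k)) (nP≤1 H≤X) ⟩
      c * 1ℚ                  ≡⟨ *-identityʳ c ⟩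
      c                       ∎

  -- M is independent of the index i: the dense estimate is applied at many indices, with one common
  -- lower bound for all approximations to log n.
  log-unbounded : ∀ {X} → 0ℚ < X → ∃[ M ] (∀ p i → M ℕ.≤ p → X ≤ logApprox p i)
  log-unbounded {X} 0<X =
    let k , 2X+2≤k = archimedean (0<-* (0<nat 1) (+-mono-<-≤ 0<X 0≤1))
    in 2 ℕ.^ k , log-lower-bound k 2X+2≤k

  /-nat : ∀ m d → + m / suc d ≡ nat m * 1/ℕ (suc d)
  /-nat zero    d = trans (0/n≡0 (suc d)) (sym (*-zeroˡ (1/ℕ (suc d))))
  /-nat (suc m) d = begin
    + suc m / suc d                        ≡⟨ HarmonicProperties./-suc m d ⟩
    + m / suc d + 1/ℕ (suc d)              ≡⟨ cong (_+ 1/ℕ (suc d)) (/-nat m d) ⟩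
    nat m * 1/ℕ (suc d) + 1/ℕ (suc d)
        ≡⟨ solve 2 (λ m r → m :* r :+ r := (con 1ℚ :+ m) :* r) refl (nat m) (1/ℕ (suc d)) ⟩
    (1ℚ + nat m) * 1/ℕ (suc d)             ≡⟨ cong (_* 1/ℕ (suc d)) (sym (nat-suc m)) ⟩
    nat (suc m) * 1/ℕ (suc d)              ∎
    where open ≡-Reasoning

  -- Passing between real inequalities and rational ones

  near⇒≤ : ∀ p q {ε} → abs (p - q) ≤ ε → p ≤ q + ε
  near⇒≤ p q {ε} h = ≤-by (≤⇒0≤ (≤-trans (p≤∣p∣ (p - q)) h))
      (solve 3 (λ p q e → p :+ (e :- (p :- q)) := q :+ e) refl p q ε)

  near⇒≥ : ∀ p q {ε} → abs (p - q) ≤ ε → q ≤ p + ε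
  near⇒≥ p q {ε} h = near⇒≤ q p (≤-trans (≤-reflexive (trans (sym (∣-p∣≡∣p∣ (q - p)))
    (cong abs (solve 2 (λ p q → :- (q :- p) := p :- q) refl p q)))) h)

  -- The margin stored in `_<_` pays for the distance between the approximations of x and the
  -- sequence y.
  const<⇒ultimately : ∀ {K y} (x : ℝ) → fromℚ K Defs.< x → approx x ≋ y → Ultimately (λ i → K ≤ y i)
  const<⇒ultimately {K} {y} x (ε , 0<ε , h) x≋y = ultimately-map
    (λ i (p , q) → ≤-by (≤⇒0≤ (≤-trans p (near⇒≤ (approx x i) (y i) q)))
        (solve 3 (λ k e y → k :+ (y :+ e :- (k :+ e)) := y) refl K ε (y i)))
    (h & near x≋y ε 0<ε)

  <const⇒ultimately : ∀ {K y} (x : ℝ) → x Defs.< fromℚ K → approx x ≋ y → Ultimately (λ i → y i ≤ K)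
  <const⇒ultimately {K} {y} x (ε , 0<ε , h) x≋y =
      ultimately-map (λ i (p , q) → ≤-trans (near⇒≥ (approx x i) (y i) q) p) (h & near x≋y ε 0<ε)

  -- `_<_` demands a rational margin, for which ½δ is reserved. The other half is split equally
  -- between the distance of x from y and that of y from c; hence the tolerance `½ * (½ * δ)` in the
  -- later estimates.
  close : ∀ {y : ℕ → ℚ} (x : ℝ) c (ε : ℝ) {δ} → approx x ≋ y → 0ℚ < δ → Ultimately (λ i → 0ℚ + δ ≤ approx ε i) →
    Ultimately (λ i → abs (y i - c) ≤ ½ * (½ * δ)) → Defs.∣ x Defs.- fromℚ c ∣ Defs.< ε
  close {y} x c ε {δ} x≋y 0<δ δ≤ε h = ½ * δ , half-pos 0<δ , ultimately-map (λ i (p , q , r) → begin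
      abs (approx x i - c) + ½ * δ
        ≡⟨ cong (λ z → abs z + ½ * δ) (solve 3 (λ x y c → x :- c := (x :- y) :+ (y :- c)) refl (approx x i) (y i) c) ⟩
      abs ((approx x i - y i) + (y i - c)) + ½ * δ
          ≤⟨ +-monoˡ-≤ (½ * δ) (≤-trans (∣p+q∣≤∣p∣+∣q∣ (approx x i - y i) (y i - c)) (+-mono-≤ q r)) ⟩
      ½ * (½ * δ) + ½ * (½ * δ) + ½ * δ
          ≡⟨ solve 1 (λ d → con ½ :* (con ½ :* d) :+ con ½ :* (con ½ :* d) :+ con ½ :* d := con 0ℚ :+ d) refl δ ⟩
      0ℚ + δ                                                    ≤⟨ p ⟩
      approx ε i                                                ∎)
    (δ≤ε & near x≋y (½ * (½ * δ)) (half-pos (half-pos 0<δ)) & h)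
    where open ≤-Reasoning

  -- Both estimates for a fixed number of nodes

  module FixedSize (n m : ℕ) ⦃ m≢0 : NonZero m ⦄ (F : ProductDistribution (2 ℕ.+ n) m) where

    open Rationalised F

    T₀ T₁ T₂ : ℕ → ℚ
    T₀ i = Model.T₀ (laws i)
    T₁ i = Model.T₁ (laws i)
    T₂ i = Model.T₂ (laws i)

    Pr : ℕ → ℚ
    Pr i = Expectation.Pr (laws i) (connected? {2 ℕ.+ n} {m})

    r : ℚ
    r = proj₁ (inverse (0<nat (suc n)))

    ≋-T₀ : momentSum 0 ≋ T₀
    ≋-T₀ = ≋-resp (λ _ → refl) (λ i →
        Sum-cong (allFin m) (λ k → sizeSum-cong (2 ℕ.+ n) (λ x → *-identityˡ (atLeastTwo x * R.φ k i x))))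
      (≋-momentSum 0 (λ _ → 1ℚ) (λ _ → refl))

    ≋-T₁ : momentSum 1 ≋ T₁
    ≋-T₁ = ≋-momentSum 1 nat (λ x → cong nat (sym (ℕ.*-identityʳ x)))

    ≋-T₂ : momentSum 2 ≋ T₂
    ≋-T₂ = ≋-resp (λ _ → refl) (λ i →
        Sum-cong (allFin m) (λ k → sizeSum-cong (2 ℕ.+ n) (λ x → *-assoc (nat x) (nat x) (atLeastTwo x * R.φ k i x))))
      (≋-momentSum 2 (λ x → nat x * nat x)
          (λ x → trans (sym (nat-* x x)) (cong (λ y → nat (x ℕ.* y)) (sym (ℕ.*-identityʳ x)))))

    logGap : ℝ
    logGap = log (2 ℕ.+ n) Defs.- fromℚ (+ m / (2 ℕ.+ n)) Defs.* moment F 1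

    1/N≡r : 1/ℕ (2 ℕ.+ n) ≡ r
    1/N≡r = begin
      1/N               ≡⟨ sym (*-identityʳ 1/N) ⟩
      1/N * 1ℚ          ≡⟨ cong (1/N *_) (sym (proj₂ (proj₂ (inverse (0<nat (suc n)))))) ⟩
      1/N * (N * r)     ≡⟨ solve 3 (λ a b c → a :* (b :* c) := (b :* a) :* c) refl 1/N N r ⟩
      N * 1/N * r       ≡⟨ trans (cong (_* r) (nat*1/ (2 ℕ.+ n))) (*-identityˡ r) ⟩
      r                 ∎
      where
      open ≡-Reasoning
      1/N = 1/ℕ (2 ℕ.+ n)
      N = nat (2 ℕ.+ n)

    rescale : ∀ A → (+ m / (2 ℕ.+ n)) * (1/ℕ m * A) ≡ r * A
    rescale A = begin
      (+ m / (2 ℕ.+ n)) * (1/ℕ m * A)        ≡⟨ cong (_* (1/ℕ m * A)) (/-nat m (suc n)) ⟩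
      nat m * 1/ℕ (2 ℕ.+ n) * (1/ℕ m * A)
        ≡⟨ solve 4 (λ m r s a → m :* r :* (s :* a) := (m :* s) :* (r :* a)) refl (nat m) (1/ℕ (2 ℕ.+ n)) (1/ℕ m) A ⟩
      nat m * 1/ℕ m * (1/ℕ (2 ℕ.+ n) * A)    ≡⟨ cong₂ (λ a b → a * (b * A)) (nat*1/ m) 1/N≡r ⟩
      1ℚ * (r * A)                           ≡⟨ *-identityˡ (r * A) ⟩
      r * A                                  ∎
      where open ≡-Reasoning

    ≋-logGap : approx logGap ≋ (λ i → logApprox (suc n) i - r * T₁ i)
    ≋-logGap = ≋-+ (≋-approx (log (2 ℕ.+ n))) (≋-neg (≋-resp
      (λ i → trans (sym (rescale (momentSum 1 i))) (cong ((+ m / (2 ℕ.+ n)) *_) (sym (approx-moment 1 i))))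
          (λ _ → refl)
      (≋-* (const-≋ r) ≋-T₁)))

    -- Three quarters of the slack 1 are spent: the tolerance ¼/m of the moment inequality becomes ¼
    -- after multiplication by m, the error of T₂ is ¼, and the error β/4 of T₀, with β = 1/b,
    -- becomes ¼ after multiplication by b.
    second-moment : ∀ C b → 1ℚ ≤ b → Ultimately (λ i → abs (approx C i) ≤ b) →
      moment F 2 Defs.≤ C Defs.* Defs.∣ moment F 0 ∣ → Ultimately (λ i → T₂ i ≤ b * T₀ i + 1ℚ)
    second-moment C b 1≤b C≤b h =
      ultimately-map bound (C≤b & h (¼ * 1/ℕ m) (0<-* 0<¼ 0<1/m) & near ≋-T₂ ¼ 0<¼ & near ≋-T₀ (β * ¼) (0<-* 0<β 0<¼))
      where
      open ≤-Reasoning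
      ¼ = ½ * ½
      0<¼ : 0ℚ < ¼
      0<¼ = positive⁻¹ ¼
      0≤b : 0ℚ ≤ b
      0≤b = ≤-trans 0≤1 1≤b
      b⁻¹ = inverse (<-≤-trans 0<1 1≤b)
      β = proj₁ b⁻¹
      0<β : 0ℚ < β
      0<β = proj₁ (proj₂ b⁻¹)
      0<1/m : 0ℚ < 1/ℕ m
      0<1/m = positive⁻¹ (1/ℕ m) ⦃ normalize-pos 1 m ⦄
      m*[1/m*_] : ∀ A → nat m * (1/ℕ m * A) ≡ A
      m*[1/m* A ] = trans (sym (*-assoc (nat m) (1/ℕ m) A)) (trans (cong (_* A) (nat*1/ m)) (*-identityˡ A))
      abs-moment : ∀ i → abs (approx (moment F 0) i) ≡ 1/ℕ m * abs (momentSum 0 i)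
      abs-moment i = trans (cong abs (approx-moment 0 i)) (trans (∣p*q∣≡∣p∣*∣q∣ (1/ℕ m) (momentSum 0 i))
        (cong (_* abs (momentSum 0 i)) (0≤p⇒∣p∣≡p (0≤1/ m))))
      bound : ∀ i → abs (approx C i) ≤ b ×
        approx (moment F 2) i ≤ approx C i * abs (approx (moment F 0) i) + ¼ * 1/ℕ m ×
        abs (momentSum 2 i - T₂ i) ≤ ¼ × abs (momentSum 0 i - T₀ i) ≤ β * ¼ → T₂ i ≤ b * T₀ i + 1ℚ
      bound i (C≤b , h , d₂ , d₀) = begin
        T₂ i                                                  ≤⟨ near⇒≥ A₂ (T₂ i) d₂ ⟩
        A₂ + ¼                                                ≡⟨ cong (_+ ¼) (sym m*[1/m* A₂ ]) ⟩
        nat m * (1/ℕ m * A₂) + ¼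
            ≡⟨ cong (λ z → nat m * z + ¼) (sym (approx-moment 2 i)) ⟩
        nat m * approx (moment F 2) i + ¼                     ≤⟨ +-monoˡ-≤ ¼ (*-monoˡ (0≤nat m) h) ⟩
        nat m * (c * abs (approx (moment F 0) i) + ¼ * 1/ℕ m) + ¼
          ≡⟨ cong (λ z → nat m * (c * z + ¼ * 1/ℕ m) + ¼) (abs-moment i) ⟩
        nat m * (c * (1/ℕ m * a₀) + ¼ * 1/ℕ m) + ¼
          ≡⟨ solve 4 (λ m c r a → m :* (c :* (r :* a) :+ con ¼ :* r) :+ con ¼ :=
              c :* (m :* (r :* a)) :+ con ¼ :* (m :* (r :* con 1ℚ)) :+ con ¼) refl (nat m) c (1/ℕ m) a₀ ⟩
        c * (nat m * (1/ℕ m * a₀)) + ¼ * (nat m * (1/ℕ m * 1ℚ)) + ¼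
          ≡⟨ cong₂ (λ x y → c * x + ¼ * y + ¼) m*[1/m* a₀ ] m*[1/m* 1ℚ ] ⟩
        c * a₀ + ¼ * 1ℚ + ¼
            ≤⟨ +-monoˡ-≤ ¼ (+-monoˡ-≤ (¼ * 1ℚ) (*-monoʳ (0≤∣p∣ A₀) (≤-trans (p≤∣p∣ c) C≤b))) ⟩
        b * a₀ + ¼ * 1ℚ + ¼                                   ≤⟨ +-monoˡ-≤ ¼ (+-monoˡ-≤ (¼ * 1ℚ) (*-monoˡ 0≤b a₀≤)) ⟩
        b * (T₀ i + β * ¼) + ¼ * 1ℚ + ¼
          ≡⟨ solve 3 (λ b β t → b :* (t :+ β :* con ¼) :+ con ¼ :* con 1ℚ :+ con ¼ :=
              b :* t :+ ((b :* β) :* con ¼ :+ con ½)) refl b β (T₀ i) ⟩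
        b * T₀ i + (b * β * ¼ + ½)
            ≡⟨ cong (λ z → b * T₀ i + (z * ¼ + ½)) (proj₂ (proj₂ b⁻¹)) ⟩
        b * T₀ i + (1ℚ * ¼ + ½)
            ≤⟨ +-monoʳ-≤ (b * T₀ i) (≤-by {1ℚ * ¼ + ½} {1ℚ} {¼} (<⇒≤ 0<¼) refl) ⟩
        b * T₀ i + 1ℚ                                         ∎
        where
        c = approx C i
        A₂ = momentSum 2 i
        A₀ = momentSum 0 i
        a₀ = abs A₀
        0≤T₀ : 0ℚ ≤ T₀ i
        0≤T₀ = Model.0≤T₀ (laws i)
        a₀≤ : a₀ ≤ T₀ i + β * ¼
        a₀≤ = ∣p∣≤r (near⇒≤ A₀ (T₀ i) d₀) (≤-trans (≤-by (0≤-+ 0≤T₀ (≤⇒0≤ {T₀ i} {A₀ + β * ¼} (near⇒≥ A₀ (T₀ i) d₀)))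
            (solve 3 (λ a t e → :- a :+ (t :+ (a :+ e :- t)) := e) refl A₀ (T₀ i) (β * ¼)))
                (≤-by 0≤T₀ (+-comm (β * ¼) (T₀ i))))

    sparse : ∀ b K {δ} ε → 1ℚ ≤ b → nat 64 * b ≤ K → nat 64 * b + 1ℚ ≤ K * (½ * (½ * δ)) →
      0ℚ < δ → Ultimately (λ i → 0ℚ + δ ≤ approx ε i) →
      Ultimately (λ i → T₂ i ≤ b * T₀ i + 1ℚ) → fromℚ K Defs.< logGap → Defs.∣ ℙ-connected F Defs.- 0ℝ ∣ Defs.< ε
    sparse b K {δ} ε 1≤b 64b≤K Kδ 0<δ δ≤ε second gap = close (ℙ-connected F) 0ℚ ε ≋-ℙ-connected 0<δ δ≤ε
      (ultimately-map (λ i (T₂≤ , K≤) → ∣Pr-0∣≤ i (Model.Sparse.K*Pr-connected≤ (laws i) b K i 1≤b 64b≤K T₂≤ K≤))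
        (second & const<⇒ultimately logGap gap ≋-logGap))
      where
      0<K : 0ℚ < K
      0<K = <-≤-trans 0<1 (≤-trans (≤-trans 1≤b
          (≤-by (0≤-* (0≤nat 63) (≤-trans 0≤1 1≤b))
          (solve 1 (λ b → b :+ con (nat 63) :* b := con (nat 64) :* b) refl b))) 64b≤K)
      ∣Pr-0∣≤ : ∀ i → K * Pr i ≤ nat 64 * b + 1ℚ → abs (Pr i - 0ℚ) ≤ ½ * (½ * δ)
      ∣Pr-0∣≤ i h = ≤-trans (≤-reflexive
          (trans (cong abs (+-identityʳ (Pr i))) (0≤p⇒∣p∣≡p (Expectation.0≤Pr (laws i) connected?))))
        (*-cancelˡ 0<K (≤-trans h Kδ))

    dense : ∀ b t {δ} ε → 0ℚ ≤ b → 0ℚ ≤ t → nat 2 ≤ (1ℚ + t) * (½ * (½ * δ)) →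
      (∀ i → nat 2 + (nat 32 * ((b + 1ℚ) * (b + 1ℚ) * (b + 1ℚ)) + nat 8 * ((b + 1ℚ) * t)) ≤ logApprox (suc n) i) →
      0ℚ < δ → Ultimately (λ i → 0ℚ + δ ≤ approx ε i) →
      Ultimately (λ i → T₂ i ≤ b * T₀ i + 1ℚ) → logGap Defs.< fromℚ (- (nat 2 * t + nat 6)) →
          Defs.∣ ℙ-connected F Defs.- 1ℝ ∣ Defs.< ε
    dense b t {δ} ε 0≤b 0≤t 2≤tδ H-large 0<δ δ≤ε second gap = close (ℙ-connected F) 1ℚ ε ≋-ℙ-connected 0<δ δ≤ε
      (ultimately-map (λ i (T₂≤ , gap≤) →
          ∣Pr-1∣≤ i (Disconnection.Dense.[1+t]*Pr-disconnected≤2 (laws i) b t i 0≤b 0≤t T₂≤ (H+ω≤rT₁ i gap≤)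
          (≤-trans (≤-by 0≤Y refl) (H-large i)) (≤-trans (≤-by (0≤nat 2) (+-comm Y (nat 2))) (H-large i))))
        (second & <const⇒ultimately logGap gap ≋-logGap))
      where
      Y = nat 32 * ((b + 1ℚ) * (b + 1ℚ) * (b + 1ℚ)) + nat 8 * ((b + 1ℚ) * t)
      0≤b+1 : 0ℚ ≤ b + 1ℚ
      0≤b+1 = 0≤-+ 0≤b 0≤1
      0≤Y : 0ℚ ≤ Y
      0≤Y = 0≤-+ (0≤-* (0≤nat 32) (0≤-* (0≤-* 0≤b+1 0≤b+1) 0≤b+1)) (0≤-* (0≤nat 8) (0≤-* 0≤b+1 0≤t))
      H+ω≤rT₁ : ∀ i → logApprox (suc n) i - r * T₁ i ≤ - (nat 2 * t + nat 6) →
          logApprox (suc n) i + (nat 2 * t + nat 6) ≤ r * T₁ i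
      H+ω≤rT₁ i h = ≤-by (≤⇒0≤ h) (solve 3 (λ h w t → h :+ w :+ (:- w :- (h :- t)) := t) refl (logApprox (suc n) i)
          (nat 2 * t + nat 6) (r * T₁ i))
      Pr-disc : ℕ → ℚ
      Pr-disc i = Expectation.Pr (laws i) (Disconnection.disconnected? (laws i))
      ∣Pr-1∣≤ : ∀ i → (1ℚ + t) * Pr-disc i ≤ nat 2 → abs (Pr i - 1ℚ) ≤ ½ * (½ * δ)
      ∣Pr-1∣≤ i h = ≤-trans (≤-reflexive
          (trans (cong (λ z → abs (Pr i - z)) (sym (Disconnection.Pr-complement (laws i))))
          (trans (cong abs (solve 2 (λ p q → p :- (p :+ q) := :- q) refl (Pr i) (Pr-disc i)))
              (trans (∣-p∣≡∣p∣ (Pr-disc i))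
            (0≤p⇒∣p∣≡p (Expectation.0≤Pr (laws i) (Disconnection.disconnected? (laws i))))))))
        (*-cancelˡ (<-≤-trans 0<1 (≤-by 0≤t refl)) (≤-trans h 2≤tδ))

  -- Stated for a variable n so that matching replaces it by 2 + n everywhere, including the type of
  -- F.
  sparse-threshold : ∀ {n m} .⦃ _ : NonZero n ⦄ ⦃ _ : NonZero m ⦄ (F : ProductDistribution n m) C ε b K {δ} →
      2 ℕ.≤ n →
    1ℚ ≤ b → nat 64 * b ≤ K → nat 64 * b + 1ℚ ≤ K * (½ * (½ * δ)) → 0ℚ < δ → Ultimately (λ i → 0ℚ + δ ≤ approx ε i) →
    Ultimately (λ i → abs (approx C i) ≤ b) → moment F 2 Defs.≤ C Defs.* Defs.∣ moment F 0 ∣ →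
    fromℚ K Defs.< log n Defs.- fromℚ (+ m / n) Defs.* moment F 1 → Defs.∣ ℙ-connected F Defs.- 0ℝ ∣ Defs.< ε
  sparse-threshold {1} F C ε b K (s≤s ())
  sparse-threshold {suc (suc n)} {m} F C ε b K _ 1≤b 64b≤K Kδ 0<δ δ≤ε C≤b moments gap =
    FixedSize.sparse n m F b K ε 1≤b 64b≤K Kδ 0<δ δ≤ε (FixedSize.second-moment n m F C b 1≤b C≤b moments) gap

  dense-threshold : ∀ {n m} .⦃ _ : NonZero n ⦄ ⦃ _ : NonZero m ⦄ (F : ProductDistribution n m) C ε b t {δ} → 2 ℕ.≤ n →
    1ℚ ≤ b → 0ℚ ≤ t → nat 2 ≤ (1ℚ + t) * (½ * (½ * δ)) →
    (∀ i → nat 2 + (nat 32 * ((b + 1ℚ) * (b + 1ℚ) * (b + 1ℚ)) + nat 8 * ((b + 1ℚ) * t)) ≤ logApprox (ℕ.pred n) i) →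
    0ℚ < δ → Ultimately (λ i → 0ℚ + δ ≤ approx ε i) →
    Ultimately (λ i → abs (approx C i) ≤ b) → moment F 2 Defs.≤ C Defs.* Defs.∣ moment F 0 ∣ →
    log n Defs.- fromℚ (+ m / n) Defs.* moment F 1 Defs.< fromℚ (- (nat 2 * t + nat 6)) →
        Defs.∣ ℙ-connected F Defs.- 1ℝ ∣ Defs.< ε
  dense-threshold {1} F C ε b t (s≤s ())
  dense-threshold {suc (suc n)} {m} F C ε b t _ 1≤b 0≤t 2≤tδ H-large 0<δ δ≤ε C≤b moments gap =
    FixedSize.dense n m F b t ε (≤-trans 0≤1 1≤b) 0≤t 2≤tδ H-large 0<δ δ≤ε
        (FixedSize.second-moment n m F C b 1≤b C≤b moments) gap

open Approximation

open import Defs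
open import Data.Integer using (+_)
open import Data.Rational using (_/_)

-- Choice of the constants and conclusion

≤-⊔₃ : ∀ a b c {n} → a ℕ.⊔ b ℕ.⊔ c ℕ.≤ n → a ℕ.≤ n × b ℕ.≤ n × c ℕ.≤ n
≤-⊔₃ a b c h =
  let ab = ℕ.m⊔n≤o⇒m≤o (a ℕ.⊔ b) c h
  in ℕ.m⊔n≤o⇒m≤o a b ab , ℕ.m⊔n≤o⇒n≤o a b ab , ℕ.m⊔n≤o⇒n≤o (a ℕ.⊔ b) c h

module Threshold
  (m : (n : ℕ) → .⦃ NonZero n ⦄ → ℕ)
  ⦃ m≥1 : ∀ {n} → .⦃ _ : NonZero n ⦄ → NonZero (m n) ⦄
  (F : (n : ℕ) → .⦃ _ : NonZero n ⦄ → ProductDistribution n (m n))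
  (C : ℝ) {δ : ℚ} (ε : ℝ) (0<δ : 0ℚ ℚ.< δ) (δ≤ε : Ultimately (λ i → 0ℚ ℚ.+ δ ℚ.≤ approx ε i)) where

  open +-*-Solver

  B = CauchyProperties.bounded {approx C} (cauchy C)

  -- With κ = 4/δ, the sparse bound Pr ≤ (64b + 1)/K and the dense bound 1 - Pr ≤ 2/(1 + t) both
  -- have to be at most δ/4; this leads to K = (64b + 1)(1 + κ), which also exceeds 64b, and to t =
  -- 2κ. `-ω` is the level that the gap has to undercut and `Y` the size that log n has to reach.
  -- Adding 1 to the bound of C ensures b ≥ 1.
  b ¼δ κ a K t -ω Y : ℚ
  b = proj₁ B ℚ.+ 1ℚ
  ¼δ = ½ ℚ.* (½ ℚ.* δ)

  0≤B : 0ℚ ℚ.≤ proj₁ B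
  0≤B = <⇒≤ (proj₁ (proj₂ B))

  1≤b : 1ℚ ℚ.≤ b
  1≤b = ≤-by 0≤B (+-comm 1ℚ (proj₁ B))

  C≤b : Ultimately (λ i → ℚ.∣ approx C i ∣ ℚ.≤ b)
  C≤b = ultimately-map (λ i h → ≤-trans h (≤-by 0≤1 refl)) (proj₂ (proj₂ B))

  ¼δ⁻¹ = inverse (CauchyProperties.half-pos (CauchyProperties.half-pos 0<δ))

  κ = proj₁ ¼δ⁻¹

  0≤κ : 0ℚ ℚ.≤ κ
  0≤κ = <⇒≤ (proj₁ (proj₂ ¼δ⁻¹))

  ¼δκ≡1 : ¼δ ℚ.* κ ≡ 1ℚ
  ¼δκ≡1 = proj₂ (proj₂ ¼δ⁻¹)

  0≤¼δ : 0ℚ ℚ.≤ ¼δ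
  0≤¼δ = <⇒≤ (CauchyProperties.half-pos (CauchyProperties.half-pos 0<δ))

  a = nat 64 ℚ.* b
  K = (a ℚ.+ 1ℚ) ℚ.* (1ℚ ℚ.+ κ)

  0≤a : 0ℚ ℚ.≤ a
  0≤a = 0≤-* (0≤nat 64) (≤-trans 0≤1 1≤b)

  a≤K : a ℚ.≤ K
  a≤K = ≤-by (0≤-+ 0≤1 (0≤-* (0≤-+ 0≤a 0≤1) 0≤κ))
    (solve 2 (λ a k → a :+ (con 1ℚ :+ (a :+ con 1ℚ) :* k) := (a :+ con 1ℚ) :* (con 1ℚ :+ k)) refl a κ)

  a+1≤K¼δ : a ℚ.+ 1ℚ ℚ.≤ K ℚ.* ¼δ
  a+1≤K¼δ = ≤-by (0≤-* (0≤-+ 0≤a 0≤1) 0≤¼δ) (trans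
    (cong (λ z → z ℚ.+ (a ℚ.+ 1ℚ) ℚ.* ¼δ) (sym (trans (cong ((a ℚ.+ 1ℚ) ℚ.*_) ¼δκ≡1) (*-identityʳ (a ℚ.+ 1ℚ)))))
    (solve 3 (λ a d k → (a :+ con 1ℚ) :* (d :* k) :+ (a :+ con 1ℚ) :* d := (a :+ con 1ℚ) :* (con 1ℚ :+ k) :* d) refl
        a ¼δ κ))

  t = nat 2 ℚ.* κ
  -ω = ℚ.- (nat 2 ℚ.* t ℚ.+ nat 6)
  Y = nat 2 ℚ.+ (nat 32 ℚ.* ((b ℚ.+ 1ℚ) ℚ.* (b ℚ.+ 1ℚ) ℚ.* (b ℚ.+ 1ℚ)) ℚ.+ nat 8 ℚ.* ((b ℚ.+ 1ℚ) ℚ.* t))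

  0≤t : 0ℚ ℚ.≤ t
  0≤t = 0≤-* (0≤nat 2) 0≤κ

  2≤[1+t]¼δ : nat 2 ℚ.≤ (1ℚ ℚ.+ t) ℚ.* ¼δ
  2≤[1+t]¼δ = ≤-by 0≤¼δ (trans
    (cong (λ z → z ℚ.+ ¼δ) (sym (trans (cong (nat 2 ℚ.*_) ¼δκ≡1) (*-identityʳ (nat 2)))))
    (solve 2 (λ d k → con (nat 2) :* (d :* k) :+ d := (con 1ℚ :+ con (nat 2) :* k) :* d) refl ¼δ κ))

  0<Y : 0ℚ ℚ.< Y
  0<Y = +-mono-<-≤ (0<nat 1) (0≤-+ (0≤-* (0≤nat 32) (0≤-* (0≤-* 0≤b+1 0≤b+1) 0≤b+1))
      (0≤-* (0≤nat 8) (0≤-* 0≤b+1 0≤t)))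
    where
    0≤b+1 : 0ℚ ℚ.≤ b ℚ.+ 1ℚ
    0≤b+1 = 0≤-+ (≤-trans 0≤1 1≤b) 0≤1

  log-large = log-unbounded 0<Y

  module _ (moments : Eventually (λ n → moment (F n) 2 ≤ C * ∣ moment (F n) 0 ∣)) where

    sparse : Eventually (λ n → fromℚ K < log n - fromℚ (+ m n / n) * moment (F n) 1) →
      Eventually (λ n → ∣ ℙ-connected (F n) - 0ℝ ∣ < ε)
    sparse gap = proj₁ moments ℕ.⊔ proj₁ gap ℕ.⊔ 2 , λ n h →
      let h₁ , h₂ , h₃ = ≤-⊔₃ (proj₁ moments) (proj₁ gap) 2 h
      in sparse-threshold (F n) C ε b K h₃ 1≤b a≤K a+1≤K¼δ 0<δ δ≤ε C≤b (proj₂ moments n h₁) (proj₂ gap n h₂)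

    dense : Eventually (λ n → log n - fromℚ (+ m n / n) * moment (F n) 1 < fromℚ -ω) →
      Eventually (λ n → ∣ ℙ-connected (F n) - 1ℝ ∣ < ε)
    -- `logApprox` takes the predecessor of n as its argument; the summand 2 covers this shift and
    -- also gives n ≥ 2.
    dense gap = proj₁ moments ℕ.⊔ proj₁ gap ℕ.⊔ (2 ℕ.+ proj₁ log-large) , λ n h →
      let h₁ , h₂ , h₃ = ≤-⊔₃ (proj₁ moments) (proj₁ gap) (2 ℕ.+ proj₁ log-large) h
      in dense-threshold (F n) C ε b t (ℕ.≤-trans (ℕ.m≤m+n 2 (proj₁ log-large)) h₃) 1≤b 0≤t 2≤[1+t]¼δ
           (λ i → proj₂ log-large (ℕ.pred n) i (ℕ.≤-trans (ℕ.n≤1+n _) (ℕ.pred-mono-≤ h₃)))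
           0<δ δ≤ε C≤b (proj₂ moments n h₁) (proj₂ gap n h₂)

mainTheorem5 : (m : (n : ℕ) → .⦃ NonZero n ⦄ → ℕ) →
    ⦃ m≥1 : ∀ {n} → .⦃ _ : NonZero n ⦄ → NonZero (m n) ⦄ →
    (F : (n : ℕ) → .⦃ _ : NonZero n ⦄ → ProductDistribution n (m n)) →
    (λ n → moment (F n) 2) ≲ (λ n → moment (F n) 0) →
    ((λ n → log n - fromℚ (+ m n / n) * moment (F n) 1) ⟶+∞ →
    (λ n → ℙ-connected (F n)) ⟶ 0ℝ) ×
    ((λ n → log n - fromℚ (+ m n / n) * moment (F n) 1) ⟶-∞ →
    (λ n → ℙ-connected (F n)) ⟶ 1ℝ)
mainTheorem5 m F (C , moments) =
  -- The rational δ contained in `0ℝ < ε` determines all constants, and divergence of the gap is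
  -- used at a single level: K here, `-ω` in the dense case.
  (λ gap ε (δ , 0<δ , δ≤ε) → Threshold.sparse m F C ε 0<δ δ≤ε moments (gap (fromℚ (Threshold.K m F C ε 0<δ δ≤ε)))) ,
  (λ gap ε (δ , 0<δ , δ≤ε) → Threshold.dense m F C ε 0<δ δ≤ε moments (gap (fromℚ (Threshold.-ω m F C ε 0<δ δ≤ε))))
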